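{- The combinatorial moduli space of Zolotarev polynomials of degree $7$ with simple critical points, passport $(2,2,2)$ and (geometric) Galois group $A_7$ has two connected components, and each component is a projective map (a map on the real projective plane) with $7$ faces, $11$ edges and $5$ vertices.
   Context: A Zolotarev polynomial is a polynomial $p\in\mathbb{C}[z]$ with exactly three pairwise distinct finite critical values $\alpha,\beta,\gamma$. Its critical points are simple if $p'$ has only simple roots. The passport $(k,l,m)$ means that $k$ critical points lie over $\alpha$, $l$ over $\beta$, $m$ over $\gamma$. The Galois group of $p$ is its geometric Galois (monodromy) group. Let $\Delta$ be the triangle with vertices $\alpha,\beta,\gamma$, labelled $\ast,\circ,\bullet$ in counterclockwise order around $\Delta$, and let preimages of vertices carry the same labels. The cactus of $p$ is the plane figure $p^{ -1}(\Delta)$ (a tree-like system of $n=\deg p$ curvilinear triangles, any two disjoint or sharing one vertex, each simple critical point being a common vertex of exactly two triangles), considered up to orientation-preserving homeomorphism of the plane respecting labels. A degenerated cactus is the 3-colored plane tree with $2n$ edges obtained when $\Delta$ degenerates to a segment with one vertex strictly inside the segment between the other two: from a cactus one deletes all arcs joining the two outer labels. The three degenerated cacti obtained in this way (one for each choice of the middle vertex) form the combinatorial border of the cactus; two cacti are neighbours if their borders share a degenerated cactus. From a degenerated cactus with middle label $x$ and outer labels $y,z$, contracting all edges of type $x$–$y$, respectively all edges of type $x$–$z$, gives two plane trees with $n$ edges. Let $G$ be the graph whose vertices are these plane trees (up to isomorphism) and whose edges are the degenerated cacti of the class, an edge joining the two trees obtained from it by contraction (possibly a loop). The combinatorial moduli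 space of the class of polynomials is the map on a closed surface $S$ given by an embedding of $G$ into $S$ whose faces correspond to the cacti of the class, the boundary of the face of a cactus consisting of the edges given by its combinatorial border (so that the neighbour and border relations are preserved).
   Formalization: Cacti are taken up to cyclic relabelling and degenerated cacti up to renaming of colours (rigid labels give 42 cacti, not 14); plane trees are identified only within a component, since some occur in both; polynomials enter through their cacti and monodromy. -}

module Defs where

open import Data.Bool.Base using (Bool; not)
open import Data.Fin.Base using (Fin; _<_)
open import Data.Fin.Permutation as Perm using (Permutation′; _⟨$⟩ʳ_; _⟨$⟩ˡ_; _≈_; _∘ₚ_; inverseˡ; inverseʳ)
open import Data.Fin.Properties using (_<?_)
open import Data.List.Base using (List; []; _∷_; length; filter; allFin; cartesianProduct)
open import Data.List.Relation.Unary.Any using (Any)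
open import Data.Nat.Base using (ℕ; suc; _+_)
open import Data.Nat.Divisibility using (_∣_)
open import Data.Product.Base using (Σ; ∃; ∃₂; _×_; _,_; proj₁; proj₂)
open import Data.Sum.Base using (_⊎_)
open import Function.Base using (_on_)
open import Function.Bundles using (_⇔_; _↔_; Inverse; mk↔ₛ′)
open import Function.Definitions using (Injective)
open import Level using (0ℓ)
open import Relation.Binary.Construct.Closure.ReflexiveTransitive using (Star)
open import Relation.Binary.Core using (Rel)
open import Relation.Binary.PropositionalEquality using (_≡_; _≢_; refl; cong)
open import Relation.Nullary using (¬_)
open import Relation.Nullary.Decidable using (_×-dec_)

-- For bijections of a finite set the reflexive-transitive closure is already
-- symmetric, so these are the orbits of the generated group.
Orbit : ∀ {A : Set} → List (A → A) → Rel A 0ℓ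
Orbit moves = Star (λ a b → Any (λ m → m a ≡ b) moves)

record HasClasses (A : Set) (_~_ : Rel A 0ℓ) (k : ℕ) : Set where
  field
    class     : A → Fin k
    onto      : ∀ c → ∃ λ a → class a ≡ c
    separates : ∀ a b → class a ≡ class b ⇔ a ~ b

------------------------------------------------------------------------
-- Cacti

-- The vertices of Δ in counterclockwise order; next goes counterclockwise.
data Label : Set where
  ∗ ○ ● : Label

next : Label → Label
next ∗ = ○
next ○ = ●
next ● = ∗

prev : Label → Label
prev ∗ = ●
prev ○ = ∗
prev ● = ○

-- For an involution: its 2-cycles, each counted at its smaller element.
twoCycles : ∀ {n} → Permutation′ n → ℕ
twoCycles {n} π = length (filter (λ i → i <? (π ⟨$⟩ʳ i)) (allFin n))

-- The cactus of a degree n polynomial with simple critical points, its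
-- triangles being numbered by Fin n.  As a plane figure it is recorded by
-- turn x i, the triangle following triangle i counterclockwise around the
-- x-vertex of i; these are also the local monodromy permutations.
record Cactus (n : ℕ) : Set where
  field
    turn : Label → Permutation′ n

    simple : ∀ x i → turn x ⟨$⟩ʳ (turn x ⟨$⟩ʳ i) ≡ i

  criticalPoints : Label → ℕ
  criticalPoints x = twoCycles (turn x)

  field
    -- Along the boundary of the figure, the ●-∗ side of triangle i is followed
    -- by the ∗-○ side of turn ∗ i, then by the ○-● side of the ○-neighbour of
    -- that triangle, and so on; the complement of the figure has a single such
    -- boundary walk.  In terms of monodromy: total ramification at infinity.
    -- (π₁ ∘ₚ π₂ applies π₁ first.)  In particular the figure is connected.
    outerWalk : ∀ i j → Orbit (((turn ∗ ∘ₚ turn ○ ∘ₚ turn ●) ⟨$⟩ʳ_) ∷ []) i j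

    -- Each shared vertex joins two triangles, so a connected figure is tree-like
    -- exactly when it has one shared vertex fewer than triangles.
    treeLike : suc (criticalPoints ∗ + criticalPoints ○ + criticalPoints ●) ≡ n

open Cactus public

-- Homeomorphism of cacti.  Going counterclockwise around Δ fixes the labels
-- only up to the choice of the critical value labelled ∗, hence the relabelling,
-- which preserves the cyclic order of the labels.
record _≅ᶜ_ {n : ℕ} (C D : Cactus n) : Set where
  field
    relabel     : Label → Label
    cyclic      : ∀ x → relabel (next x) ≡ next (relabel x)
    triangles   : Permutation′ n
    equivariant : ∀ x i → triangles ⟨$⟩ʳ (turn C x ⟨$⟩ʳ i) ≡ turn D (relabel x) ⟨$⟩ʳ (triangles ⟨$⟩ʳ i)

HasPassport : ∀ {n} → Cactus n → ℕ → ℕ → ℕ → Set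
HasPassport C k l m = criticalPoints C ∗ ≡ k × criticalPoints C ○ ≡ l × criticalPoints C ● ≡ m

data Monodromy {n : ℕ} (C : Cactus n) : Permutation′ n → Set where
  local    : ∀ x → Monodromy C (turn C x)
  identity : Monodromy C Perm.id
  compose  : ∀ {π ρ} → Monodromy C π → Monodromy C ρ → Monodromy C (π ∘ₚ ρ)
  inverse  : ∀ {π} → Monodromy C π → Monodromy C (Perm.flip π)
  respects : ∀ {π ρ} → π ≈ ρ → Monodromy C π → Monodromy C ρ

inversions : ∀ {n} → Permutation′ n → ℕ
inversions {n} π =
  length (filter (λ (i , j) → (i <? j) ×-dec ((π ⟨$⟩ʳ j) <? (π ⟨$⟩ʳ i)))
                 (cartesianProduct (allFin n) (allFin n)))

Even : ∀ {n} → Permutation′ n → Set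
Even π = 2 ∣ inversions π

HasAlternatingGaloisGroup : ∀ {n} → Cactus n → Set
HasAlternatingGaloisGroup C = ∀ π → Monodromy C π ⇔ Even π

-- Degree 7, simple critical points, passport (2,2,2), Galois group A₇.
record A₇-222 (C : Cactus 7) : Set where
  field
    passport    : HasPassport C 2 2 2
    galoisGroup : HasAlternatingGaloisGroup C

------------------------------------------------------------------------
-- Plane graphs and their contraction

-- A plane graph without isolated vertices as a rotation system: rev exchanges
-- the two halves of an edge and rot is the next half-edge counterclockwise
-- around the same vertex.
record PlaneGraph : Set₁ where
  field
    Dart           : Set
    rotation       : Dart ↔ Dart
    rev            : Dart → Dart
    rev-involutive : ∀ d → rev (rev d) ≡ d
    rev-free       : ∀ d → rev d ≢ d

  rot : Dart → Dart
  rot = Inverse.to rotation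

open PlaneGraph public

record _≅_ (G H : PlaneGraph) : Set where
  field
    darts    : Dart G ↔ Dart H
    rot-comm : ∀ d → Inverse.to darts (rot G d) ≡ rot H (Inverse.to darts d)
    rev-comm : ∀ d → Inverse.to darts (rev G d) ≡ rev H (Inverse.to darts d)

record ColouredPlaneGraph : Set₁ where
  field
    graph         : PlaneGraph
    -- The colour of the vertex from which the half-edge starts.
    colour        : Dart graph → Label
    colour-vertex : ∀ d → colour (rot graph d) ≡ colour d

open ColouredPlaneGraph public

-- Colours are matched up to renaming, not necessarily cyclic: when the middle
-- vertex of Δ crosses the segment between the outer ones, the counterclockwise
-- order of the three critical values is reversed.
record _≅₃_ (T U : ColouredPlaneGraph) : Set where
  field
    iso         : graph T ≅ graph U
    rename      : Label ↔ Label
    colour-comm : ∀ d → Inverse.to rename (colour T d) ≡ colour U (Inverse.to (_≅_.darts iso) d)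

OfType : (T : ColouredPlaneGraph) → Label → Label → Dart (graph T) → Set
OfType T x y d =
  (colour T d ≡ x × colour T (rev (graph T) d) ≡ y) ⊎
  (colour T d ≡ y × colour T (rev (graph T) d) ≡ x)

-- The first surviving half-edge met when turning counterclockwise: a contracted
-- edge is run along to its other end, where the turn goes on.
data Survivor (T : ColouredPlaneGraph) (x y : Label) : Rel (Dart (graph T)) 0ℓ where
  stop : ∀ {d} → ¬ OfType T x y d → Survivor T x y d d
  pass : ∀ {d e} → OfType T x y d → Survivor T x y (rot (graph T) (rev (graph T) d)) e → Survivor T x y d e

-- S arises from T by contracting all edges of type x–y.
record Contraction (T : ColouredPlaneGraph) (x y : Label) (S : PlaneGraph) : Set where
  field
    embed     : Dart S → Dart (graph T)
    injective : Injective _≡_ _≡_ embed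
    survives  : ∀ d → ¬ OfType T x y (embed d)
    onto      : ∀ d → ¬ OfType T x y d → ∃ λ e → embed e ≡ d
    rev-comm  : ∀ d → embed (rev S d) ≡ rev (graph T) (embed d)
    rot-comm  : ∀ d → Survivor T x y (rot (graph T) (embed d)) (embed (rot S d))

------------------------------------------------------------------------
-- Degenerated cacti

data Side : Set where
  toNext toPrev : Side

data End : Set where
  inner outer : End

-- The half-edges left in triangle i when the middle label is x: its arcs x–next x
-- and x–prev x, each with its end at x (inner) and its other end (outer).
HalfArc : ℕ → Set
HalfArc n = Fin n × Side × End

outerLabel : Label → Side → Label
outerLabel x toNext = next x
outerLabel x toPrev = prev x

module _ {n : ℕ} (C : Cactus n) (x : Label) where

  private
    -- Counterclockwise inside a triangle with vertices x, next x, prev x in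
    -- counterclockwise order, the arc x–next x comes just before x–prev x.
    turnArc : HalfArc n → HalfArc n
    turnArc (i , toNext , inner) = i , toPrev , inner
    turnArc (i , toPrev , inner) = (turn C x ⟨$⟩ʳ i) , toNext , inner
    turnArc (i , s      , outer) = (turn C (outerLabel x s) ⟨$⟩ʳ i) , s , outer

    turnArc⁻¹ : HalfArc n → HalfArc n
    turnArc⁻¹ (i , toPrev , inner) = i , toNext , inner
    turnArc⁻¹ (i , toNext , inner) = (turn C x ⟨$⟩ˡ i) , toPrev , inner
    turnArc⁻¹ (i , s      , outer) = (turn C (outerLabel x s) ⟨$⟩ˡ i) , s , outer

    invˡ : ∀ d → turnArc (turnArc⁻¹ d) ≡ d
    invˡ (i , toNext , inner) = cong (_, toNext , inner) (inverseʳ (turn C x))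
    invˡ (i , toPrev , inner) = refl
    invˡ (i , toNext , outer) = cong (_, toNext , outer) (inverseʳ (turn C (next x)))
    invˡ (i , toPrev , outer) = cong (_, toPrev , outer) (inverseʳ (turn C (prev x)))

    invʳ : ∀ d → turnArc⁻¹ (turnArc d) ≡ d
    invʳ (i , toNext , inner) = refl
    invʳ (i , toPrev , inner) = cong (_, toPrev , inner) (inverseˡ (turn C x))
    invʳ (i , toNext , outer) = cong (_, toNext , outer) (inverseˡ (turn C (next x)))
    invʳ (i , toPrev , outer) = cong (_, toPrev , outer) (inverseˡ (turn C (prev x)))

    otherEnd : HalfArc n → HalfArc n
    otherEnd (i , s , inner) = i , s , outer
    otherEnd (i , s , outer) = i , s , inner

    otherEnd-involutive : ∀ d → otherEnd (otherEnd d) ≡ d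
    otherEnd-involutive (i , s , inner) = refl
    otherEnd-involutive (i , s , outer) = refl

    otherEnd-free : ∀ d → otherEnd d ≢ d
    otherEnd-free (i , s , inner) ()
    otherEnd-free (i , s , outer) ()

    label : HalfArc n → Label
    label (i , s , inner) = x
    label (i , s , outer) = outerLabel x s

    label-vertex : ∀ d → label (turnArc d) ≡ label d
    label-vertex (i , toNext , inner) = refl
    label-vertex (i , toPrev , inner) = refl
    label-vertex (i , toNext , outer) = refl
    label-vertex (i , toPrev , outer) = refl

  -- The degenerated cactus of C with middle label x: the arcs joining next x
  -- and prev x are deleted.
  degenerate : ColouredPlaneGraph
  degenerate = record
    { graph = record
      { Dart           = HalfArc n
      ; rotation       = mk↔ₛ′ turnArc turnArc⁻¹ invˡ invʳ
      ; rev            = otherEnd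
      ; rev-involutive = otherEnd-involutive
      ; rev-free       = otherEnd-free
      }
    ; colour        = label
    ; colour-vertex = label-vertex
    }

Middle : ColouredPlaneGraph → Label → Set
Middle T x = ∀ d → colour T d ≡ x ⊎ colour T (rev (graph T) d) ≡ x

-- S and S′ are the two contractions of the degenerated cactus T, in some order.
Contractions : ColouredPlaneGraph → PlaneGraph → PlaneGraph → Set
Contractions T S S′ =
  ∃ λ x → ∃₂ λ y z →
    x ≢ y × x ≢ z × y ≢ z × Middle T x × Contraction T x y S × Contraction T x z S′

------------------------------------------------------------------------
-- Maps on closed surfaces

-- A (not necessarily orientable or connected) map on a closed surface, given by
-- its flags, i.e. the triangles of its barycentric subdivision; flipV, flipE and
-- flipF lead to the adjacent flag with another vertex, edge, face.  Freeness
-- says that there is no boundary and that an edge consists of four flags, two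
-- on each of its sides.
record SurfaceMap : Set where
  field
    size : ℕ

  Flag : Set
  Flag = Fin size

  field
    flipV flipE flipF : Flag → Flag
    flipV-involutive  : ∀ f → flipV (flipV f) ≡ f
    flipE-involutive  : ∀ f → flipE (flipE f) ≡ f
    flipF-involutive  : ∀ f → flipF (flipF f) ≡ f
    flipV-free        : ∀ f → flipV f ≢ f
    flipE-free        : ∀ f → flipE f ≢ f
    flipF-free        : ∀ f → flipF f ≢ f
    flipVF-comm       : ∀ f → flipV (flipF f) ≡ flipF (flipV f)
    flipVF-free       : ∀ f → flipV (flipF f) ≢ f

  SameVertex SameEdge SameFace SameComponent : Rel Flag 0ℓ
  SameVertex    = Orbit (flipE ∷ flipF ∷ [])
  SameEdge      = Orbit (flipV ∷ flipF ∷ [])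
  SameFace      = Orbit (flipV ∷ flipE ∷ [])
  SameComponent = Orbit (flipV ∷ flipE ∷ flipF ∷ [])

  Component : Flag → Set
  Component f = ∃ λ g → SameComponent f g

  record HasCounts (f : Flag) (faces edges vertices : ℕ) : Set where
    field
      faceCount   : HasClasses (Component f) (SameFace on proj₁) faces
      edgeCount   : HasClasses (Component f) (SameEdge on proj₁) edges
      vertexCount : HasClasses (Component f) (SameVertex on proj₁) vertices

  Orientable : Flag → Set
  Orientable f = Σ (Flag → Bool) λ sign → ∀ g → SameComponent f g →
    sign (flipV g) ≡ not (sign g) × sign (flipE g) ≡ not (sign g) × sign (flipF g) ≡ not (sign g)

  -- The projective plane: the non-orientable closed surface of Euler
  -- characteristic 1.
  record Projective (f : Flag) : Set where
    field
      faces edges vertices : ℕ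
      counts               : HasCounts f faces edges vertices
      euler                : vertices + faces ≡ suc edges
      nonOrientable        : ¬ Orientable f

------------------------------------------------------------------------
-- The combinatorial moduli space

-- A map whose faces, edges and vertices are labelled with cacti, degenerated
-- cacti and plane trees, labels being constant on a face, edge or vertex up to
-- isomorphism.
record ModuliSpace {n : ℕ} (P : Cactus n → Set) : Set₁ where
  field
    surfaceMap : SurfaceMap

  open SurfaceMap surfaceMap public

  field
    cactus          : Flag → Cactus n
    cactus-in-class : ∀ f → P (cactus f)
    cactus-onto     : ∀ C → P C → ∃ λ f → cactus f ≅ᶜ C
    faces           : ∀ f g → SameFace f g ⇔ cactus f ≅ᶜ cactus g

    degenerated : Flag → ColouredPlaneGraph
    edges       : ∀ f g → SameEdge f g ⇔ degenerated f ≅₃ degenerated g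

    -- The edges on the boundary of a face are those of the border of its cactus.
    boundary⊆border : ∀ f → ∃ λ x → degenerated f ≅₃ degenerate (cactus f) x
    border⊆boundary : ∀ f x → ∃ λ g → SameFace f g × degenerated g ≅₃ degenerate (cactus f) x

    -- Plane trees are identified up to isomorphism within each component of the
    -- surface.  The same tree may label vertices of different components: its
    -- occurrences there are separate points of the surface.
    tree     : Flag → PlaneGraph
    vertices : ∀ f g → SameComponent f g → SameVertex f g ⇔ tree f ≅ tree g
    ends     : ∀ f → Contractions (degenerated f) (tree f) (tree (flipV f))

{-# OPTIONS --safe #-}

-- Numbering its triangles along the outer walk turns a cactus of the class into a
-- factorisation of a fixed 7-cycle into three even involutions. Exhaustion leaves,
-- besides factorisations preserving a Fano plane, whose group is not A₇, fourteen
-- cacti; they have 22 degenerations, and contracting these gives five trees in each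
-- component. As isomorphism of the labels decides whether two flags share a face, an
-- edge or a vertex, the components of any moduli space and their numbers of faces,
-- edges and vertices can be read off from these finite data, without knowing in which
-- order edges follow each other around a face.
--
-- In each component one face lies on both sides of an edge, which is moreover a loop
-- of the map. In an oriented component the two sides of the loop would follow each
-- other in opposite directions on the boundary of the face, and the end of the loop
-- between them would be a vertex distinct from the other end.

module Submission where

open import Defs
import Algebra.Properties.CommutativeMonoid.Sum
open import Data.Bool.Base using (Bool; _xor_; _∧_; _∨_; false; if_then_else_; not; true)
open import Data.Bool.Properties using (not-involutive; not-¬)
open import Data.Empty using (⊥)
open import Data.Fin using (#_)
open import Data.Fin.Base using (Fin; combine; fromℕ<; inject≤; remQuot; suc; toℕ; zero)
open import Data.Fin.Patterns
open import Data.Fin.Permutation as Perm using (Permutation′; _∘ₚ_; _≈_; _⟨$⟩ʳ_; _⟨$⟩ˡ_; inverseʳ; inverseˡ; permutation)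
open import Data.Fin.Properties using (<-asym; <-cmp; <-irrefl; _<?_; _≟_; all?; any?; pigeonhole; toℕ-fromℕ<; toℕ-injective; toℕ-inject≤; toℕ<n)
open import Data.List.Base as List using (List; []; _++_; _∷_; allFin; cartesianProduct; filter; length; map; tabulate)
open import Data.List.Membership.Propositional using (_∈_)
open import Data.List.Membership.Propositional.Properties using (∈-allFin; ∈-concatMap⁺; ∈-filter⁺; ∈-map⁺)
open import Data.List.Properties using (filter-++; length-++; map-tabulate; ≡-dec)
open import Data.List.Relation.Unary.All as All using (All)
open import Data.List.Relation.Unary.Any as Any using (Any; here; there)
open import Data.Nat.Base as ℕ using (NonZero; _*_; _+_; suc; zero; ℕ)
open import Data.Nat.DivMod using (_%_; _/_; m%n<n; m≡m%n+[m/n]*n)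
open import Data.Nat.Divisibility using (_∣?_; _∣_; divides; m∣m*n; ∣m+n∣m⇒∣n; ∣m∣n⇒∣m+n)
open import Data.Nat.Properties using (*-cancelˡ-≡; *-comm; *-distribˡ-+; *-identityˡ; *-zeroʳ; +-0-commutativeMonoid; +-comm; +-identityʳ)
import Data.Nat.Properties as ℕ
open import Data.Nat.Solver using (module +-*-Solver)
open import Data.Product.Base using (_,_; _×_; proj₁; proj₂; ∃; ∃₂)
open import Data.Sum.Base as Sum using (_⊎_; inj₁; inj₂)
open import Data.Unit.Base using (tt; ⊤)
open import Data.Vec.Base as Vec using (Vec; []; _∷_; lookup)
import Data.Vec.Properties as Vec
open import Function.Base using (_on_; _∘_; id)
open import Function.Bundles using (Equivalence; Inverse; _↔_; _⇔_; mk↔ₛ′; mk⇔)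
open import Function.Construct.Composition using (_↔-∘_; _⇔-∘_)
open import Function.Construct.Identity using (↔-id)
open import Function.Construct.Symmetry using (↔-sym; ⇔-sym)
open import Relation.Binary.Construct.Closure.ReflexiveTransitive as Star using (_◅_; _◅◅_; reverse; ε)
open import Relation.Binary.Definitions using (DecidableEquality; tri<; tri>; tri≈)
open import Relation.Binary.PropositionalEquality
open import Relation.Nullary.Decidable using (Dec; _×-dec_; _→-dec_; _⊎-dec_; dec-false; dec-true; does; from-no; map′; no; yes; ¬?)
open import Relation.Nullary.Negation using (contradiction; ¬_)

open Algebra.Properties.CommutativeMonoid.Sum +-0-commutativeMonoid
  using (sum; sum-syntax; sum-cong-≗; sum-replicate-zero; ∑-distrib-+; ∑-comm; ∑-permute)

-- Parity of permutations

-- Two tasks shape the finite part. Isomorphisms must be found: each intertwines two 7-cycles, and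
-- in the symmetric group of seven points a 7-cycle commutes only with its powers, so seven
-- candidates remain once the labels are matched. Non-isomorphisms must be proved: degenerated cacti
-- and plane trees are told apart by the vertex degrees met along their boundary walk, cacti by
-- their borders. There are 392 factorisations of the 7-cycle; 294 = 14 · 3 · 7 come from the
-- fourteen cacti (three cyclic relabellings, seven starting triangles) and the other 98 preserve a
-- Fano plane. That a cactus has group A₇ rests on a word in its turns that is a 3-cycle of
-- consecutive triangles: together with the outer walk it generates A₇. Evenness counts inversions,
-- which depend on the numbering of the triangles, so its invariance under conjugation has to be
-- established. The claim about all moduli spaces is accompanied by an explicit one with 88 flags,
-- four for each of the 22 edges.

indicator : Bool → ℕ
indicator true  = 1
indicator false = 0

count-tabulate : ∀ {n} {A : Set} {P : A → Set} (P? : ∀ a → Dec (P a)) (f : Fin n → A) →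
  length (filter P? (tabulate f)) ≡ ∑[ i < n ] indicator (does (P? (f i)))
count-tabulate {zero}  P? f = refl
count-tabulate {suc n} P? f with does (P? (f zero))
... | true  = cong suc (count-tabulate P? (f ∘ suc))
... | false = count-tabulate P? (f ∘ suc)

count-product : ∀ {m n} {A B : Set} {P : A × B → Set} (P? : ∀ p → Dec (P p)) (f : Fin m → A) (g : Fin n → B) →
  length (filter P? (cartesianProduct (tabulate f) (tabulate g))) ≡
  ∑[ i < m ] ∑[ j < n ] indicator (does (P? (f i , g j)))
count-product {zero}  P? f g = refl
count-product {suc m} P? f g = begin
  length (filter P? (map (f zero ,_) (tabulate g) ++ rest))
    ≡⟨ cong length (filter-++ P? (map (f zero ,_) (tabulate g)) rest) ⟩
  length (filter P? (map (f zero ,_) (tabulate g)) ++ filter P? rest)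
    ≡⟨ length-++ (filter P? (map (f zero ,_) (tabulate g))) ⟩
  length (filter P? (map (f zero ,_) (tabulate g))) + length (filter P? rest)
    ≡⟨ cong (λ xs → length (filter P? xs) + length (filter P? rest)) (map-tabulate g (f zero ,_)) ⟩
  length (filter P? (tabulate (λ j → f zero , g j))) + length (filter P? rest)
    ≡⟨ cong₂ _+_ (count-tabulate P? (λ j → f zero , g j)) (count-product P? (f ∘ suc) g) ⟩
  _ ∎
  where
  open ≡-Reasoning
  rest = cartesianProduct (tabulate (f ∘ suc)) (tabulate g)

module _ {n : ℕ} where

  less : Fin n → Fin n → Bool
  less i j = does (i <? j)

  less-irrefl : ∀ i → less i i ≡ false
  less-irrefl i = dec-false (i <? i) (<-irrefl refl)

  less-flip : ∀ {i j} → i ≢ j → less j i ≡ not (less i j)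
  less-flip {i} {j} i≢j with <-cmp i j
  ... | tri< i<j _ _ = trans (dec-false (j <? i) (<-asym i<j)) (cong not (sym (dec-true (i <? j) i<j)))
  ... | tri≈ _ i≡j _ = contradiction i≡j i≢j
  ... | tri> _ _ j<i = trans (dec-true (j <? i) j<i) (cong not (sym (dec-false (i <? j) (<-asym j<i))))

  ∑² : (Fin n → Fin n → ℕ) → ℕ
  ∑² h = ∑[ i < n ] ∑[ j < n ] h i j

  ∑²-cong : ∀ {h k} → (∀ i j → h i j ≡ k i j) → ∑² h ≡ ∑² k
  ∑²-cong eq = sum-cong-≗ (λ i → sum-cong-≗ (eq i))

  ∑²-+ : ∀ h k → ∑² (λ i j → h i j + k i j) ≡ ∑² h + ∑² k
  ∑²-+ h k = trans (sum-cong-≗ (λ i → ∑-distrib-+ (h i) (k i)))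
                   (∑-distrib-+ (λ i → sum (h i)) (λ i → sum (k i)))

  ∑²-permute : ∀ h (π : Permutation′ n) → ∑² (λ i j → h (π ⟨$⟩ʳ i) (π ⟨$⟩ʳ j)) ≡ ∑² h
  ∑²-permute h π = sym (trans (∑-permute (λ i → sum (h i)) π)
                              (sum-cong-≗ (λ i → ∑-permute (h (π ⟨$⟩ʳ i)) π)))

  ∑< : (Fin n → Fin n → ℕ) → ℕ
  ∑< h = ∑² (λ i j → indicator (less i j) * h i j)

  ∑<-+ : ∀ h k → ∑< (λ i j → h i j + k i j) ≡ ∑< h + ∑< k
  ∑<-+ h k = trans (∑²-cong (λ i j → *-distribˡ-+ (indicator (less i j)) (h i j) (k i j)))
                   (∑²-+ _ _)

  Symmetric₀ : (Fin n → Fin n → ℕ) → Set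
  Symmetric₀ h = (∀ i j → h j i ≡ h i j) × (∀ i → h i i ≡ 0)

  -- Each unordered pair is counted twice in `∑²`, once in either order, and the diagonal
  -- contributes nothing.
  ∑<-double : ∀ {h} → Symmetric₀ h → ∑< h + ∑< h ≡ ∑² h
  ∑<-double {h} (symmetric , h₀) = begin
    ∑< h + ∑< h
      ≡⟨ cong (∑< h +_) (trans (∑-comm (λ i j → indicator (less i j) * h i j))
           (∑²-cong (λ i j → cong (indicator (less j i) *_) (symmetric i j)))) ⟩
    ∑< h + ∑² (λ i j → indicator (less j i) * h i j)
      ≡⟨ ∑²-+ _ _ ⟨
    ∑² (λ i j → indicator (less i j) * h i j + indicator (less j i) * h i j)
      ≡⟨ ∑²-cong either ⟩
    ∑² h ∎
    where
    open ≡-Reasoning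
    either : ∀ i j → indicator (less i j) * h i j + indicator (less j i) * h i j ≡ h i j
    either i j with i ≟ j
    ... | yes refl rewrite h₀ i | *-zeroʳ (indicator (less i i)) = refl
    ... | no  i≢j  rewrite less-flip i≢j with less i j
    ...   | true  rewrite +-identityʳ (h i j) = +-identityʳ (h i j)
    ...   | false = +-identityʳ (h i j)

  -- A permutation permutes the unordered pairs but does not respect the condition i < j; so the
  -- doubled sums, which run over ordered pairs, are compared and then halved.
  ∑<-permute : ∀ {h} → Symmetric₀ h → ∀ (π : Permutation′ n) → ∑< (λ i j → h (π ⟨$⟩ʳ i) (π ⟨$⟩ʳ j)) ≡ ∑< h
  ∑<-permute {h} s@(symmetric , h₀) π = halve (begin
    _ ≡⟨ ∑<-double ((λ i j → symmetric (π ⟨$⟩ʳ i) (π ⟨$⟩ʳ j)) , (λ i → h₀ (π ⟨$⟩ʳ i))) ⟩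
    _ ≡⟨ ∑²-permute h π ⟩
    _ ≡⟨ ∑<-double s ⟨
    _ ∎)
    where
    open ≡-Reasoning
    halve : ∀ {a b} → a + a ≡ b + b → a ≡ b
    halve {a} {b} eq = *-cancelˡ-≡ a b 2 (trans (cong (a +_) (+-identityʳ a)) (trans eq (cong (b +_) (sym (+-identityʳ b)))))

  -- The `xor` makes this symmetric in i and j, hence a function of the unordered pair.
  reverses : Permutation′ n → Fin n → Fin n → Bool
  reverses π i j = less i j xor less (π ⟨$⟩ʳ i) (π ⟨$⟩ʳ j)

  permutation-injective : ∀ (π : Permutation′ n) {i j} → π ⟨$⟩ʳ i ≡ π ⟨$⟩ʳ j → i ≡ j
  permutation-injective π eq = trans (sym (inverseˡ π)) (trans (cong (π ⟨$⟩ˡ_) eq) (inverseˡ π))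

  reverses-symmetric : ∀ π → Symmetric₀ (λ i j → indicator (reverses π i j))
  reverses-symmetric π = (λ i j → cong indicator (swap i j)) , λ i → cong indicator (diagonal i)
    where
    diagonal : ∀ i → reverses π i i ≡ false
    diagonal i rewrite less-irrefl i | less-irrefl (π ⟨$⟩ʳ i) = refl
    swap : ∀ i j → reverses π j i ≡ reverses π i j
    swap i j with i ≟ j
    ... | yes refl = refl
    ... | no  i≢j rewrite less-flip i≢j | less-flip (i≢j ∘ permutation-injective π)
      with less i j | less (π ⟨$⟩ʳ i) (π ⟨$⟩ʳ j)
    ...   | true  | true  = refl
    ...   | true  | false = refl
    ...   | false | true  = refl
    ...   | false | false = refl

  inversions-∑ : ∀ π → inversions π ≡ ∑< (λ i j → indicator (reverses π i j))
  inversions-∑ π = trans (count-product (λ (i , j) → (i <? j) ×-dec ((π ⟨$⟩ʳ j) <? (π ⟨$⟩ʳ i))) id id)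
                         (∑²-cong pointwise)
    where
    pointwise : ∀ i j → indicator (less i j ∧ less (π ⟨$⟩ʳ j) (π ⟨$⟩ʳ i)) ≡
                        indicator (less i j) * indicator (reverses π i j)
    pointwise i j with i ≟ j
    ... | yes refl rewrite less-irrefl i = refl
    ... | no  i≢j rewrite less-flip (i≢j ∘ permutation-injective π) with less i j
    ...   | true  = sym (*-identityˡ _)
    ...   | false = refl

  -- A pair is reversed by the composite exactly when one of the two steps, but not both, reverses
  -- it. So the three indicators of a pair add up to 0 or 2, namely twice the indicator of
  -- `a i j ∨ b i j`; the inversions of ρ are reindexed along π by `∑<-permute`.
  inversions-∘ : ∀ π ρ → 2 ∣ inversions (π ∘ₚ ρ) + (inversions π + inversions ρ)
  inversions-∘ π ρ = divides (∑< (λ i j → indicator (a i j ∨ b i j))) (begin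
      inversions (π ∘ₚ ρ) + (inversions π + inversions ρ)
        ≡⟨ cong₂ _+_ (inversions-∑ (π ∘ₚ ρ)) (cong₂ _+_ (inversions-∑ π)
             (trans (inversions-∑ ρ) (sym (∑<-permute (reverses-symmetric ρ) π)))) ⟩
      ∑< (λ i j → indicator (reverses (π ∘ₚ ρ) i j)) + (∑< (λ i j → indicator (a i j)) + ∑< (λ i j → indicator (b i j)))
        ≡⟨ cong (∑< (λ i j → indicator (reverses (π ∘ₚ ρ) i j)) +_) (∑<-+ _ _) ⟨
      ∑< (λ i j → indicator (reverses (π ∘ₚ ρ) i j)) + ∑< (λ i j → indicator (a i j) + indicator (b i j))
        ≡⟨ ∑<-+ _ _ ⟨
      ∑< (λ i j → indicator (reverses (π ∘ₚ ρ) i j) + (indicator (a i j) + indicator (b i j)))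
        ≡⟨ ∑²-cong (λ i j → cong (indicator (less i j) *_) (pointwise i j)) ⟩
      ∑< (λ i j → indicator (a i j ∨ b i j) + indicator (a i j ∨ b i j))
        ≡⟨ ∑<-+ _ _ ⟩
      K + K
        ≡⟨ cong (K +_) (+-identityʳ K) ⟨
      2 * K
        ≡⟨ *-comm 2 K ⟩
      K * 2 ∎)
    where
    open ≡-Reasoning
    a b : Fin n → Fin n → Bool
    a = reverses π
    b i j = reverses ρ (π ⟨$⟩ʳ i) (π ⟨$⟩ʳ j)
    K : ℕ
    K = ∑< (λ i j → indicator (a i j ∨ b i j))
    pointwise : ∀ i j → indicator (reverses (π ∘ₚ ρ) i j) + (indicator (a i j) + indicator (b i j)) ≡
                        indicator (a i j ∨ b i j) + indicator (a i j ∨ b i j)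
    pointwise i j with less i j | less (π ⟨$⟩ʳ i) (π ⟨$⟩ʳ j) | less (ρ ⟨$⟩ʳ (π ⟨$⟩ʳ i)) (ρ ⟨$⟩ʳ (π ⟨$⟩ʳ j))
    ... | true  | true  | true  = refl
    ... | true  | true  | false = refl
    ... | true  | false | true  = refl
    ... | true  | false | false = refl
    ... | false | true  | true  = refl
    ... | false | true  | false = refl
    ... | false | false | true  = refl
    ... | false | false | false = refl

  inversions-cong : ∀ {π ρ : Permutation′ n} → π ≈ ρ → inversions π ≡ inversions ρ
  inversions-cong {π} {ρ} eq = trans (inversions-∑ π) (trans (∑²-cong pointwise) (sym (inversions-∑ ρ)))
    where
    pointwise : ∀ i j → indicator (less i j) * indicator (reverses π i j) ≡
                        indicator (less i j) * indicator (reverses ρ i j)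
    pointwise i j rewrite eq i | eq j = refl

  Even-respects : ∀ (π ρ : Permutation′ n) → π ≈ ρ → Even π → Even ρ
  Even-respects π ρ eq = subst (2 ∣_) (inversions-cong {π} {ρ} eq)

  Even-∘ : ∀ (π ρ : Permutation′ n) → Even π → Even ρ → Even (π ∘ₚ ρ)
  Even-∘ π ρ π-even ρ-even =
    ∣m+n∣m⇒∣n (subst (2 ∣_) (+-comm (inversions (π ∘ₚ ρ)) _) (inversions-∘ π ρ)) (∣m∣n⇒∣m+n π-even ρ-even)

  Even-id : Even {n} Perm.id
  Even-id = subst (2 ∣_) (sym (trans (inversions-∑ Perm.id) (trans (∑²-cong pointwise) zeros))) (divides 0 refl)
    where
    pointwise : ∀ i j → indicator (less i j) * indicator (less i j xor less i j) ≡ 0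
    pointwise i j with less i j
    ... | true  = refl
    ... | false = refl
    zeros : ∑² (λ _ _ → 0) ≡ 0
    zeros = trans (sum-cong-≗ {n} (λ i → sum-replicate-zero n)) (sum-replicate-zero n)

  -- inv (π ∘ₚ π⁻¹) + (inv π + inv π⁻¹) is even, and so is the first summand.
  inversions-flip : ∀ π → 2 ∣ inversions π + inversions (Perm.flip π)
  inversions-flip π = ∣m+n∣m⇒∣n (inversions-∘ π (Perm.flip π))
    (Even-respects Perm.id (π ∘ₚ Perm.flip π) (λ i → sym (inverseˡ π)) Even-id)

  Even-flip : ∀ (π : Permutation′ n) → Even π → Even (Perm.flip π)
  Even-flip π = ∣m+n∣m⇒∣n (inversions-flip π)

  -- Modulo 2 the inversions of φ and of its inverse cancel. This makes evenness independent of the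
  -- numbering of the triangles.
  Even-conjugate : ∀ (φ π : Permutation′ n) → Even π → Even (Perm.flip φ ∘ₚ π ∘ₚ φ)
  Even-conjugate φ π π-even = ∣m+n∣m⇒∣n
    (subst (2 ∣_) (+-comm (inversions (Perm.flip φ ∘ₚ π ∘ₚ φ)) (x + y)) (inversions-∘ (Perm.flip φ) (π ∘ₚ φ)))
    (∣m+n∣m⇒∣n (subst (2 ∣_) rearranged (∣m∣n⇒∣m+n (inversions-∘ π φ) (inversions-flip φ)))
               (∣m∣n⇒∣m+n π-even (m∣m*n z)))
    where
    x y z p : ℕ
    x = inversions (Perm.flip φ)
    y = inversions (π ∘ₚ φ)
    z = inversions φ
    p = inversions π
    open +-*-Solver
    rearranged : (y + (p + z)) + (z + x) ≡ (p + 2 * z) + (x + y)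
    rearranged = solve 4 (λ x y z p → (y :+ (p :+ z)) :+ (z :+ x) := (p :+ con 2 :* z) :+ (x :+ y)) refl x y z p

-- Decisions by exhaustive evaluation

opaque
  -- Only the boolean of the decision is evaluated; being opaque, the proof obtained is never
  -- unfolded later.
  decide : {A : Set} (A? : Dec A) → does A? ≡ true → A
  decide (yes a) refl = a

allLabels? : {P : Label → Set} → (∀ x → Dec (P x)) → Dec (∀ x → P x)
allLabels? {P} P? = map′ join (λ p → p ∗ , p ○ , p ●) (P? ∗ ×-dec P? ○ ×-dec P? ●)
  where
  join : P ∗ × P ○ × P ● → ∀ x → P x
  join (p , _ , _) ∗ = p
  join (_ , p , _) ○ = p
  join (_ , _ , p) ● = p

-- The cacti of the class, triangles being numbered along the outer walk

-- The first index is the component of the moduli space; the last cactus of each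
-- component is the one that is its own neighbour.
Face : Set
Face = Fin 2 × Fin 7

allFaces? : {P : Face → Set} → (∀ c → Dec (P c)) → Dec (∀ c → P c)
allFaces? P? = map′ (λ p (k , c) → p k c) (λ p k c → p (k , c)) (all? λ k → all? λ c → P? (k , c))

-- For each cactus the turns at ∗, ○ and ●, each exchanging two pairs of triangles. The numbering is
-- such that the outer walk is `rot₇`; of the 21 normalised forms of a cactus (seven starting
-- triangles, three cyclic relabellings) one is listed.
turnTable : Vec (Vec (Vec (Vec (Fin 7) 7) 3) 7) 2
turnTable =
  (((0F ∷ 1F ∷ 2F ∷ 4F ∷ 3F ∷ 6F ∷ 5F ∷ []) ∷ (0F ∷ 5F ∷ 3F ∷ 2F ∷ 4F ∷ 1F ∷ 6F ∷ []) ∷ (1F ∷ 0F ∷ 5F ∷ 3F ∷ 4F ∷ 2F ∷ 6F ∷ []) ∷ []) ∷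
   ((0F ∷ 1F ∷ 2F ∷ 4F ∷ 3F ∷ 6F ∷ 5F ∷ []) ∷ (1F ∷ 0F ∷ 5F ∷ 3F ∷ 4F ∷ 2F ∷ 6F ∷ []) ∷ (2F ∷ 1F ∷ 0F ∷ 5F ∷ 4F ∷ 3F ∷ 6F ∷ []) ∷ []) ∷
   ((0F ∷ 1F ∷ 2F ∷ 4F ∷ 3F ∷ 6F ∷ 5F ∷ []) ∷ (2F ∷ 1F ∷ 0F ∷ 5F ∷ 4F ∷ 3F ∷ 6F ∷ []) ∷ (3F ∷ 2F ∷ 1F ∷ 0F ∷ 4F ∷ 5F ∷ 6F ∷ []) ∷ []) ∷
   ((0F ∷ 1F ∷ 2F ∷ 4F ∷ 3F ∷ 6F ∷ 5F ∷ []) ∷ (3F ∷ 2F ∷ 1F ∷ 0F ∷ 4F ∷ 5F ∷ 6F ∷ []) ∷ (5F ∷ 3F ∷ 2F ∷ 1F ∷ 4F ∷ 0F ∷ 6F ∷ []) ∷ []) ∷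
   ((0F ∷ 1F ∷ 2F ∷ 4F ∷ 3F ∷ 6F ∷ 5F ∷ []) ∷ (5F ∷ 3F ∷ 2F ∷ 1F ∷ 4F ∷ 0F ∷ 6F ∷ []) ∷ (0F ∷ 5F ∷ 3F ∷ 2F ∷ 4F ∷ 1F ∷ 6F ∷ []) ∷ []) ∷
   ((0F ∷ 1F ∷ 6F ∷ 3F ∷ 5F ∷ 4F ∷ 2F ∷ []) ∷ (0F ∷ 2F ∷ 1F ∷ 4F ∷ 3F ∷ 5F ∷ 6F ∷ []) ∷ (1F ∷ 0F ∷ 2F ∷ 6F ∷ 4F ∷ 5F ∷ 3F ∷ []) ∷ []) ∷
   ((0F ∷ 1F ∷ 2F ∷ 6F ∷ 5F ∷ 4F ∷ 3F ∷ []) ∷ (1F ∷ 0F ∷ 3F ∷ 2F ∷ 4F ∷ 5F ∷ 6F ∷ []) ∷ (2F ∷ 1F ∷ 0F ∷ 3F ∷ 6F ∷ 5F ∷ 4F ∷ []) ∷ []) ∷ []) ∷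
  (((0F ∷ 1F ∷ 3F ∷ 2F ∷ 4F ∷ 6F ∷ 5F ∷ []) ∷ (0F ∷ 5F ∷ 4F ∷ 3F ∷ 2F ∷ 1F ∷ 6F ∷ []) ∷ (1F ∷ 0F ∷ 5F ∷ 3F ∷ 4F ∷ 2F ∷ 6F ∷ []) ∷ []) ∷
   ((0F ∷ 1F ∷ 3F ∷ 2F ∷ 4F ∷ 6F ∷ 5F ∷ []) ∷ (1F ∷ 0F ∷ 5F ∷ 3F ∷ 4F ∷ 2F ∷ 6F ∷ []) ∷ (2F ∷ 1F ∷ 0F ∷ 3F ∷ 5F ∷ 4F ∷ 6F ∷ []) ∷ []) ∷
   ((0F ∷ 1F ∷ 3F ∷ 2F ∷ 4F ∷ 6F ∷ 5F ∷ []) ∷ (2F ∷ 1F ∷ 0F ∷ 3F ∷ 5F ∷ 4F ∷ 6F ∷ []) ∷ (4F ∷ 2F ∷ 1F ∷ 3F ∷ 0F ∷ 5F ∷ 6F ∷ []) ∷ []) ∷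
   ((0F ∷ 1F ∷ 3F ∷ 2F ∷ 4F ∷ 6F ∷ 5F ∷ []) ∷ (5F ∷ 4F ∷ 2F ∷ 3F ∷ 1F ∷ 0F ∷ 6F ∷ []) ∷ (0F ∷ 5F ∷ 4F ∷ 3F ∷ 2F ∷ 1F ∷ 6F ∷ []) ∷ []) ∷
   ((0F ∷ 1F ∷ 6F ∷ 3F ∷ 5F ∷ 4F ∷ 2F ∷ []) ∷ (1F ∷ 0F ∷ 2F ∷ 4F ∷ 3F ∷ 5F ∷ 6F ∷ []) ∷ (2F ∷ 1F ∷ 0F ∷ 6F ∷ 4F ∷ 5F ∷ 3F ∷ []) ∷ []) ∷
   ((0F ∷ 1F ∷ 6F ∷ 4F ∷ 3F ∷ 5F ∷ 2F ∷ []) ∷ (0F ∷ 2F ∷ 1F ∷ 3F ∷ 4F ∷ 6F ∷ 5F ∷ []) ∷ (1F ∷ 0F ∷ 2F ∷ 5F ∷ 4F ∷ 3F ∷ 6F ∷ []) ∷ []) ∷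
   ((0F ∷ 1F ∷ 3F ∷ 2F ∷ 4F ∷ 6F ∷ 5F ∷ []) ∷ (4F ∷ 2F ∷ 1F ∷ 3F ∷ 0F ∷ 5F ∷ 6F ∷ []) ∷ (5F ∷ 4F ∷ 2F ∷ 3F ∷ 1F ∷ 0F ∷ 6F ∷ []) ∷ []) ∷ []) ∷ []

row : Label → Fin 3
row ∗ = 0F
row ○ = 1F
row ● = 2F

turnOf : Face → Label → Fin 7 → Fin 7
turnOf (k , c) x = lookup (lookup (lookup (lookup turnTable k) c) (row x))

turnOf-involutive : ∀ c x i → turnOf c x (turnOf c x i) ≡ i
turnOf-involutive = decide (allFaces? λ c → allLabels? λ x → all? λ i → _ ≟ _) refl

rot₇ rot₇⁻¹ : Fin 7 → Fin 7
rot₇   = lookup (1F ∷ 2F ∷ 3F ∷ 4F ∷ 5F ∷ 6F ∷ 0F ∷ [])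
rot₇⁻¹ = lookup (6F ∷ 0F ∷ 1F ∷ 2F ∷ 3F ∷ 4F ∷ 5F ∷ [])

walk-rot₇ : ∀ c i → turnOf c ● (turnOf c ○ (turnOf c ∗ i)) ≡ rot₇ i
walk-rot₇ = decide (allFaces? λ c → all? λ i → _ ≟ _) refl

iterate : {A : Set} → (A → A) → ℕ → A → A
iterate f zero    a = a
iterate f (suc k) a = iterate f k (f a)

iterate-cong : {A : Set} {f g : A → A} → (∀ a → f a ≡ g a) → ∀ k a → iterate f k a ≡ iterate g k a
iterate-cong f≗g zero    a = refl
iterate-cong {f = f} {g} f≗g (suc k) a = trans (iterate-cong f≗g k (f a)) (cong (iterate g k) (f≗g a))

iterate-orbit : {A : Set} (f : A → A) → ∀ k a → Orbit (f ∷ []) a (iterate f k a)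
iterate-orbit f zero    a = ε
iterate-orbit f (suc k) a = here refl ◅ iterate-orbit f k (f a)

rot₇-transitive : ∀ i j → ∃ λ (k : Fin 7) → iterate rot₇ (toℕ k) i ≡ j
rot₇-transitive = decide (all? λ i → all? λ j → any? λ k → _ ≟ _) refl

turnPerm : Face → Label → Permutation′ 7
turnPerm c x = permutation (turnOf c x) (turnOf c x) (turnOf-involutive c x) (turnOf-involutive c x)

turnPerm-twoCycles : ∀ c x → twoCycles (turnPerm c x) ≡ 2
turnPerm-twoCycles = decide (allFaces? λ c → allLabels? λ x → _ ℕ.≟ _) refl

rep : Face → Cactus 7
rep c = record
  { turn      = turnPerm c
  ; simple    = turnOf-involutive c
  ; outerWalk = λ i j → let k , walk≡j = rot₇-transitive i j in
      subst (Orbit _ i) (trans (iterate-cong (walk-rot₇ c) (toℕ k) i) walk≡j) (iterate-orbit _ (toℕ k) i)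
  ; treeLike  = cong suc (cong₂ ℕ._+_ (cong₂ ℕ._+_ (turnPerm-twoCycles c ∗) (turnPerm-twoCycles c ○)) (turnPerm-twoCycles c ●))
  }

-- The alternating group

cycle₇ : Permutation′ 7
cycle₇ = permutation rot₇ rot₇⁻¹ (decide (all? λ i → _ ≟ _) refl) (decide (all? λ i → _ ≟ _) refl)

threeCycle₀ : Permutation′ 7
threeCycle₀ = permutation (lookup (1F ∷ 2F ∷ 0F ∷ 3F ∷ 4F ∷ 5F ∷ 6F ∷ []))
                          (lookup (2F ∷ 0F ∷ 1F ∷ 3F ∷ 4F ∷ 5F ∷ 6F ∷ []))
                          (decide (all? λ i → _ ≟ _) refl) (decide (all? λ i → _ ≟ _) refl)

shift : ℕ → Permutation′ 7
shift zero    = Perm.id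
shift (suc k) = cycle₇ ∘ₚ shift k

-- The 3-cycle k ↦ k + 1 ↦ k + 2 ↦ k.
threeCycle : Fin 5 → Permutation′ 7
threeCycle k = Perm.flip (shift (toℕ k)) ∘ₚ threeCycle₀ ∘ₚ shift (toℕ k)

threeCycle-even : ∀ k → Even (threeCycle k)
threeCycle-even = decide (all? λ k → 2 ∣? inversions (threeCycle k)) refl

product : List (Fin 5) → Permutation′ 7
product []       = Perm.id
product (k ∷ ks) = threeCycle k ∘ₚ product ks

-- Moves j down to k, two steps at a time, without moving any point below k.
sink : ℕ → Fin 5 → Fin 7 → List (Fin 5)
sink zero       _ _ = []
sink (suc fuel) k j with does (suc (toℕ k) ℕ.<? toℕ j)
... | true  = let t = fromℕ-pred2 j in t ∷ sink fuel k (threeCycle t ⟨$⟩ʳ j)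
  where
  fromℕ-pred2 : Fin 7 → Fin 5
  fromℕ-pred2 = lookup (0F ∷ 0F ∷ 0F ∷ 1F ∷ 2F ∷ 3F ∷ 4F ∷ [])
... | false with does (toℕ k ℕ.<? toℕ j)
...   | true  = k ∷ k ∷ []
...   | false = []

-- Fuel 3 suffices: the longest descents are 6, 4, 2, 0 and 5, 3, 1, 0. A last step from k + 1 to k
-- passes through k + 2, by two applications of the 3-cycle starting at k.
Sinks : Fin 5 → Fin 7 → Set
Sinks k j = toℕ (product (sink 3 k j) ⟨$⟩ʳ j) ≡ toℕ k × (∀ i → toℕ i ℕ.< toℕ k → product (sink 3 k j) ⟨$⟩ʳ i ≡ i)

sink-correct : ∀ k j → toℕ k ℕ.≤ toℕ j → Sinks k j
sink-correct = decide (all? λ k → all? λ j → toℕ k ℕ.≤? toℕ j →-dec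
  ((_ ℕ.≟ _) ×-dec (all? λ i → toℕ i ℕ.<? toℕ k →-dec (_ ≟ _)))) refl

transposition₅₆ : Permutation′ 7
transposition₅₆ = permutation t t t-involutive t-involutive
  where
  t : Fin 7 → Fin 7
  t = lookup (0F ∷ 1F ∷ 2F ∷ 3F ∷ 4F ∷ 6F ∷ 5F ∷ [])
  t-involutive : ∀ i → t (t i) ≡ i
  t-involutive = decide (all? λ i → _ ≟ _) refl

transposition₅₆-odd : ¬ Even transposition₅₆
transposition₅₆-odd = from-no (2 ∣? inversions transposition₅₆)

FixesBelow : ℕ → Permutation′ 7 → Set
FixesBelow k π = ∀ i → toℕ i ℕ.< k → π ⟨$⟩ʳ i ≡ i

fixes≥ : ∀ {k} π → FixesBelow k π → ∀ i → k ℕ.≤ toℕ i → k ℕ.≤ toℕ (π ⟨$⟩ʳ i)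
fixes≥ {k} π fixes i k≤i = ℕ.≮⇒≥ λ πi<k →
  ℕ.<⇒≱ (subst (ℕ._< k) (cong toℕ (permutation-injective π (fixes (π ⟨$⟩ʳ i) πi<k))) πi<k) k≤i

5F⊎6F : ∀ (i : Fin 7) → 5 ℕ.≤ toℕ i → i ≡ 5F ⊎ i ≡ 6F
5F⊎6F = decide (all? λ i → 5 ℕ.≤? toℕ i →-dec ((i ≟ 5F) ⊎-dec (i ≟ 6F))) refl

-- Only the points 5 and 6 are left to be permuted, and their transposition is odd.
even-fixing-five : ∀ π → Even π → FixesBelow 5 π → π ≈ Perm.id
even-fixing-five π π-even fixes = λ where
    0F → fixes 0F (decide (1 ℕ.≤? 5) refl)
    1F → fixes 1F (decide (2 ℕ.≤? 5) refl)
    2F → fixes 2F (decide (3 ℕ.≤? 5) refl)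
    3F → fixes 3F (decide (4 ℕ.≤? 5) refl)
    4F → fixes 4F (decide (5 ℕ.≤? 5) refl)
    5F → fixes-5
    6F → fixes-6
  where
  five : π ⟨$⟩ʳ 5F ≡ 5F ⊎ π ⟨$⟩ʳ 5F ≡ 6F
  five = 5F⊎6F _ (fixes≥ π fixes 5F (decide (5 ℕ.≤? 5) refl))
  six : π ⟨$⟩ʳ 6F ≡ 5F ⊎ π ⟨$⟩ʳ 6F ≡ 6F
  six = 5F⊎6F _ (fixes≥ π fixes 6F (decide (5 ℕ.≤? 6) refl))
  collision : ∀ {a} → π ⟨$⟩ʳ 5F ≡ a → π ⟨$⟩ʳ 6F ≢ a
  collision π5 π6 = contradiction (permutation-injective π (trans π5 (sym π6))) λ ()
  fixes-5 : π ⟨$⟩ʳ 5F ≡ 5F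
  fixes-5 with five | six
  ... | inj₁ π5 | _       = π5
  ... | inj₂ π5 | inj₂ π6 = contradiction π6 (collision π5)
  ... | inj₂ π5 | inj₁ π6 = contradiction (Even-respects π transposition₅₆ π-swap π-even) transposition₅₆-odd
    where
    π-swap : π ≈ transposition₅₆
    π-swap 0F = fixes 0F (decide (1 ℕ.≤? 5) refl)
    π-swap 1F = fixes 1F (decide (2 ℕ.≤? 5) refl)
    π-swap 2F = fixes 2F (decide (3 ℕ.≤? 5) refl)
    π-swap 3F = fixes 3F (decide (4 ℕ.≤? 5) refl)
    π-swap 4F = fixes 4F (decide (5 ℕ.≤? 5) refl)
    π-swap 5F = π5
    π-swap 6F = π6
  fixes-6 : π ⟨$⟩ʳ 6F ≡ 6F
  fixes-6 with six
  ... | inj₁ π6 = contradiction π6 (collision fixes-5)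
  ... | inj₂ π6 = π6

record Sifted (π : Permutation′ 7) (k : ℕ) : Set where
  field
    word  : List (Fin 5)
    fixes : FixesBelow k (π ∘ₚ product word)

product-++ : ∀ ks ls i → product (ks List.++ ls) ⟨$⟩ʳ i ≡ product ls ⟨$⟩ʳ (product ks ⟨$⟩ʳ i)
product-++ []       ls i = refl
product-++ (k ∷ ks) ls i = product-++ ks ls (threeCycle k ⟨$⟩ʳ i)

product-even : ∀ ks → Even (product ks)
product-even []       = Even-id {7}
product-even (k ∷ ks) = Even-∘ (threeCycle k) (product ks) (threeCycle-even k) (product-even ks)

-- Elimination along the chain of stabilisers: once the points below k are fixed, the image of k is
-- at least k and is brought back to k by 3-cycles that leave the points below k alone. It stops at
-- 5, as a 3-cycle k, k + 1, k + 2 needs k ≤ 4.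
sift : ∀ π k → k ℕ.≤ 5 → Sifted π k
sift π zero    _   = record { word = [] ; fixes = λ _ () }
sift π (suc k) k<5 = record { word = word List.++ sink 3 k′ j ; fixes = fixes′ }
  where
  open Sifted (sift π k (ℕ.<⇒≤ k<5))
  k′ : Fin 5
  k′ = fromℕ< k<5
  k≡ : toℕ k′ ≡ k
  k≡ = toℕ-fromℕ< k<5
  k″ : Fin 7
  k″ = inject≤ k′ (decide (5 ℕ.≤? 7) refl)
  k″≡ : toℕ k″ ≡ k
  k″≡ = trans (toℕ-inject≤ k′ _) k≡
  ρ : Permutation′ 7
  ρ = π ∘ₚ product word
  j : Fin 7
  j = ρ ⟨$⟩ʳ k″
  sinks : Sinks k′ j
  sinks = sink-correct k′ j (subst (ℕ._≤ toℕ j) (sym k≡) (fixes≥ ρ fixes k″ (ℕ.≤-reflexive (sym k″≡))))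
  fixes′ : FixesBelow (suc k) (π ∘ₚ product (word List.++ sink 3 k′ j))
  fixes′ i i<1+k = trans (product-++ word (sink 3 k′ j) (π ⟨$⟩ʳ i)) (case (ℕ.m<1+n⇒m<n∨m≡n i<1+k))
    where
    case : toℕ i ℕ.< k ⊎ toℕ i ≡ k → product (sink 3 k′ j) ⟨$⟩ʳ (ρ ⟨$⟩ʳ i) ≡ i
    case (inj₁ i<k) = trans (cong (product (sink 3 k′ j) ⟨$⟩ʳ_) (fixes i i<k))
                            (proj₂ sinks i (subst (toℕ i ℕ.<_) (sym k≡) i<k))
    case (inj₂ i≡k) = trans (cong (λ i → product (sink 3 k′ j) ⟨$⟩ʳ (ρ ⟨$⟩ʳ i)) i≡k″)
                            (toℕ-injective (trans (proj₁ sinks) (trans k≡ (sym i≡k))))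
      where
      i≡k″ : i ≡ k″
      i≡k″ = toℕ-injective (trans i≡k (sym k″≡))

even⇒product : ∀ π → Even π → ∃ λ ks → π ∘ₚ product ks ≈ Perm.id
even⇒product π π-even = word ,
  even-fixing-five (π ∘ₚ product word) (Even-∘ π (product word) π-even (product-even word)) fixes
  where open Sifted (sift π 5 ℕ.≤-refl)

module _ (C : Cactus 7) where

  Monodromy-shift : Monodromy C cycle₇ → ∀ k → Monodromy C (shift k)
  Monodromy-shift m zero    = identity
  Monodromy-shift m (suc k) = compose m (Monodromy-shift m k)

  Monodromy-product : Monodromy C cycle₇ → Monodromy C threeCycle₀ → ∀ ks → Monodromy C (product ks)
  Monodromy-product m t []       = identity
  Monodromy-product m t (k ∷ ks) =
    compose (compose (inverse s) (compose t s)) (Monodromy-product m t ks)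
    where
    s : Monodromy C (shift (toℕ k))
    s = Monodromy-shift m (toℕ k)

  -- Conjugating one 3-cycle of consecutive points by powers of the 7-cycle gives all the 3-cycles
  -- used in sifting.
  even⇒monodromy : Monodromy C cycle₇ → Monodromy C threeCycle₀ → ∀ π → Even π → Monodromy C π
  even⇒monodromy m t π π-even =
    let ks , π∘ks≈id = even⇒product π π-even
    in respects (λ i → permutation-injective (product ks) (trans (inverseʳ (product ks)) (sym (π∘ks≈id i))))
                (inverse (Monodromy-product m t ks))

  monodromy⇒even : (∀ x → Even (turn C x)) → ∀ {π} → Monodromy C π → Even π
  monodromy⇒even e (local x)               = e x
  monodromy⇒even e identity                = Even-id {7}
  monodromy⇒even e (compose {π} {ρ} m n)   = Even-∘ π ρ (monodromy⇒even e m) (monodromy⇒even e n)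
  monodromy⇒even e (inverse {π} m)         = Even-flip π (monodromy⇒even e m)
  monodromy⇒even e (respects {π} {ρ} eq m) = Even-respects π ρ eq (monodromy⇒even e m)

  evaluate : List Label → Permutation′ 7
  evaluate []       = Perm.id
  evaluate (x ∷ xs) = turn C x ∘ₚ evaluate xs

  Monodromy-evaluate : ∀ xs → Monodromy C (evaluate xs)
  Monodromy-evaluate []       = identity
  Monodromy-evaluate (x ∷ xs) = compose (local x) (Monodromy-evaluate xs)

-- Words in the local monodromies (the leftmost acts first) equal to the 3-cycle
-- 0 ↦ 1 ↦ 2 ↦ 0, found by a search of the Cayley graph.
threeCycleWord : Face → List Label
threeCycleWord (k , c) = lookup (lookup words k) c
  where
  words : Vec (Vec (List Label) 7) 2
  words =
   ((∗ ∷ ● ∷ ∗ ∷ ○ ∷ ● ∷ ○ ∷ ∗ ∷ ● ∷ ∗ ∷ ● ∷ ○ ∷ ● ∷ ○ ∷ []) ∷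
   (○ ∷ ∗ ∷ ● ∷ ∗ ∷ ● ∷ ○ ∷ ∗ ∷ ● ∷ ∗ ∷ ● ∷ ○ ∷ ● ∷ []) ∷
   (○ ∷ ● ∷ ∗ ∷ ○ ∷ ∗ ∷ ○ ∷ ● ∷ ∗ ∷ ○ ∷ ∗ ∷ ○ ∷ ● ∷ []) ∷
   (∗ ∷ ● ∷ ○ ∷ ● ∷ ○ ∷ ∗ ∷ ○ ∷ ∗ ∷ ● ∷ ○ ∷ ● ∷ ∗ ∷ ○ ∷ []) ∷
   (∗ ∷ ● ∷ ○ ∷ ● ∷ ∗ ∷ ○ ∷ ∗ ∷ ● ∷ ○ ∷ ∗ ∷ ● ∷ ∗ ∷ ○ ∷ ● ∷ ○ ∷ []) ∷
   (● ∷ ∗ ∷ ○ ∷ ● ∷ ○ ∷ ∗ ∷ ● ∷ ∗ ∷ ○ ∷ ∗ ∷ ● ∷ ∗ ∷ ○ ∷ ● ∷ ○ ∷ ∗ ∷ []) ∷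
   (∗ ∷ ○ ∷ ∗ ∷ ● ∷ ○ ∷ ● ∷ ∗ ∷ ○ ∷ ● ∷ ○ ∷ ● ∷ ∗ ∷ ○ ∷ []) ∷ []) ∷
   ((● ∷ ○ ∷ ∗ ∷ ● ∷ ∗ ∷ ○ ∷ ∗ ∷ ● ∷ ∗ ∷ ● ∷ []) ∷
   (● ∷ ∗ ∷ ○ ∷ ∗ ∷ ● ∷ ∗ ∷ ○ ∷ ∗ ∷ []) ∷
   (∗ ∷ ○ ∷ ∗ ∷ ● ∷ ∗ ∷ ● ∷ ○ ∷ ∗ ∷ []) ∷
   (○ ∷ ● ∷ ○ ∷ ∗ ∷ ● ∷ ○ ∷ ∗ ∷ ○ ∷ ∗ ∷ ● ∷ ∗ ∷ ○ ∷ []) ∷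
   (∗ ∷ ○ ∷ ∗ ∷ ○ ∷ ● ∷ ○ ∷ ∗ ∷ ○ ∷ ∗ ∷ ○ ∷ ● ∷ ○ ∷ []) ∷
   (○ ∷ ∗ ∷ ● ∷ ∗ ∷ ○ ∷ ● ∷ ○ ∷ ∗ ∷ ● ∷ ∗ ∷ ○ ∷ ● ∷ []) ∷
   (∗ ∷ ○ ∷ ● ∷ ○ ∷ ∗ ∷ ○ ∷ ∗ ∷ ● ∷ ○ ∷ ∗ ∷ []) ∷ []) ∷ []

threeCycleWord-correct : ∀ c i → evaluate (rep c) (threeCycleWord c) ⟨$⟩ʳ i ≡ threeCycle₀ ⟨$⟩ʳ i
threeCycleWord-correct = decide (allFaces? λ c → all? λ i → _ ≟ _) refl

turnPerm-even : ∀ c x → Even (turnPerm c x)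
turnPerm-even = decide (allFaces? λ c → allLabels? λ x → 2 ∣? inversions (turnPerm c x)) refl

rep-in-class : ∀ c → A₇-222 (rep c)
rep-in-class c = record
  { passport    = turnPerm-twoCycles c ∗ , turnPerm-twoCycles c ○ , turnPerm-twoCycles c ●
  ; galoisGroup = λ π → mk⇔ (monodromy⇒even (rep c) (turnPerm-even c))
      (even⇒monodromy (rep c)
        (respects (walk-rot₇ c) (Monodromy-evaluate (rep c) (∗ ∷ ○ ∷ ● ∷ [])))
        (respects (threeCycleWord-correct c) (Monodromy-evaluate (rep c) (threeCycleWord c)))
        π)
  }

-- Numbering the triangles along the outer walk

iterate-+ : {A : Set} (f : A → A) → ∀ j k a → iterate f (j ℕ.+ k) a ≡ iterate f k (iterate f j a)
iterate-+ f zero    k a = refl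
iterate-+ f (suc j) k a = iterate-+ f j k (f a)

iterate-suc : {A : Set} (f : A → A) → ∀ k a → iterate f (suc k) a ≡ f (iterate f k a)
iterate-suc f zero    a = refl
iterate-suc f (suc k) a = iterate-suc f k (f a)

iterate-injective : {A : Set} {f : A → A} → (∀ {a b} → f a ≡ f b → a ≡ b) →
  ∀ k {a b} → iterate f k a ≡ iterate f k b → a ≡ b
iterate-injective inj zero    eq = eq
iterate-injective inj (suc k) eq = inj (iterate-injective inj k eq)

orbit-iterate : {A : Set} {f : A → A} {a b : A} → Orbit (f ∷ []) a b → ∃ λ k → iterate f k a ≡ b
orbit-iterate ε               = zero , refl
orbit-iterate (here refl ◅ s) = let k , eq = orbit-iterate s in suc k , eq

module Numbering (W : Permutation′ 7) (transitive : ∀ i j → Orbit ((W ⟨$⟩ʳ_) ∷ []) i j) where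

  at : ℕ → Fin 7
  at k = iterate (W ⟨$⟩ʳ_) k 0F

  at-+ : ∀ j k → at j ≡ at (j ℕ.+ k) → at k ≡ 0F
  at-+ j k eq = iterate-injective (permutation-injective W) j
    (trans (sym (trans (cong at (ℕ.+-comm j k)) (iterate-+ _ k j 0F))) (sym eq))

  at-periodic : ∀ {d} → at d ≡ 0F → ∀ m k → at (k ℕ.+ m ℕ.* d) ≡ at k
  at-periodic {d} d-period zero    k = cong at (ℕ.+-identityʳ k)
  at-periodic {d} d-period (suc m) k = begin
    at (k ℕ.+ (d ℕ.+ m ℕ.* d)) ≡⟨ cong at (trans (cong (k ℕ.+_) (ℕ.+-comm d (m ℕ.* d))) (trans (sym (ℕ.+-assoc k _ d)) (ℕ.+-comm _ d))) ⟩
    at (d ℕ.+ (k ℕ.+ m ℕ.* d)) ≡⟨ iterate-+ _ d (k ℕ.+ m ℕ.* d) 0F ⟩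
    iterate _ (k ℕ.+ m ℕ.* d) (at d) ≡⟨ cong (iterate _ (k ℕ.+ m ℕ.* d)) d-period ⟩
    at (k ℕ.+ m ℕ.* d) ≡⟨ at-periodic d-period m k ⟩
    at k ∎
    where open ≡-Reasoning

  step : Fin 7 → ℕ
  step j = proj₁ (orbit-iterate (transitive 0F j))

  at-step : ∀ j → at (step j) ≡ j
  at-step j = proj₂ (orbit-iterate (transitive 0F j))

  at-step-% : ∀ {d} .{{_ : NonZero d}} → at d ≡ 0F → ∀ j → at (step j % d) ≡ j
  at-step-% {d} d-period j = begin
    at (step j % d)                        ≡⟨ at-periodic d-period (step j / d) (step j % d) ⟨
    at (step j % d ℕ.+ step j / d ℕ.* d) ≡⟨ cong at (m≡m%n+[m/n]*n (step j) d) ⟨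
    at (step j)                            ≡⟨ at-step j ⟩
    j ∎
    where open ≡-Reasoning

  -- By transitivity every point is some `at m`, and m may be reduced modulo the period; fewer than
  -- seven residues cannot reach seven points.
  period≥7 : ∀ {d} .{{_ : NonZero d}} → at d ≡ 0F → 7 ℕ.≤ d
  period≥7 {d} d-period = ℕ.≮⇒≥ λ d<7 →
    let remainder = λ j → fromℕ< (m%n<n (step j) d)
        at-remainder : ∀ j → at (toℕ (remainder j)) ≡ j
        at-remainder j = trans (cong at (toℕ-fromℕ< (m%n<n (step j) d))) (at-step-% {d} d-period j)
        i , j , i<j , eq = pigeonhole d<7 remainder
    in <-irrefl (trans (sym (at-remainder i)) (trans (cong (at ∘ toℕ) eq) (at-remainder j))) i<j

  at-distinct : ∀ {j k} → j ℕ.< k → at j ≡ at k → 7 ℕ.≤ k ℕ.∸ j × at (k ℕ.∸ j) ≡ 0F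
  at-distinct {j} {k} j<k eq = period≥7 {{ℕ.>-nonZero (ℕ.m<n⇒0<n∸m j<k)}} period , period
    where
    period : at (k ℕ.∸ j) ≡ 0F
    period = at-+ j (k ℕ.∸ j) (trans eq (cong at (sym (ℕ.m+[n∸m]≡n (ℕ.<⇒≤ j<k)))))

  -- Two of the eight values `at 0`, ..., `at 7` agree, which gives a period of at most 7; by
  -- `period≥7` it is exactly 7.
  period-7 : at 7 ≡ 0F
  period-7 =
    let i , j , i<j , eq = pigeonhole (ℕ.n<1+n 7) (at ∘ toℕ)
        7≤d , period = at-distinct i<j eq
    in subst (λ d → at d ≡ 0F) (ℕ.≤-antisym (ℕ.≤-trans (ℕ.m∸n≤m (toℕ j) (toℕ i)) (ℕ.≤-pred (toℕ<n j))) 7≤d) period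

  at-injective : ∀ {i j : Fin 7} → at (toℕ i) ≡ at (toℕ j) → i ≡ j
  at-injective {i} {j} eq with <-cmp i j
  ... | tri< i<j _ _ = contradiction (proj₁ (at-distinct i<j eq))
                         (ℕ.<⇒≱ (ℕ.≤-<-trans (ℕ.m∸n≤m (toℕ j) (toℕ i)) (toℕ<n j)))
  ... | tri≈ _ i≡j _ = i≡j
  ... | tri> _ _ j<i = contradiction (proj₁ (at-distinct j<i (sym eq)))
                         (ℕ.<⇒≱ (ℕ.≤-<-trans (ℕ.m∸n≤m (toℕ i) (toℕ j)) (toℕ<n i)))

  position : Fin 7 → Fin 7
  position j = fromℕ< (m%n<n (step j) 7)

  at-position : ∀ j → at (toℕ (position j)) ≡ j
  at-position j = trans (cong at (toℕ-fromℕ< (m%n<n (step j) 7))) (at-step-% {7} period-7 j)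

  numbering : Permutation′ 7
  numbering = permutation (at ∘ toℕ) position at-position (λ i → at-injective (at-position (at (toℕ i))))

  rot₇-toℕ : ∀ i → toℕ (rot₇ i) ≡ suc (toℕ i) ⊎ (i ≡ 6F × rot₇ i ≡ 0F)
  rot₇-toℕ = decide (all? λ i → (_ ℕ.≟ _) ⊎-dec ((_ ≟ _) ×-dec (_ ≟ _))) refl

  numbering-walk : ∀ i → W ⟨$⟩ʳ (numbering ⟨$⟩ʳ i) ≡ numbering ⟨$⟩ʳ (rot₇ i)
  numbering-walk i = trans (sym (iterate-suc _ (toℕ i) 0F)) (follow (rot₇-toℕ i))
    where
    follow : toℕ (rot₇ i) ≡ suc (toℕ i) ⊎ (i ≡ 6F × rot₇ i ≡ 0F) → at (suc (toℕ i)) ≡ at (toℕ (rot₇ i))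
    follow (inj₁ eq)         = cong at (sym eq)
    follow (inj₂ (refl , _)) = period-7

-- Enumeration of the even involutions

module _ {n : ℕ} where

  -- The constraints on the value x at d, when the points `es` already have the values `ys`: an
  -- involution sends d to e exactly when it sends e to d.
  Extends : ∀ {m} → Fin n → Vec (Fin n) m → Vec (Fin n) m → Fin n → Set
  Extends d []        []       x = ⊤
  Extends d (e ∷ es) (y ∷ ys) x = (x ≡ e → y ≡ d) × (y ≡ d → x ≡ e) × Extends d es ys x

  extends? : ∀ {m} d (es ys : Vec (Fin n) m) x → Dec (Extends d es ys x)
  extends? d []        []       x = yes tt
  extends? d (e ∷ es) (y ∷ ys) x = (x ≟ e →-dec y ≟ d) ×-dec (y ≟ d →-dec x ≟ e) ×-dec extends? d es ys x

  -- Backtracking with early pruning, in place of a test of all 7⁷ self-maps.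
  involutionsOn : ∀ {m} → Vec (Fin n) m → List (Vec (Fin n) m)
  involutionsOn []       = [] ∷ []
  involutionsOn (d ∷ es) =
    List.concatMap (λ ys → List.map (_∷ ys) (filter (extends? d es ys) (allFin n))) (involutionsOn es)

  module _ {f : Fin n → Fin n} (involutive : ∀ i → f (f i) ≡ i) where

    involution-extends : ∀ {m} d (es : Vec (Fin n) m) → Extends d es (Vec.map f es) (f d)
    involution-extends d []       = tt
    involution-extends d (e ∷ es) = (λ fd≡e → trans (cong f (sym fd≡e)) (involutive d)) ,
                                    (λ fe≡d → trans (cong f (sym fe≡d)) (involutive e)) ,
                                    involution-extends d es

    ∈-involutionsOn : ∀ {m} (es : Vec (Fin n) m) → Vec.map f es ∈ involutionsOn es
    ∈-involutionsOn []       = here refl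
    ∈-involutionsOn (d ∷ es) = ∈-concatMap⁺ _ (Any.map (λ { refl →
      ∈-map⁺ _ (∈-filter⁺ (extends? d es (Vec.map f es)) (∈-allFin (f d)) (involution-extends d es)) })
      (∈-involutionsOn es))

-- Refers to the forward map alone, so that it applies to tables and to conjugated turns; on the
-- forward map of a permutation it is `inversions` by definition.
inversionsOf : (Fin 7 → Fin 7) → ℕ
inversionsOf f =
  length (filter (λ (i , j) → (i <? j) ×-dec (f j <? f i)) (cartesianProduct (allFin 7) (allFin 7)))

inversionsOf-cong : ∀ f g → (∀ i → f i ≡ g i) → inversionsOf f ≡ inversionsOf g
inversionsOf-cong f g f≗g = trans (count f) (trans (∑²-cong pointwise) (sym (count g)))
  where
  count : ∀ f → inversionsOf f ≡ ∑² (λ i j → indicator (less i j ∧ less (f j) (f i)))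
  count f = count-product (λ (i , j) → (i <? j) ×-dec (f j <? f i)) id id
  pointwise : ∀ i j → indicator (less i j ∧ less (f j) (f i)) ≡ indicator (less i j ∧ less (g j) (g i))
  pointwise i j rewrite f≗g i | f≗g j = refl

even? : (v : Vec (Fin 7) 7) → Dec (2 ∣ inversionsOf (lookup v))
even? v = 2 ∣? inversionsOf (lookup v)

-- The identity and the 105 products of two disjoint transpositions.
evenInvolutions : List (Vec (Fin 7) 7)
evenInvolutions = filter even? (involutionsOn (Vec.allFin 7))

tabulated : (Fin 7 → Fin 7) → Vec (Fin 7) 7
tabulated f = Vec.map f (Vec.allFin 7)

lookup-tabulated : ∀ f i → lookup (tabulated f) i ≡ f i
lookup-tabulated f i = trans (Vec.lookup-map i f (Vec.allFin 7)) (cong f (Vec.lookup-allFin i))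

∈-evenInvolutions : ∀ f → (∀ i → f (f i) ≡ i) → 2 ∣ inversionsOf f → tabulated f ∈ evenInvolutions
∈-evenInvolutions f involutive even = ∈-filter⁺ even? (∈-involutionsOn {f = f} involutive (Vec.allFin 7))
  (subst (2 ∣_) (inversionsOf-cong f (lookup (tabulated f)) (λ i → sym (lookup-tabulated f i))) even)

-- Normalised cacti

-- The two Fano planes invariant under rot₇, with the lines {t, t + 1, t + 3} and
-- {t, t + 2, t + 3}: the third point of the line through 0 and i.
thirdFrom0 : Fin 2 → Fin 7 → Fin 7
thirdFrom0 0F = lookup (0F ∷ 3F ∷ 6F ∷ 1F ∷ 5F ∷ 4F ∷ 2F ∷ [])
thirdFrom0 1F = lookup (0F ∷ 5F ∷ 3F ∷ 2F ∷ 6F ∷ 1F ∷ 4F ∷ [])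

-- The Steiner quasigroup of the plane: rotation carries lines to lines, so the line through i and j
-- is moved to 0 and back. Since `third p i i` is i, collineations can be characterised by one
-- equation without a distinctness condition.
third : Fin 2 → Fin 7 → Fin 7 → Fin 7
third p i j = iterate rot₇ (toℕ i) (thirdFrom0 p (iterate rot₇⁻¹ (toℕ i) j))

Collineation : Fin 2 → (Fin 7 → Fin 7) → Set
Collineation p f = ∀ i j → f (third p i j) ≡ third p (f i) (f j)

collineation? : ∀ p f → Dec (Collineation p f)
collineation? p f = all? λ i → all? λ j → _ ≟ _

relabelling : Fin 3 → Label → Label
relabelling r = iterate next (toℕ r)

-- Turns the outer walk of a cactus into that of the relabelled cactus.
conjugator : Face → Fin 3 → Permutation′ 7
conjugator c 0F = Perm.id
conjugator c 1F = turnPerm c ∗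
conjugator c 2F = turnPerm c ∗ ∘ₚ turnPerm c ○

-- An isomorphism carries one outer walk to the other, so it is `conjugator c r` up to a power of
-- `rot₇`: there are 21 candidates for each cactus.
matching : Face → Fin 3 → Fin 7 → Permutation′ 7
matching c r k = shift (toℕ k) ∘ₚ conjugator c r

Matches : (Label → Fin 7 → Fin 7) → Face → Fin 3 → Fin 7 → Set
Matches N c r k = ∀ x i → matching c r k ⟨$⟩ʳ N x i ≡ turnOf c (relabelling r x) (matching c r k ⟨$⟩ʳ i)

someFace? : {P : Face → Set} → (∀ c → Dec (P c)) → Dec (∃ P)
someFace? P? = map′ (λ (k , c , p) → (k , c) , p) (λ ((k , c) , p) → k , c , p) (any? λ k → any? λ c → P? (k , c))

Classified : (Label → Fin 7 → Fin 7) → Set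
Classified N = (∃ λ p → ∀ x → Collineation p (N x)) ⊎ (∃ λ c → ∃₂ λ r k → Matches N c r k)

classified? : ∀ N → Dec (Classified N)
classified? N = any? (λ p → allLabels? λ x → collineation? p (N x))
  ⊎-dec someFace? λ c → any? λ r → any? λ k → allLabels? λ x → all? λ i → _ ≟ _

turns : (a b c : Vec (Fin 7) 7) → Label → Fin 7 → Fin 7
turns a b c ∗ = lookup a
turns a b c ○ = lookup b
turns a b c ● = lookup c

-- For involutions a and b, c ∘ b ∘ a = rot₇ means c = rot₇ ∘ a ∘ b.
lastTurn : (a b : Vec (Fin 7) 7) → Vec (Fin 7) 7
lastTurn a b = tabulated (λ i → rot₇ (lookup a (lookup b i)))

lookup-lastTurn : ∀ a b i → lookup (lastTurn a b) i ≡ rot₇ (lookup a (lookup b i))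
lookup-lastTurn a b = lookup-tabulated (λ i → rot₇ (lookup a (lookup b i)))

Admissible : (a b : Vec (Fin 7) 7) → Set
Admissible a b = (∀ i → lookup (lastTurn a b) (lookup (lastTurn a b) i) ≡ i) →
  2 ∣ inversionsOf (lookup (lastTurn a b)) → Classified (turns a b (lastTurn a b))

-- For just 392 of the 106² pairs is the last turn an involution; the others pass at this cheap
-- first test, before any search for a plane or a cactus.
admissible? : ∀ a b → Dec (Admissible a b)
admissible? a b = all? (λ i → _ ≟ _) →-dec 2 ∣? inversionsOf (lookup (lastTurn a b)) →-dec
  classified? (turns a b (lastTurn a b))

-- Abstracting over the list lets it be evaluated only once.
admissiblePairs? : ∀ es → Dec (All (λ a → All (Admissible a) es) es)
admissiblePairs? es = All.all? (λ a → All.all? (admissible? a) es) es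

opaque
  evenInvolutions-admissible : All (λ a → All (Admissible a) evenInvolutions) evenInvolutions
  evenInvolutions-admissible = decide (admissiblePairs? evenInvolutions) refl

module _ {N : Label → Fin 7 → Fin 7} (involutive : ∀ x i → N x (N x i) ≡ i)
         (even : ∀ x → 2 ∣ inversionsOf (N x)) (walk : ∀ i → N ● (N ○ (N ∗ i)) ≡ rot₇ i) where

  private
    a b c : Vec (Fin 7) 7
    a = tabulated (N ∗)
    b = tabulated (N ○)
    c = lastTurn a b

    lookup-c : ∀ i → lookup c i ≡ N ● i
    lookup-c i = begin
      lookup c i                             ≡⟨ lookup-lastTurn a b i ⟩
      rot₇ (lookup a (lookup b i))           ≡⟨ cong rot₇ (trans (lookup-tabulated (N ∗) _) (cong (N ∗) (lookup-tabulated (N ○) i))) ⟩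
      rot₇ (N ∗ (N ○ i))                     ≡⟨ walk _ ⟨
      N ● (N ○ (N ∗ (N ∗ (N ○ i))))          ≡⟨ cong (N ● ∘ N ○) (involutive ∗ _) ⟩
      N ● (N ○ (N ○ i))                      ≡⟨ cong (N ●) (involutive ○ i) ⟩
      N ● i ∎
      where open ≡-Reasoning

    turns-N : ∀ x i → turns a b c x i ≡ N x i
    turns-N ∗ = lookup-tabulated (N ∗)
    turns-N ○ = lookup-tabulated (N ○)
    turns-N ● = lookup-c

  classified : Classified N
  classified = transfer (All.lookup (All.lookup evenInvolutions-admissible
      (∈-evenInvolutions (N ∗) (involutive ∗) (even ∗))) (∈-evenInvolutions (N ○) (involutive ○) (even ○))
      (λ i → trans (trans (lookup-c _) (cong (N ●) (lookup-c i))) (involutive ● i))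
      (subst (2 ∣_) (inversionsOf-cong (N ●) (lookup c) (λ i → sym (lookup-c i))) (even ●)))
    where
    transfer : Classified (turns a b c) → Classified N
    transfer (inj₁ (p , collineation)) = inj₁ (p , λ x i j →
      trans (sym (turns-N x _)) (trans (collineation x i j) (cong₂ (third p) (turns-N x i) (turns-N x j))))
    transfer (inj₂ (face , r , k , matches)) = inj₂ (face , r , k , λ x i →
      trans (cong (matching face r k ⟨$⟩ʳ_) (sym (turns-N x i))) (matches x i))

relabelling-cyclic : ∀ r x → relabelling r (next x) ≡ next (relabelling r x)
relabelling-cyclic r x = iterate-suc next (toℕ r) x

-- A 3-cycle fixes four of the seven points, a collineation of a Fano plane other than the identity
-- at most three.
threeCycle₀-not-collineation : ∀ p → ¬ Collineation p (threeCycle₀ ⟨$⟩ʳ_)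
threeCycle₀-not-collineation = decide (all? λ p → ¬? (collineation? p (threeCycle₀ ⟨$⟩ʳ_))) refl

module Normalised (C : Cactus 7) (C-in-class : A₇-222 C) (φ : Permutation′ 7)
                  (φ-walk : ∀ i → turn C ● ⟨$⟩ʳ (turn C ○ ⟨$⟩ʳ (turn C ∗ ⟨$⟩ʳ (φ ⟨$⟩ʳ i))) ≡ φ ⟨$⟩ʳ (rot₇ i)) where

  open A₇-222 C-in-class
  N : Label → Fin 7 → Fin 7
  N x i = φ ⟨$⟩ˡ (turn C x ⟨$⟩ʳ (φ ⟨$⟩ʳ i))
  N-involutive : ∀ x i → N x (N x i) ≡ i
  N-involutive x i = trans (cong (λ j → φ ⟨$⟩ˡ (turn C x ⟨$⟩ʳ j)) (inverseʳ φ))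
                           (trans (cong (φ ⟨$⟩ˡ_) (simple C x _)) (inverseˡ φ))
  N-even : ∀ x → 2 ∣ inversionsOf (N x)
  -- A local monodromy is even because the group is A₇, and `N x` is its conjugate under the
  -- numbering.
  N-even x = Even-conjugate (Perm.flip φ) (turn C x) (Equivalence.to (galoisGroup (turn C x)) (local x))
  N-walk : ∀ i → N ● (N ○ (N ∗ i)) ≡ rot₇ i
  N-walk i = begin
    N ● (N ○ (N ∗ i))
      ≡⟨ cong (λ j → φ ⟨$⟩ˡ (turn C ● ⟨$⟩ʳ j)) (trans (inverseʳ φ) (cong (turn C ○ ⟨$⟩ʳ_) (inverseʳ φ))) ⟩
    φ ⟨$⟩ˡ (turn C ● ⟨$⟩ʳ (turn C ○ ⟨$⟩ʳ (turn C ∗ ⟨$⟩ʳ (φ ⟨$⟩ʳ i))))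
      ≡⟨ cong (φ ⟨$⟩ˡ_) (φ-walk i) ⟩
    φ ⟨$⟩ˡ (φ ⟨$⟩ʳ (rot₇ i))
      ≡⟨ inverseˡ φ ⟩
    rot₇ i ∎
    where open ≡-Reasoning
  module _ (p : Fin 2) (collineation : ∀ x → Collineation p (N x)) where
    conjugate : Permutation′ 7 → Fin 7 → Fin 7
    conjugate π i = φ ⟨$⟩ˡ (π ⟨$⟩ʳ (φ ⟨$⟩ʳ i))
    monodromy-collineation : ∀ {π} → Monodromy C π → Collineation p (conjugate π)
    monodromy-collineation (local x) = collineation x
    monodromy-collineation identity i j =
      trans (inverseˡ φ) (cong₂ (third p) (sym (inverseˡ φ)) (sym (inverseˡ φ)))
    monodromy-collineation (compose {π} {ρ} m n) i j = begin
      conjugate (π ∘ₚ ρ) (third p i j) ≡⟨ unfold (third p i j) ⟨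
      conjugate ρ (conjugate π (third p i j)) ≡⟨ cong (conjugate ρ) (monodromy-collineation m i j) ⟩
      conjugate ρ (third p (conjugate π i) (conjugate π j)) ≡⟨ monodromy-collineation n _ _ ⟩
      third p (conjugate ρ (conjugate π i)) (conjugate ρ (conjugate π j)) ≡⟨ cong₂ (third p) (unfold i) (unfold j) ⟩
      third p (conjugate (π ∘ₚ ρ) i) (conjugate (π ∘ₚ ρ) j) ∎
      where
      open ≡-Reasoning
      unfold : ∀ i → conjugate ρ (conjugate π i) ≡ conjugate (π ∘ₚ ρ) i
      unfold i = cong (λ j → φ ⟨$⟩ˡ (ρ ⟨$⟩ʳ j)) (inverseʳ φ)
    monodromy-collineation (inverse {π} m) i j = begin
      π⁻¹ (third p i j) ≡⟨ cong₂ (λ i j → π⁻¹ (third p i j)) (right i) (right j) ⟨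
      π⁻¹ (third p (conjugate π (π⁻¹ i)) (conjugate π (π⁻¹ j))) ≡⟨ cong π⁻¹ (monodromy-collineation m _ _) ⟨
      π⁻¹ (conjugate π (third p (π⁻¹ i) (π⁻¹ j))) ≡⟨ left _ ⟩
      third p (π⁻¹ i) (π⁻¹ j) ∎
      where
      open ≡-Reasoning
      π⁻¹ : Fin 7 → Fin 7
      π⁻¹ = conjugate (Perm.flip π)
      left : ∀ i → π⁻¹ (conjugate π i) ≡ i
      left i = trans (cong (λ j → φ ⟨$⟩ˡ (π ⟨$⟩ˡ j)) (inverseʳ φ)) (trans (cong (φ ⟨$⟩ˡ_) (inverseˡ π)) (inverseˡ φ))
      right : ∀ i → conjugate π (π⁻¹ i) ≡ i
      right i = trans (cong (λ j → φ ⟨$⟩ˡ (π ⟨$⟩ʳ j)) (inverseʳ φ)) (trans (cong (φ ⟨$⟩ˡ_) (inverseʳ π)) (inverseˡ φ))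
    monodromy-collineation (respects {π} {ρ} π≈ρ m) i j =
      trans (sym (same (third p i j))) (trans (monodromy-collineation m i j) (cong₂ (third p) (same i) (same j)))
      where
      same : ∀ i → conjugate π i ≡ conjugate ρ i
      same i = cong (φ ⟨$⟩ˡ_) (π≈ρ (φ ⟨$⟩ʳ i))
    t : Permutation′ 7
    t = Perm.flip φ ∘ₚ threeCycle₀ ∘ₚ φ
    -- Carried over to the triangles of C by φ, the 3-cycle is even, hence belongs to the monodromy
    -- group A₇, and would have to preserve the plane.
    absurd : ⊥
    absurd = threeCycle₀-not-collineation p λ i j →
      trans (sym (same (third p i j)))
        (trans (monodromy-collineation (Equivalence.from (galoisGroup t) t-even) i j) (cong₂ (third p) (same i) (same j)))
      where
      t-even : Even t
      t-even = Even-conjugate φ threeCycle₀ (decide (2 ∣? inversions threeCycle₀) refl)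
      same : ∀ i → conjugate t i ≡ threeCycle₀ ⟨$⟩ʳ i
      same i = trans (inverseˡ φ) (cong (threeCycle₀ ⟨$⟩ʳ_) (inverseˡ φ))
  normalised-classification : ∃ λ c → C ≅ᶜ rep c
  normalised-classification = from (classified {N} N-involutive N-even N-walk)
    where
    from : Classified N → ∃ λ c → C ≅ᶜ rep c
    from (inj₁ (p , collineation))   = contradiction (absurd p collineation) λ ()
    from (inj₂ (c , r , k , matches)) = c , record
      { relabel     = relabelling r
      ; cyclic      = relabelling-cyclic r
      ; triangles   = Perm.flip φ ∘ₚ matching c r k
      ; equivariant = λ x i → trans (cong (λ j → matching c r k ⟨$⟩ʳ (φ ⟨$⟩ˡ (turn C x ⟨$⟩ʳ j))) (sym (inverseʳ φ)))
                                    (matches x (φ ⟨$⟩ˡ i))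
      }

opaque
  cactus-classification : ∀ C → A₇-222 C → ∃ λ c → C ≅ᶜ rep c
  cactus-classification C C-in-class = Normalised.normalised-classification C C-in-class numbering numbering-walk
    where open Numbering (turn C ∗ ∘ₚ turn C ○ ∘ₚ turn C ●) (outerWalk C)

-- Isomorphisms

module _ {A B : Set} (f : A ↔ B) where
  open Inverse f

  to-from : ∀ b → to (from b) ≡ b
  to-from = strictlyInverseˡ

  from-to : ∀ a → from (to a) ≡ a
  from-to = strictlyInverseʳ

  to-injective : ∀ {a a′} → to a ≡ to a′ → a ≡ a′
  to-injective eq = trans (sym (from-to _)) (trans (cong from eq) (from-to _))

≅-refl : ∀ {G} → G ≅ G
≅-refl = record { darts = ↔-id _ ; rot-comm = λ _ → refl ; rev-comm = λ _ → refl }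

≅-sym : ∀ {G H} → G ≅ H → H ≅ G
≅-sym {G} {H} φ = record
  { darts    = ↔-sym darts
  ; rot-comm = swap rot-comm
  ; rev-comm = swap rev-comm
  }
  where
  open _≅_ φ
  open Inverse darts using (to; from)
  swap : ∀ {g : Dart G → Dart G} {h : Dart H → Dart H} → (∀ d → to (g d) ≡ h (to d)) → ∀ e → from (h e) ≡ g (from e)
  swap {g} {h} comm e = trans (cong (from ∘ h) (sym (to-from darts e)))
                              (trans (cong from (sym (comm (from e)))) (from-to darts _))

≅-trans : ∀ {G H K} → G ≅ H → H ≅ K → G ≅ K
≅-trans φ ψ = record
  { darts    = ψ.darts ↔-∘ φ.darts
  ; rot-comm = λ d → trans (cong (Inverse.to ψ.darts) (φ.rot-comm d)) (ψ.rot-comm _)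
  ; rev-comm = λ d → trans (cong (Inverse.to ψ.darts) (φ.rev-comm d)) (ψ.rev-comm _)
  }
  where
  module φ = _≅_ φ
  module ψ = _≅_ ψ

≅₃-refl : ∀ {T} → T ≅₃ T
≅₃-refl = record { iso = ≅-refl ; rename = ↔-id _ ; colour-comm = λ _ → refl }

≅₃-sym : ∀ {T U} → T ≅₃ U → U ≅₃ T
≅₃-sym {T} {U} φ = record
  { iso         = ≅-sym iso
  ; rename      = ↔-sym rename
  ; colour-comm = λ e → trans (cong (from ∘ colour U) (sym (to-from (_≅_.darts iso) e)))
                              (trans (cong from (sym (colour-comm _))) (from-to rename _))
  }
  where
  open _≅₃_ φ
  open Inverse rename using (from)

≅₃-trans : ∀ {T U V} → T ≅₃ U → U ≅₃ V → T ≅₃ V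
≅₃-trans φ ψ = record
  { iso         = ≅-trans φ.iso ψ.iso
  ; rename      = ψ.rename ↔-∘ φ.rename
  ; colour-comm = λ d → trans (cong (Inverse.to ψ.rename) (φ.colour-comm d)) (ψ.colour-comm _)
  }
  where
  module φ = _≅₃_ φ
  module ψ = _≅₃_ ψ

≅ᶜ-refl : ∀ {n} {C : Cactus n} → C ≅ᶜ C
≅ᶜ-refl = record { relabel = id ; cyclic = λ _ → refl ; triangles = Perm.id ; equivariant = λ _ _ → refl }

module Cyclic (r : Label → Label) (cyclic : ∀ x → r (next x) ≡ next (r x)) where

  cyclic-prev : ∀ x → r (prev x) ≡ prev (r x)
  cyclic-prev x = trans (cong r (prev-next² x))
    (trans (cyclic _) (trans (cong next (cyclic x)) (sym (prev-next² (r x)))))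
    where
    prev-next² : ∀ y → prev y ≡ next (next y)
    prev-next² ∗ = refl
    prev-next² ○ = refl
    prev-next² ● = refl

  -- Commuting with the 3-cycle `next`, the relabelling r is one of its powers. So `r ∘ r` inverts
  -- it.
  cyclic³ : ∀ x → r (r (r x)) ≡ x
  cyclic³ ∗ = cyclic³-∗
    where
    cyclic³-∗ : r (r (r ∗)) ≡ ∗
    cyclic³-∗ with r ∗ in r∗
    ... | ∗ = trans (cong r r∗) r∗
    ... | ○ = trans (cong r r○) (trans (cyclic ○) (cong next r○))
      where
      r○ : r ○ ≡ ●
      r○ = trans (cyclic ∗) (cong next r∗)
    ... | ● = trans (cong r r●) (trans (cyclic ∗) (cong next r∗))
      where
      r● : r ● ≡ ○
      r● = trans (cyclic-prev ∗) (cong prev r∗)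
  cyclic³ ○ = trans (cong (r ∘ r) (cyclic ∗)) (trans (cong r (cyclic _)) (trans (cyclic _) (cong next (cyclic³ ∗))))
  cyclic³ ● = trans (cong (r ∘ r) (cyclic-prev ∗))
    (trans (cong r (cyclic-prev _)) (trans (cyclic-prev _) (cong prev (cyclic³ ∗))))

  cyclic-bijection : Label ↔ Label
  cyclic-bijection = mk↔ₛ′ r (r ∘ r) cyclic³ cyclic³

  outerLabel-cyclic : ∀ x s → r (outerLabel x s) ≡ outerLabel (r x) s
  outerLabel-cyclic x toNext = cyclic x
  outerLabel-cyclic x toPrev = cyclic-prev x

≅ᶜ-inverse : ∀ {n} {C D : Cactus n} → C ≅ᶜ D → D ≅ᶜ C
≅ᶜ-inverse {C = C} {D} φ = record
  { relabel     = relabel ∘ relabel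
  ; cyclic      = λ x → trans (cong relabel (cyclic x)) (cyclic _)
  ; triangles   = Perm.flip triangles
  ; equivariant = λ x i → trans
      (cong₂ (λ y j → triangles ⟨$⟩ˡ (turn D y ⟨$⟩ʳ j)) (sym (cyclic³ x)) (sym (inverseʳ triangles)))
      (trans (cong (triangles ⟨$⟩ˡ_) (sym (equivariant _ _))) (inverseˡ triangles))
  }
  where
  open _≅ᶜ_ φ
  open Cyclic relabel cyclic

≅ᶜ-trans : ∀ {n} {C D E : Cactus n} → C ≅ᶜ D → D ≅ᶜ E → C ≅ᶜ E
≅ᶜ-trans φ ψ = record
  { relabel     = ψ.relabel ∘ φ.relabel
  ; cyclic      = λ x → trans (cong ψ.relabel (φ.cyclic x)) (ψ.cyclic _)
  ; triangles   = φ.triangles ∘ₚ ψ.triangles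
  ; equivariant = λ x i → trans (cong (ψ.triangles ⟨$⟩ʳ_) (φ.equivariant x i)) (ψ.equivariant _ _)
  }
  where
  module φ = _≅ᶜ_ φ
  module ψ = _≅ᶜ_ ψ

degenerate-≅ : ∀ {n} {C D : Cactus n} (φ : C ≅ᶜ D) x → degenerate C x ≅₃ degenerate D (_≅ᶜ_.relabel φ x)
degenerate-≅ {n} {C} {D} φ x = record
  { iso         = record { darts = mk↔ₛ′ to from to∘from from∘to ; rot-comm = rot-comm ; rev-comm = rev-comm }
  ; rename      = cyclic-bijection
  ; colour-comm = colour-comm
  }
  where
  open _≅ᶜ_ φ
  open Cyclic relabel cyclic
  to from : HalfArc n → HalfArc n
  to   (i , s , e) = triangles ⟨$⟩ʳ i , s , e
  from (i , s , e) = triangles ⟨$⟩ˡ i , s , e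
  to∘from : ∀ d → to (from d) ≡ d
  to∘from (i , s , e) = cong (_, s , e) (inverseʳ triangles)
  from∘to : ∀ d → from (to d) ≡ d
  from∘to (i , s , e) = cong (_, s , e) (inverseˡ triangles)
  G = graph (degenerate C x)
  H = graph (degenerate D (relabel x))
  outer-comm : ∀ i s → triangles ⟨$⟩ʳ (turn C (outerLabel x s) ⟨$⟩ʳ i) ≡
                       turn D (outerLabel (relabel x) s) ⟨$⟩ʳ (triangles ⟨$⟩ʳ i)
  outer-comm i s = trans (equivariant _ i) (cong (λ y → turn D y ⟨$⟩ʳ (triangles ⟨$⟩ʳ i)) (outerLabel-cyclic x s))
  rot-comm : ∀ d → to (rot G d) ≡ rot H (to d)
  rot-comm (i , toNext , inner) = refl
  rot-comm (i , toPrev , inner) = cong (_, toNext , inner) (equivariant x i)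
  rot-comm (i , toNext , outer) = cong (_, toNext , outer) (outer-comm i toNext)
  rot-comm (i , toPrev , outer) = cong (_, toPrev , outer) (outer-comm i toPrev)
  rev-comm : ∀ d → to (rev G d) ≡ rev H (to d)
  rev-comm (i , s , inner) = refl
  rev-comm (i , s , outer) = refl
  colour-comm : ∀ d → relabel (colour (degenerate C x) d) ≡ colour (degenerate D (relabel x)) (to d)
  colour-comm (i , s , inner) = refl
  colour-comm (i , s , outer) = outerLabel-cyclic x s

-- Contractions

Survivor-functional : ∀ {T x y d e e′} → Survivor T x y d e → Survivor T x y d e′ → e ≡ e′
Survivor-functional (stop _)   (stop _)   = refl
Survivor-functional (stop ¬o)  (pass o _) = contradiction o ¬o
Survivor-functional (pass o _) (stop ¬o)  = contradiction o ¬o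
Survivor-functional (pass _ s) (pass _ t) = Survivor-functional s t

module _ {T x y} {S S′ : PlaneGraph} (κ : Contraction T x y S) (κ′ : Contraction T x y S′) where

  private
    module κ  = Contraction κ
    module κ′ = Contraction κ′

    to : Dart S → Dart S′
    to d = proj₁ (κ′.onto (κ.embed d) (κ.survives d))

    from : Dart S′ → Dart S
    from d = proj₁ (κ.onto (κ′.embed d) (κ′.survives d))

    embed-to : ∀ d → κ′.embed (to d) ≡ κ.embed d
    embed-to d = proj₂ (κ′.onto (κ.embed d) (κ.survives d))

    embed-from : ∀ d → κ.embed (from d) ≡ κ′.embed d
    embed-from d = proj₂ (κ.onto (κ′.embed d) (κ′.survives d))

  -- Both graphs embed bijectively onto the surviving half-edges, and the walk to the next survivor
  -- is deterministic.
  contraction-unique : S ≅ S′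
  contraction-unique = record
    { darts    = mk↔ₛ′ to from (λ d → κ′.injective (trans (embed-to _) (embed-from d)))
                               (λ d → κ.injective (trans (embed-from _) (embed-to d)))
    ; rot-comm = λ d → κ′.injective (trans (embed-to _) (Survivor-functional
        (κ.rot-comm d)
        (subst (λ c → Survivor T x y (rot (graph T) c) (κ′.embed (rot S′ (to d)))) (embed-to d) (κ′.rot-comm (to d)))))
    ; rev-comm = λ d → κ′.injective (trans (embed-to _) (trans (κ.rev-comm d)
        (trans (cong (rev (graph T)) (sym (embed-to d))) (sym (κ′.rev-comm (to d))))))
    }

contraction-≅ : ∀ {T x y S S′} → S ≅ S′ → Contraction T x y S → Contraction T x y S′
contraction-≅ {T} {x} {y} {S} {S′} φ κ = record
  { embed     = embed ∘ from
  ; injective = λ eq → to-injective (↔-sym darts) (injective eq)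
  ; survives  = λ d → survives (from d)
  ; onto      = λ d ¬o → let e , eq = onto d ¬o in to e , trans (cong embed (from-to darts e)) eq
  ; rev-comm  = λ d → trans (cong embed (_≅_.rev-comm (≅-sym φ) d)) (rev-comm (from d))
  ; rot-comm  = λ d → subst (Survivor T x y _) (cong embed (sym (_≅_.rot-comm (≅-sym φ) d))) (rot-comm (from d))
  }
  where
  open _≅_ φ using (darts)
  open Inverse darts using (to; from)
  open Contraction κ

module _ {T U : ColouredPlaneGraph} (φ : T ≅₃ U) where

  open _≅₃_ φ
  open _≅_ iso
  private
    module D = Inverse darts
    module R = Inverse rename

    colour-rev : ∀ d → R.to (colour T (rev (graph T) d)) ≡ colour U (rev (graph U) (D.to d))
    colour-rev d = trans (colour-comm _) (cong (colour U) (rev-comm d))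

  OfType-to : ∀ {x y d} → OfType T x y d → OfType U (R.to x) (R.to y) (D.to d)
  OfType-to {d = d} (inj₁ (p , q)) =
    inj₁ (trans (sym (colour-comm d)) (cong R.to p) , trans (sym (colour-rev d)) (cong R.to q))
  OfType-to {d = d} (inj₂ (p , q)) =
    inj₂ (trans (sym (colour-comm d)) (cong R.to p) , trans (sym (colour-rev d)) (cong R.to q))

  OfType-from : ∀ {x y d} → OfType U (R.to x) (R.to y) (D.to d) → OfType T x y d
  OfType-from {d = d} (inj₁ (p , q)) =
    inj₁ (to-injective rename (trans (colour-comm d) p) , to-injective rename (trans (colour-rev d) q))
  OfType-from {d = d} (inj₂ (p , q)) =
    inj₂ (to-injective rename (trans (colour-comm d) p) , to-injective rename (trans (colour-rev d) q))

  Survivor-to : ∀ {x y d e} → Survivor T x y d e → Survivor U (R.to x) (R.to y) (D.to d) (D.to e)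
  Survivor-to (stop ¬o)           = stop (¬o ∘ OfType-from)
  Survivor-to {e = e} (pass {d} o s) = pass (OfType-to o)
    (subst (λ c → Survivor U _ _ c (D.to e))
           (trans (rot-comm _) (cong (rot (graph U)) (rev-comm d))) (Survivor-to s))

  Contraction-to : ∀ {x y S} → Contraction T x y S → Contraction U (R.to x) (R.to y) S
  Contraction-to {x} {y} {S} κ = record
    { embed     = D.to ∘ embed
    ; injective = λ eq → injective (to-injective darts eq)
    ; survives  = λ d o → survives d (OfType-from o)
    ; onto      = λ d ¬o →
        let e , eq = onto (D.from d) (λ o → ¬o (subst (OfType U _ _) (to-from darts d) (OfType-to o)))
        in e , trans (cong D.to eq) (to-from darts d)
    ; rev-comm  = λ d → trans (cong D.to (κ.rev-comm d)) (rev-comm _)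
    ; rot-comm  = λ d → subst (λ c → Survivor U _ _ c (D.to (embed (rot S d)))) (rot-comm _) (Survivor-to (κ.rot-comm d))
    }
    where
    module κ = Contraction κ
    open κ using (embed; injective; survives; onto)

  Contractions-to : ∀ {S S′} → Contractions T S S′ → Contractions U S S′
  Contractions-to (x , y , z , x≢y , x≢z , y≢z , middle , κ , κ′) =
    R.to x , R.to y , R.to z ,
    x≢y ∘ to-injective rename , x≢z ∘ to-injective rename , y≢z ∘ to-injective rename ,
    (λ d → subst (λ d → colour U d ≡ R.to x ⊎ colour U (rev (graph U) d) ≡ R.to x) (to-from darts d)
             (Sum.map (λ p → trans (sym (colour-comm _)) (cong R.to p))
                      (λ p → trans (sym (colour-rev _)) (cong R.to p)) (middle (D.from d)))) ,
    Contraction-to κ , Contraction-to κ′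

other : Side → Side
other toNext = toPrev
other toPrev = toNext

outerLabel≢ : ∀ x s → outerLabel x s ≢ x
outerLabel≢ ∗ toNext ()
outerLabel≢ ∗ toPrev ()
outerLabel≢ ○ toNext ()
outerLabel≢ ○ toPrev ()
outerLabel≢ ● toNext ()
outerLabel≢ ● toPrev ()

outerLabel-other : ∀ x s → outerLabel x (other s) ≢ outerLabel x s
outerLabel-other ∗ toNext ()
outerLabel-other ∗ toPrev ()
outerLabel-other ○ toNext ()
outerLabel-other ○ toPrev ()
outerLabel-other ● toNext ()
outerLabel-other ● toPrev ()

outerLabel-covers : ∀ x y → x ≢ y → ∃ λ s → outerLabel x s ≡ y
outerLabel-covers ∗ ∗ x≢y = contradiction refl x≢y
outerLabel-covers ∗ ○ _   = toNext , refl
outerLabel-covers ∗ ● _   = toPrev , refl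
outerLabel-covers ○ ∗ _   = toPrev , refl
outerLabel-covers ○ ○ x≢y = contradiction refl x≢y
outerLabel-covers ○ ● _   = toNext , refl
outerLabel-covers ● ∗ _   = toNext , refl
outerLabel-covers ● ○ _   = toPrev , refl
outerLabel-covers ● ● x≢y = contradiction refl x≢y

-- Contracting the arcs on side s leaves one arc per triangle.
module _ {n : ℕ} (C : Cactus n) (x : Label) where

  -- A contracted arc leads from the middle vertex to an outer vertex and back.
  innerTurn : Side → Permutation′ n
  innerTurn toNext = turn C x ∘ₚ turn C (next x)
  innerTurn toPrev = turn C (prev x) ∘ₚ turn C x

  contractedTurn : Side → End → Permutation′ n
  contractedTurn s inner = innerTurn s
  contractedTurn s outer = turn C (outerLabel x (other s))

  opposite : End → End
  opposite inner = outer
  opposite outer = inner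

  contract : Side → PlaneGraph
  contract s = record
    { Dart           = Fin n × End
    ; rotation       = mk↔ₛ′ (λ (i , e) → (contractedTurn s e ⟨$⟩ʳ i) , e) (λ (i , e) → (contractedTurn s e ⟨$⟩ˡ i) , e)
                             (λ (i , e) → cong (_, e) (inverseʳ (contractedTurn s e)))
                             (λ (i , e) → cong (_, e) (inverseˡ (contractedTurn s e)))
    ; rev            = λ (i , e) → i , opposite e
    ; rev-involutive = λ { (i , inner) → refl ; (i , outer) → refl }
    ; rev-free       = λ { (i , inner) () ; (i , outer) () }
    }

  private
    T = degenerate C x

  ofType : ∀ i s e → OfType T x (outerLabel x s) (i , s , e)
  ofType i s inner = inj₁ (refl , refl)
  ofType i s outer = inj₂ (refl , refl)

  ¬ofType : ∀ i s e → ¬ OfType T x (outerLabel x s) (i , other s , e)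
  ¬ofType i s inner (inj₁ (_ , p)) = outerLabel-other x s p
  ¬ofType i s inner (inj₂ (p , _)) = outerLabel≢ x s (sym p)
  ¬ofType i s outer (inj₁ (p , _)) = outerLabel≢ x (other s) p
  ¬ofType i s outer (inj₂ (p , _)) = outerLabel-other x s p

  contract-contraction : ∀ s → Contraction T x (outerLabel x s) (contract s)
  contract-contraction s = record
    { embed     = λ (i , e) → i , other s , e
    ; injective = λ { refl → refl }
    ; survives  = λ (i , e) → ¬ofType i s e
    ; onto      = onto s
    ; rev-comm  = λ { (i , inner) → refl ; (i , outer) → refl }
    ; rot-comm  = rot-comm s
    }
    where
    onto : ∀ s d → ¬ OfType T x (outerLabel x s) d → ∃ λ (i , e) → (i , other s , e) ≡ d
    onto toNext (i , toNext , e) ¬o = contradiction (ofType i toNext e) ¬o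
    onto toNext (i , toPrev , e) ¬o = (i , e) , refl
    onto toPrev (i , toNext , e) ¬o = (i , e) , refl
    onto toPrev (i , toPrev , e) ¬o = contradiction (ofType i toPrev e) ¬o
    rot-comm : ∀ s ((i , e) : Fin n × End) → Survivor T x (outerLabel x s)
      (rot (graph T) (i , other s , e)) ((contractedTurn s e ⟨$⟩ʳ i) , other s , e)
    rot-comm toNext (i , inner) = pass (ofType j toNext inner) (pass (ofType k toNext outer) (stop (¬ofType k toNext inner)))
      where
      j = turn C x ⟨$⟩ʳ i
      k = turn C (next x) ⟨$⟩ʳ j
    rot-comm toPrev (i , inner) = pass (ofType i toPrev inner) (pass (ofType j toPrev outer) (stop (¬ofType k toPrev inner)))
      where
      j = turn C (prev x) ⟨$⟩ʳ i
      k = turn C x ⟨$⟩ʳ j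
    rot-comm toNext (i , outer) = stop (¬ofType (turn C (prev x) ⟨$⟩ʳ i) toNext outer)
    rot-comm toPrev (i , outer) = stop (¬ofType (turn C (next x) ⟨$⟩ʳ i) toPrev outer)

  middle : Middle T x
  middle (i , s , inner) = inj₁ refl
  middle (i , s , outer) = inj₂ refl

  contractions : ∀ s → Contractions T (contract s) (contract (other s))
  contractions s = x , outerLabel x s , outerLabel x (other s) ,
    (λ eq → outerLabel≢ x s (sym eq)) , (λ eq → outerLabel≢ x (other s) (sym eq)) ,
    (λ eq → outerLabel-other x s (sym eq)) , middle , contract-contraction s , contract-contraction (other s)

  -- The two arcs of a single triangle have only the label x in common; the first argument supplies
  -- the triangle.
  middle-unique : Fin n → ∀ {y} → Middle T y → y ≡ x
  middle-unique i {y} m with m (i , toNext , inner) | m (i , toPrev , inner)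
  ... | inj₁ p | _      = sym p
  ... | inj₂ _ | inj₁ p = sym p
  ... | inj₂ p | inj₂ q = contradiction (trans q (sym p)) (outerLabel-other x toNext)

  contractions-unique : Fin n → ∀ {S S′} → Contractions T S S′ → ∃ λ s → S ≅ contract s × S′ ≅ contract (other s)
  contractions-unique i (y , z , w , y≢z , y≢w , z≢w , m , κ , κ′) with middle-unique i m
  ... | refl with outerLabel-covers x z y≢z | outerLabel-covers x w y≢w
  ... | s , refl | s′ , refl with s | s′
  ... | toNext | toNext = contradiction refl z≢w
  ... | toNext | toPrev = toNext , contraction-unique κ (contract-contraction toNext) , contraction-unique κ′ (contract-contraction toPrev)
  ... | toPrev | toNext = toPrev , contraction-unique κ (contract-contraction toPrev) , contraction-unique κ′ (contract-contraction toNext)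
  ... | toPrev | toPrev = contradiction refl z≢w

-- Deciding isomorphism

record Searchable (A : Set) : Set₁ where
  field
    _≡?_ : DecidableEquality A
    every? : {P : A → Set} → (∀ a → Dec (P a)) → Dec (∀ a → P a)
    some? : {P : A → Set} → (∀ a → Dec (P a)) → Dec (∃ P)

open Searchable {{...}} public

instance
  searchable-Fin : ∀ {n} → Searchable (Fin n)
  searchable-Fin = record { _≡?_ = _≟_ ; every? = all? ; some? = any? }

  searchable-Label : Searchable Label
  searchable-Label = record
    { _≡?_   = λ { ∗ ∗ → yes refl ; ∗ ○ → no λ () ; ∗ ● → no λ () ; ○ ∗ → no λ () ; ○ ○ → yes refl ; ○ ● → no λ ()
                 ; ● ∗ → no λ () ; ● ○ → no λ () ; ● ● → yes refl }
    ; every? = allLabels?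
    ; some?  = λ P? → map′ (λ { (inj₁ p) → ∗ , p ; (inj₂ (inj₁ p)) → ○ , p ; (inj₂ (inj₂ p)) → ● , p })
                           (λ { (∗ , p) → inj₁ p ; (○ , p) → inj₂ (inj₁ p) ; (● , p) → inj₂ (inj₂ p) })
                           (P? ∗ ⊎-dec P? ○ ⊎-dec P? ●)
    }

  searchable-Side : Searchable Side
  searchable-Side = record
    { _≡?_   = λ { toNext toNext → yes refl ; toNext toPrev → no λ () ; toPrev toNext → no λ () ; toPrev toPrev → yes refl }
    ; every? = λ P? → map′ (λ { (p , q) toNext → p ; (p , q) toPrev → q }) (λ p → p toNext , p toPrev) (P? toNext ×-dec P? toPrev)
    ; some?  = λ P? → map′ (λ { (inj₁ p) → toNext , p ; (inj₂ p) → toPrev , p })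
                           (λ { (toNext , p) → inj₁ p ; (toPrev , p) → inj₂ p }) (P? toNext ⊎-dec P? toPrev)
    }

  searchable-End : Searchable End
  searchable-End = record
    { _≡?_   = λ { inner inner → yes refl ; inner outer → no λ () ; outer inner → no λ () ; outer outer → yes refl }
    ; every? = λ P? → map′ (λ { (p , q) inner → p ; (p , q) outer → q }) (λ p → p inner , p outer) (P? inner ×-dec P? outer)
    ; some?  = λ P? → map′ (λ { (inj₁ p) → inner , p ; (inj₂ p) → outer , p })
                           (λ { (inner , p) → inj₁ p ; (outer , p) → inj₂ p }) (P? inner ⊎-dec P? outer)
    }

  searchable-× : ∀ {A B : Set} {{_ : Searchable A}} {{_ : Searchable B}} → Searchable (A × B)
  searchable-× = record
    { _≡?_   = λ (a , b) (a′ , b′) → map′ (λ { (refl , refl) → refl }) (λ { refl → refl , refl }) (a ≡? a′ ×-dec b ≡? b′)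
    ; every? = λ P? → map′ (λ p (a , b) → p a b) (λ p a b → p (a , b)) (every? λ a → every? λ b → P? (a , b))
    ; some?  = λ P? → map′ (λ (a , b , p) → (a , b) , p) (λ ((a , b) , p) → a , b , p) (some? λ a → some? λ b → P? (a , b))
    }

module _ (G : PlaneGraph) {{_ : Searchable (Dart G)}} where

  -- The walk around a face of G; a plane tree has only one.
  along : Dart G → Dart G
  along d = rot G (rev G d)

  -- Counts the turns from d until d₀ is met. The 28 used below, both as fuel and as the length of
  -- the walk, is the number of half-edges of a degenerated cactus of degree 7; the walk around a
  -- plane tree with 14 half-edges is run through twice.
  degreeFrom : ℕ → Dart G → Dart G → ℕ
  degreeFrom zero       d₀ d = zero
  degreeFrom (suc fuel) d₀ d = if does (d₀ ≡? d) then zero else suc (degreeFrom fuel d₀ (rot G d))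

  -- The degrees of the vertices met along the face, each diminished by 1.
  code : ℕ → Dart G → List ℕ
  code zero    d = []
  code (suc k) d = degreeFrom 28 d (rot G d) ∷ code k (along d)

module _ {G H : PlaneGraph} {{_ : Searchable (Dart G)}} {{_ : Searchable (Dart H)}} where

  module _ (φ : G ≅ H) where
    open _≅_ φ
    open Inverse darts using (to)

    degreeFrom-≅ : ∀ k d₀ d → degreeFrom G k d₀ d ≡ degreeFrom H k (to d₀) (to d)
    degreeFrom-≅ zero    d₀ d = refl
    degreeFrom-≅ (suc k) d₀ d with d₀ ≡? d | to d₀ ≡? to d
    ... | yes _    | yes _  = refl
    ... | yes d₀≡d | no ≢   = contradiction (cong to d₀≡d) ≢
    ... | no ≢     | yes eq = contradiction (to-injective darts eq) ≢
    ... | no _     | no _   = cong suc (trans (degreeFrom-≅ k d₀ (rot G d)) (cong (degreeFrom H k (to d₀)) (rot-comm d)))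

    along-≅ : ∀ d → to (along G d) ≡ along H (to d)
    along-≅ d = trans (rot-comm _) (cong (rot H) (rev-comm d))

    code-≅ : ∀ k d → code G k d ≡ code H k (to d)
    code-≅ zero    d = refl
    code-≅ (suc k) d = cong₂ _∷_
      (trans (degreeFrom-≅ 28 d (rot G d)) (cong (degreeFrom H 28 (to d)) (rot-comm d)))
      (trans (code-≅ k (along G d)) (cong (code H k) (along-≅ d)))

  record Distinguished (d₀ : Dart G) : Set where
    constructor distinguished
    field code-differs : ∀ e → code G 28 d₀ ≢ code H 28 e

  distinguished? : ∀ d₀ → Dec (Distinguished d₀)
  distinguished? d₀ = map′ distinguished Distinguished.code-differs
    (every? λ e → ¬? (≡-dec ℕ._≟_ (code G 28 d₀) (code H 28 e)))

  distinguished⇒≇ : ∀ {d₀} → Distinguished d₀ → ¬ G ≅ H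
  distinguished⇒≇ (distinguished code-differs) φ = code-differs _ (code-≅ φ 28 _)

-- Neighbours

-- A mirrored isomorphism of degenerated cacti: it is given by its effect π on the
-- arcs on the next side, since the arcs on the other side are their successors.
module _ {n : ℕ} (C D : Cactus n) (x y : Label) where

  record Neighbours (π : Permutation′ n) : Set where
    field
      at-middle : ∀ i → π ⟨$⟩ʳ (turn C x ⟨$⟩ʳ i) ≡ turn D y ⟨$⟩ʳ (π ⟨$⟩ʳ i)
      at-next   : ∀ i → π ⟨$⟩ʳ (turn C (next x) ⟨$⟩ʳ i) ≡ turn D (prev y) ⟨$⟩ʳ (π ⟨$⟩ʳ i)
      at-prev   : ∀ i → π ⟨$⟩ʳ (turn C x ⟨$⟩ʳ (turn C (prev x) ⟨$⟩ʳ i)) ≡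
                        turn D (next y) ⟨$⟩ʳ (π ⟨$⟩ʳ (turn C x ⟨$⟩ʳ i))

  neighbours? : ∀ π → Dec (Neighbours π)
  neighbours? π = map′ (λ (p , q , r) → record { at-middle = p ; at-next = q ; at-prev = r })
    (λ ν → Neighbours.at-middle ν , Neighbours.at-next ν , Neighbours.at-prev ν)
    (all? (λ i → _ ≟ _) ×-dec all? (λ i → _ ≟ _) ×-dec all? (λ i → _ ≟ _))

  module _ {π : Permutation′ n} (ν : Neighbours π) where
    open Neighbours ν

    private
      G = graph (degenerate C x)
      H = graph (degenerate D y)

      π₋ : Side → Permutation′ n
      π₋ toNext = π
      π₋ toPrev = turn C x ∘ₚ π

      to from : HalfArc n → HalfArc n
      to   (i , s , e) = π₋ s ⟨$⟩ʳ i , other s , e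
      from (i , s , e) = π₋ (other s) ⟨$⟩ˡ i , other s , e

      to∘from : ∀ d → to (from d) ≡ d
      to∘from (i , toNext , e) = cong (_, toNext , e) (inverseʳ (π₋ toPrev))
      to∘from (i , toPrev , e) = cong (_, toPrev , e) (inverseʳ (π₋ toNext))

      from∘to : ∀ d → from (to d) ≡ d
      from∘to (i , toNext , e) = cong (_, toNext , e) (inverseˡ (π₋ toNext))
      from∘to (i , toPrev , e) = cong (_, toPrev , e) (inverseˡ (π₋ toPrev))

      rot-comm : ∀ d → to (rot G d) ≡ rot H (to d)
      rot-comm (i , toNext , inner) = cong (_, toNext , inner) (at-middle i)
      rot-comm (i , toPrev , inner) = refl
      rot-comm (i , toNext , outer) = cong (_, toPrev , outer) (at-next i)
      rot-comm (i , toPrev , outer) = cong (_, toNext , outer) (at-prev i)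

      rev-comm : ∀ d → to (rev G d) ≡ rev H (to d)
      rev-comm (i , s , inner) = refl
      rev-comm (i , s , outer) = refl

    neighbours⇒≅₃ : (ρ : Label ↔ Label) → Inverse.to ρ x ≡ y → (∀ s → Inverse.to ρ (outerLabel x s) ≡ outerLabel y (other s)) →
      degenerate C x ≅₃ degenerate D y
    neighbours⇒≅₃ ρ ρx ρ-outer = record
      { iso         = record { darts = mk↔ₛ′ to from to∘from from∘to ; rot-comm = rot-comm ; rev-comm = rev-comm }
      ; rename      = ρ
      ; colour-comm = λ { (i , s , inner) → ρx ; (i , s , outer) → ρ-outer s }
      }

-- The renaming that takes x to y and reverses the cyclic order, as happens when the middle vertex
-- crosses the segment between the outer ones.
reflect : Label → Label → Label → Label
reflect x y z = if does (z ≡? x) then y else if does (z ≡? next x) then prev y else next y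

reflect-involutive : ∀ x y z → reflect x y (reflect x y z) ≡ z
reflect-involutive = decide (every? λ x → every? λ y → every? λ z → _ ≡? _) refl

reflection : Label → Label → Label ↔ Label
reflection x y = mk↔ₛ′ (reflect x y) (reflect x y) (reflect-involutive x y) (reflect-involutive x y)

reflect-middle : ∀ x y → reflect x y x ≡ y
reflect-middle = decide (every? λ x → every? λ y → _ ≡? _) refl

reflect-outer : ∀ x y s → reflect x y (outerLabel x s) ≡ outerLabel y (other s)
reflect-outer = decide (every? λ x → every? λ y → every? λ s → _ ≡? _) refl

-- Isomorphisms of contractions, possibly exchanging the two colours of the tree

exchange : Side → End → End
exchange toNext e     = e
exchange toPrev inner = outer
exchange toPrev outer = inner

exchange-involutive : ∀ u e → exchange u (exchange u e) ≡ e
exchange-involutive = decide (every? λ u → every? λ e → _ ≡? _) refl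

module _ {n : ℕ} (C D : Cactus n) (x y : Label) (s t : Side) where

  TreeMatch : Side → Permutation′ n → Set
  TreeMatch u π = ∀ e i → π ⟨$⟩ʳ (contractedTurn C x s e ⟨$⟩ʳ i) ≡ contractedTurn D y t (exchange u e) ⟨$⟩ʳ (π ⟨$⟩ʳ i)

  treeMatch⇒≅ : ∀ u π → TreeMatch u π → contract C x s ≅ contract D y t
  treeMatch⇒≅ u π match = record
    { darts    = mk↔ₛ′ (λ (i , e) → π ⟨$⟩ʳ i , exchange u e) (λ (i , e) → π ⟨$⟩ˡ i , exchange u e)
        (λ (i , e) → cong₂ _,_ (inverseʳ π) (exchange-involutive u e))
        (λ (i , e) → cong₂ _,_ (inverseˡ π) (exchange-involutive u e))
    ; rot-comm = λ (i , e) → cong (_, exchange u e) (match e i)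
    ; rev-comm = rev-comm u
    }
    where
    rev-comm : ∀ u ((i , e) : Fin n × End) → (π ⟨$⟩ʳ i , exchange u (opposite C x e)) ≡ (π ⟨$⟩ʳ i , opposite D y (exchange u e))
    rev-comm toNext (i , inner) = refl
    rev-comm toNext (i , outer) = refl
    rev-comm toPrev (i , inner) = refl
    rev-comm toPrev (i , outer) = refl

-- The degenerated cacti and plane trees of the class

Edge : Set
Edge = Fin 2 × Fin 11

Vertex : Set
Vertex = Fin 2 × Fin 5

-- For each edge a face on its border, the middle label of the degeneration, and
-- the trees obtained by contracting the arcs on the two sides.
pattern 10F = suc 9F

edgeTable : Vec (Vec (Fin 7 × Label × Fin 5 × Fin 5) 11) 2
edgeTable =
  ( (0F , ∗ , 0F , 1F) ∷ (0F , ○ , 2F , 0F) ∷ (0F , ● , 1F , 2F) ∷ (1F , ∗ , 1F , 3F) ∷ (1F , ● , 3F , 2F)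
  ∷ (2F , ∗ , 3F , 1F) ∷ (2F , ● , 1F , 2F) ∷ (3F , ∗ , 1F , 4F) ∷ (3F , ● , 4F , 2F) ∷ (4F , ∗ , 4F , 0F)
  ∷ (6F , ● , 3F , 3F) ∷ []) ∷
  ( (0F , ∗ , 0F , 2F) ∷ (0F , ○ , 3F , 0F) ∷ (0F , ● , 2F , 3F) ∷ (1F , ∗ , 2F , 1F) ∷ (1F , ● , 1F , 3F)
  ∷ (2F , ∗ , 1F , 4F) ∷ (2F , ● , 4F , 3F) ∷ (3F , ○ , 3F , 4F) ∷ (3F , ∗ , 4F , 0F) ∷ (4F , ∗ , 4F , 2F)
  ∷ (6F , ∗ , 4F , 4F) ∷ []) ∷ []

edgeFace : Edge → Face
edgeFace (k , e) = let c , _ = lookup (lookup edgeTable k) e in k , c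

edgeMiddle : Edge → Label
edgeMiddle (k , e) = let _ , x , _ = lookup (lookup edgeTable k) e in x

edgeGraph : Edge → ColouredPlaneGraph
edgeGraph e = degenerate (rep (edgeFace e)) (edgeMiddle e)

end : Edge → Side → Fin 5
end (k , e) s with lookup (lookup edgeTable k) e | s
... | _ , _ , v , _ | toNext = v
... | _ , _ , _ , v | toPrev = v

vertexTable : Vec (Vec (Fin 7 × Label × Side) 5) 2
vertexTable =
  ((0F , ∗ , toNext) ∷ (0F , ∗ , toPrev) ∷ (0F , ○ , toNext) ∷ (1F , ∗ , toPrev) ∷ (3F , ∗ , toPrev) ∷ []) ∷
  ((0F , ∗ , toNext) ∷ (1F , ∗ , toPrev) ∷ (0F , ∗ , toPrev) ∷ (0F , ○ , toNext) ∷ (2F , ∗ , toPrev) ∷ []) ∷ []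

vertexSite : Vertex → Face × Label × Side
vertexSite (k , v) = let c , x , s = lookup (lookup vertexTable k) v in (k , c) , x , s

vertexGraph : Vertex → PlaneGraph
vertexGraph v = let c , x , s = vertexSite v in contract (rep c) x s

-- For each cactus the edges with middle label ∗, ○ and ●. Among the 21 entries of a component the
-- edges 0 to 9 occur twice each, and edge 10 once, on face 6.
borderTable : Vec (Vec (Vec (Fin 11) 3) 7) 2
borderTable =
  ( (0F ∷ 1F ∷ 2F ∷ []) ∷ (3F ∷ 2F ∷ 4F ∷ []) ∷ (5F ∷ 4F ∷ 6F ∷ []) ∷ (7F ∷ 6F ∷ 8F ∷ []) ∷ (9F ∷ 8F ∷ 1F ∷ [])
  ∷ (7F ∷ 9F ∷ 0F ∷ []) ∷ (5F ∷ 3F ∷ 10F ∷ []) ∷ []) ∷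
  ( (0F ∷ 1F ∷ 2F ∷ []) ∷ (3F ∷ 2F ∷ 4F ∷ []) ∷ (5F ∷ 4F ∷ 6F ∷ []) ∷ (8F ∷ 7F ∷ 1F ∷ []) ∷ (9F ∷ 8F ∷ 0F ∷ [])
  ∷ (9F ∷ 3F ∷ 5F ∷ []) ∷ (10F ∷ 6F ∷ 7F ∷ []) ∷ []) ∷ []

border : Face → Label → Edge
border (k , c) x = k , lookup (lookup (lookup borderTable k) c) (row x)

-- All isomorphisms of the class intertwine products of the three turns in various
-- orders, each conjugate to the outer walk rot₇. With σ = walkConjugator c x s, the
-- contraction on side s has σ ∘ rot₇ ∘ σ⁻¹ as the product of its two rotations.
walkConjugator : Face → Label → Side → Permutation′ 7
walkConjugator c ∗ toNext = Perm.id
walkConjugator c ○ toNext = turnPerm c ∗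
walkConjugator c ● toNext = turnPerm c ●
walkConjugator c ∗ toPrev = turnPerm c ●
walkConjugator c ○ toPrev = Perm.id
walkConjugator c ● toPrev = turnPerm c ∗

-- A mirrored isomorphism exchanges the sides, so it identifies the contraction of c on the side
-- `toPrev` with that of d on the side `toNext` and intertwines their products of rotations. The
-- conjugator of c enters without inversion, being the identity or a single turn.
neighbouring : Face → Face → Label → Label → Fin 7 → Permutation′ 7
neighbouring c d x y k = walkConjugator c x toPrev ∘ₚ shift (toℕ k) ∘ₚ walkConjugator d y toNext

BorderCheck : Face → Label → Set
BorderCheck c x = let e = border c x ; d = edgeFace e ; y = edgeMiddle e in
  (d , y) ≡ (c , x) ⊎ ∃ λ k → Neighbours (rep c) (rep d) x y (neighbouring c d x y k)

opaque
  border-check : ∀ c x → BorderCheck c x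
  border-check = decide (every? λ c → every? λ x → let e = border c x ; d = edgeFace e ; y = edgeMiddle e in
    (d , y) ≡? (c , x) ⊎-dec some? λ k → neighbours? (rep c) (rep d) x y (neighbouring c d x y k)) refl

border-≅ : ∀ c x → degenerate (rep c) x ≅₃ edgeGraph (border c x)
border-≅ c x with border-check c x
... | inj₁ same    = subst (λ (d , y) → degenerate (rep c) x ≅₃ degenerate (rep d) y) (sym same) ≅₃-refl
... | inj₂ (k , ν) = neighbours⇒≅₃ _ _ x y {neighbouring c d x y k} ν (reflection x y) (reflect-middle x y) (reflect-outer x y)
  where
  d = edgeFace (border c x)
  y = edgeMiddle (border c x)

contractedEdge : Edge → Side → PlaneGraph
contractedEdge e s = contract (rep (edgeFace e)) (edgeMiddle e) s

-- When the colours of the tree are exchanged, the two rotations are multiplied in the opposite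
-- order; this conjugates their product by the outer rotation, whence the factor `exchanging u`.
treeMatching : (c d : Face) (x y : Label) (s t u : Side) → Fin 7 → Permutation′ 7
treeMatching c d x y s t u k =
  Perm.flip (walkConjugator c x s) ∘ₚ shift (toℕ k) ∘ₚ walkConjugator d y t ∘ₚ exchanging u
  where
  exchanging : Side → Permutation′ 7
  exchanging toNext = Perm.id
  exchanging toPrev = contractedTurn (rep d) y t outer

EndCheck : Edge → Side → Set
EndCheck e s = let c = edgeFace e ; x = edgeMiddle e ; d , y , t = vertexSite (proj₁ e , end e s) in
  ∃₂ λ u k → TreeMatch (rep c) (rep d) x y s t u (treeMatching c d x y s t u k)

opaque
  end-check : ∀ e s → EndCheck e s
  end-check = decide (every? λ e → every? λ s → some? λ u → some? λ k → every? λ i → every? λ j → _ ≡? _) refl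

end-≅ : ∀ e s → contractedEdge e s ≅ vertexGraph (proj₁ e , end e s)
end-≅ e s =
  let u , k , match = end-check e s
      d , y , t = vertexSite (proj₁ e , end e s)
  in treeMatch⇒≅ _ _ (edgeMiddle e) y s t u (treeMatching (edgeFace e) d (edgeMiddle e) y s t u k) match

-- Distinguishing the edges, vertices and faces of the class

opaque
  edges-distinguished : ∀ e e′ → e ≡ e′ ⊎ Distinguished {graph (edgeGraph e)} {graph (edgeGraph e′)} (0F , toNext , inner)
  edges-distinguished = decide (every? λ e → every? λ e′ → e ≡? e′ ⊎-dec
    distinguished? {graph (edgeGraph e)} {graph (edgeGraph e′)} (0F , toNext , inner)) refl

edgeGraph-injective : ∀ e e′ → edgeGraph e ≅₃ edgeGraph e′ → e ≡ e′
edgeGraph-injective e e′ φ with edges-distinguished e e′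
... | inj₁ e≡e′ = e≡e′
... | inj₂ dist = contradiction (_≅₃_.iso φ) (distinguished⇒≇ dist)

opaque
  -- Trees are compared only within one component, in agreement with the identification of vertices
  -- in a moduli space.
  vertices-distinguished : ∀ k v v′ → v ≡ v′ ⊎ Distinguished {vertexGraph (k , v)} {vertexGraph (k , v′)} (0F , inner)
  vertices-distinguished = decide (every? λ k → every? λ v → every? λ v′ → v ≡? v′ ⊎-dec
    distinguished? {vertexGraph (k , v)} {vertexGraph (k , v′)} (0F , inner)) refl

vertexGraph-injective : ∀ k v v′ → vertexGraph (k , v) ≅ vertexGraph (k , v′) → v ≡ v′
vertexGraph-injective k v v′ φ with vertices-distinguished k v v′
... | inj₁ v≡v′ = v≡v′
... | inj₂ dist = contradiction φ (distinguished⇒≇ dist)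

opaque
  borders-differ : ∀ c c′ → c ≡ c′ ⊎ ∃ λ x → ∀ y → border c x ≢ border c′ y
  borders-differ = decide (every? λ c → every? λ c′ → c ≡? c′ ⊎-dec
    some? λ x → every? λ y → ¬? (border c x ≡? border c′ y)) refl

border-relabel : ∀ {C c} (φ : C ≅ᶜ rep c) x → degenerate C x ≅₃ edgeGraph (border c (_≅ᶜ_.relabel φ x))
border-relabel {c = c} φ x = ≅₃-trans (degenerate-≅ φ x) (border-≅ c (_≅ᶜ_.relabel φ x))

border-≅-border : ∀ c c′ (φ : rep c ≅ᶜ rep c′) x → edgeGraph (border c x) ≅₃ edgeGraph (border c′ (_≅ᶜ_.relabel φ x))
border-≅-border c c′ φ x =
  ≅₃-trans {edgeGraph (border c x)} {degenerate (rep c) x} {edgeGraph (border c′ (_≅ᶜ_.relabel φ x))}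
    (≅₃-sym {degenerate (rep c) x} {edgeGraph (border c x)} (border-≅ c x)) (border-relabel {rep c} {c′} φ x)

border-preserved : ∀ c c′ (φ : rep c ≅ᶜ rep c′) x → border c x ≡ border c′ (_≅ᶜ_.relabel φ x)
border-preserved c c′ φ x =
  edgeGraph-injective (border c x) (border c′ (_≅ᶜ_.relabel φ x)) (border-≅-border c c′ φ x)

-- No invariant of cacti is computed: an isomorphism matches the borders edge by edge, and different
-- faces have different sets of border edges.
rep-injective : ∀ c c′ → rep c ≅ᶜ rep c′ → c ≡ c′
rep-injective c c′ φ with borders-differ c c′
... | inj₁ c≡c′         = c≡c′
... | inj₂ (x , differ) = contradiction (border-preserved c c′ φ x) (differ (_≅ᶜ_.relabel φ x))

-- Surface maps labelled by the faces, edges and vertices of the class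

orbit-closed : {A : Set} {moves : List (A → A)} (P : A → Set) →
  (∀ {m} → m ∈ moves → ∀ a → P a → P (m a)) → ∀ {a b} → Orbit moves a b → P a → P b
orbit-closed P closed ε        p = p
orbit-closed {A} P closed (s ◅ t) p = orbit-closed P closed t (step closed s p)
  where
  step : ∀ {moves : List (A → A)} {a b} → (∀ {m} → m ∈ moves → ∀ a → P a → P (m a)) →
    Any (λ m → m a ≡ b) moves → P a → P b
  step closed (here refl) p = closed (here refl) _ p
  step closed (there s)   p = step (closed ∘ there) s p

orbit-move : {A : Set} {moves : List (A → A)} {m : A → A} → m ∈ moves → ∀ a → Orbit moves a (m a)
orbit-move m∈ a = inject m∈ ◅ ε
  where
  inject : ∀ {moves m} → m ∈ moves → Any (λ m′ → m′ a ≡ m a) moves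
  inject (here refl) = here refl
  inject (there m∈)  = there (inject m∈)

-- What remains of a moduli space when cacti, degenerated cacti and trees are replaced by their
-- numbers. A vertex is numbered inside its component, so `sameVertex` speaks of flags of one
-- component only.
record Labelling (S : SurfaceMap) : Set where
  open SurfaceMap S
  field
    face   : Flag → Face
    edge   : Flag → Edge
    vertex : Flag → Fin 5
    sameFace   : ∀ f g → SameFace f g ⇔ face f ≡ face g
    sameEdge   : ∀ f g → SameEdge f g ⇔ edge f ≡ edge g
    incident   : ∀ f → ∃ λ x → edge f ≡ border (face f) x
    corner     : ∀ f x → ∃ λ g → SameFace f g × edge g ≡ border (face f) x
    realised   : ∀ c → ∃ λ f → face f ≡ c
    sameVertex : ∀ f g → SameComponent f g → SameVertex f g ⇔ vertex f ≡ vertex g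
    ends       : ∀ f → ∃ λ s → vertex f ≡ end (edge f) s × vertex (flipV f) ≡ end (edge f) (other s)

-- Incidences read off from the tables

Adjacent : Face → Face → Set
Adjacent c c′ = ∃₂ λ x y → border c x ≡ border c′ y

opaque
  -- Faces sharing a border edge lie in one component of the surface; so all seven faces with the
  -- same first index are linked through face 0.
  within-two : ∀ k c → ∃ λ m → Adjacent (k , c) (k , m) × Adjacent (k , m) (k , 0F)
  within-two = decide (every? λ k → every? λ c → some? λ (m : Fin 7) →
    (some? λ x → some? λ y → _ ≡? _) ×-dec (some? λ x → some? λ y → _ ≡? _)) refl

opaque
  border-edgeMiddle : ∀ e → border (edgeFace e) (edgeMiddle e) ≡ e
  border-edgeMiddle = decide (every? λ e → _ ≡? _) refl

opaque
  end-onto : ∀ k v → ∃₂ λ e s → end (k , e) s ≡ v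
  end-onto = decide (every? λ k → every? λ v → some? λ e → some? λ s → _ ≡? _) refl

-- The face 6 has two edges joining apex k to base k, and the loop 10 at base k, on
-- both sides of which it lies.
flank : Fin 2 → Side → Fin 11
flank 0F toNext = 5F
flank 0F toPrev = 3F
flank 1F toNext = 6F
flank 1F toPrev = 7F

apex base : Fin 2 → Fin 5
apex = lookup (1F ∷ 3F ∷ [])
base = lookup (3F ∷ 4F ∷ [])

opaque
  apex≢base : ∀ k → apex k ≢ base k
  apex≢base = decide (every? λ k → ¬? (_ ≡? _)) refl

opaque
  flank≢loop : ∀ k s → flank k s ≢ 10F
  flank≢loop = decide (every? λ k → every? λ s → ¬? (_ ≡? _)) refl

opaque
  flank-distinct : ∀ k → flank k toNext ≢ flank k toPrev
  flank-distinct = decide (every? λ k → ¬? (_ ≡? _)) refl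

opaque
  border-loopFace : ∀ k x → (∃ λ s → border (k , 6F) x ≡ (k , flank k s)) ⊎ border (k , 6F) x ≡ (k , 10F)
  border-loopFace = decide (every? λ k → every? λ x → (some? λ s → _ ≡? _) ⊎-dec (_ ≡? _)) refl

opaque
  flank-on-border : ∀ k s → ∃ λ x → border (k , 6F) x ≡ (k , flank k s)
  flank-on-border = decide (every? λ k → every? λ s → some? λ x → _ ≡? _) refl

opaque
  flank-other-face : ∀ k s → ∃ λ c → c ≢ 6F × ∃ λ x → border (k , c) x ≡ (k , flank k s)
  flank-other-face = decide (every? λ k → every? λ s → some? λ c → ¬? (_ ≡? _) ×-dec some? λ x → _ ≡? _) refl

opaque
  -- So both sides of edge 10 lie on face 6, and all four of its flags belong to this face.
  loop-face : ∀ k c x → border c x ≡ (k , 10F) → c ≡ (k , 6F)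
  loop-face = decide (every? λ k → every? λ c → every? λ x → (_ ≡? _) →-dec (_ ≡? _)) refl

opaque
  loop-ends : ∀ k s → end (k , 10F) s ≡ base k
  loop-ends = decide (every? λ k → every? λ s → _ ≡? _) refl

opaque
  flank-ends : ∀ k s t → (end (k , flank k s) t ≡ base k × end (k , flank k s) (other t) ≡ apex k) ⊎
                         (end (k , flank k s) t ≡ apex k × end (k , flank k s) (other t) ≡ base k)
  flank-ends = decide (every? λ k → every? λ s → every? λ t →
    ((_ ≡? _) ×-dec (_ ≡? _)) ⊎-dec ((_ ≡? _) ×-dec (_ ≡? _))) refl

-- Components and counts of a labelled map

module Labelled (S : SurfaceMap) (L : Labelling S) where
  open SurfaceMap S
  open Labelling L
  open Equivalence using (to; from)

  component : Flag → Fin 2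
  component f = proj₁ (face f)

  edge-component : ∀ f → proj₁ (edge f) ≡ component f
  edge-component f = cong proj₁ (proj₂ (incident f))

  face-flipV : ∀ f → face (flipV f) ≡ face f
  face-flipV f = sym (to (sameFace f _) (orbit-move (here refl) f))

  face-flipE : ∀ f → face (flipE f) ≡ face f
  face-flipE f = sym (to (sameFace f _) (orbit-move (there (here refl)) f))

  edge-flipV : ∀ f → edge (flipV f) ≡ edge f
  edge-flipV f = sym (to (sameEdge f _) (orbit-move (here refl) f))

  edge-flipF : ∀ f → edge (flipF f) ≡ edge f
  edge-flipF f = sym (to (sameEdge f _) (orbit-move (there (here refl)) f))

  component-flipF : ∀ f → component (flipF f) ≡ component f
  component-flipF f = trans (sym (edge-component (flipF f))) (trans (cong proj₁ (edge-flipF f)) (edge-component f))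

  sameComponent⇒ : ∀ {f g} → SameComponent f g → component f ≡ component g
  sameComponent⇒ {f} path = sym (orbit-closed (λ g → component g ≡ component f) closed path refl)
    where
    closed : ∀ {m} → m ∈ flipV ∷ flipE ∷ flipF ∷ [] → ∀ g → component g ≡ component f → component (m g) ≡ component f
    closed (here refl)                 g = trans (cong proj₁ (face-flipV g))
    closed (there (here refl))         g = trans (cong proj₁ (face-flipE g))
    closed (there (there (here refl))) g = trans (component-flipF g)

  sameFace⊆ : ∀ {f g} → SameFace f g → SameComponent f g
  sameFace⊆ = Star.map λ { (here eq) → here eq ; (there (here eq)) → there (here eq) }

  sameEdge⊆ : ∀ {f g} → SameEdge f g → SameComponent f g
  sameEdge⊆ = Star.map λ { (here eq) → here eq ; (there (here eq)) → there (there (here eq)) }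

  adjacent⇒ : ∀ {f g} → Adjacent (face f) (face g) → SameComponent f g
  adjacent⇒ {f} {g} (x , y , eq) =
    let f₁ , f~f₁ , edge-f₁ = corner f x
        g₁ , g~g₁ , edge-g₁ = corner g y
    in sameFace⊆ f~f₁ ◅◅ sameEdge⊆ (from (sameEdge f₁ g₁) (trans edge-f₁ (trans eq (sym edge-g₁))))
         ◅◅ sameFace⊆ (from (sameFace g₁ g) (sym (to (sameFace g g₁) g~g₁)))

  -- Paths are given in both directions because an `Orbit` path is directed; each direction is built
  -- from adjacencies, which are symmetric.
  linked-root : ∀ {f r} → face r ≡ (component f , 0F) → SameComponent f r × SameComponent r f
  linked-root {f} {r} root =
    let m , c~m , m~0 = within-two (component f) (proj₂ (face f))
        h , face-h    = realised (component f , m)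
        f~h = subst (Adjacent (face f)) (sym face-h) c~m
        h~r = subst₂ Adjacent (sym face-h) (sym root) m~0
    in (adjacent⇒ f~h ◅◅ adjacent⇒ h~r) , (adjacent⇒ (backwards h~r) ◅◅ adjacent⇒ (backwards f~h))
    where
    backwards : ∀ {c c′} → Adjacent c c′ → Adjacent c′ c
    backwards (x , y , eq) = y , x , sym eq

  linked : ∀ f g → component f ≡ component g → SameComponent f g
  linked f g eq =
    let r , root = realised (component f , 0F)
    in proj₁ (linked-root root) ◅◅ proj₂ (linked-root (trans root (cong (_, 0F) eq)))

  components : HasClasses Flag SameComponent 2
  components = record
    { class     = component
    ; onto      = λ k → let f , eq = realised (k , 0F) in f , cong proj₁ eq
    ; separates = λ f g → mk⇔ (linked f g) sameComponent⇒
    }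

  vertex-step : ∀ {f g} → component f ≡ component g → SameVertex f g → vertex f ≡ vertex g
  vertex-step {f} {g} eq = to (sameVertex f g (linked f g eq))

  vertex-flipE : ∀ f → vertex (flipE f) ≡ vertex f
  vertex-flipE f = sym (vertex-step (sym (cong proj₁ (face-flipE f))) (orbit-move (here refl) f))

  edge-realised : ∀ e → ∃ λ f → edge f ≡ e × component f ≡ proj₁ e
  edge-realised e =
    let f , face-f      = realised (edgeFace e)
        g , f~g , edge-g = corner f (edgeMiddle e)
    in g , trans edge-g (trans (cong (λ c → border c (edgeMiddle e)) face-f) (border-edgeMiddle e)) ,
       cong proj₁ (trans (sym (to (sameFace f g) f~g)) face-f)

  module _ (f : Flag) where

    private
      same : (g h : Component f) → component (proj₁ g) ≡ component (proj₁ h)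
      same (g , f~g) (h , f~h) = trans (sym (sameComponent⇒ f~g)) (sameComponent⇒ f~h)

      pair-≡ : {A : Set} {k l : Fin 2} {a b : A} → k ≡ l → a ≡ b → (k , a) ≡ (l , b)
      pair-≡ refl refl = refl

    counts : HasCounts f 7 11 5
    counts = record
      { faceCount   = record
        { class     = λ (g , _) → proj₂ (face g)
        ; onto      = λ c → let g , eq = realised (component f , c) in
            (g , linked f g (sym (cong proj₁ eq))) , cong proj₂ eq
        ; separates = λ g h → mk⇔
            (λ eq → from (sameFace (proj₁ g) (proj₁ h)) (pair-≡ (same g h) eq))
            (λ s → cong proj₂ (to (sameFace (proj₁ g) (proj₁ h)) s))
        }
      ; edgeCount   = record
        { class     = λ (g , _) → proj₂ (edge g)
        ; onto      = λ e → let g , eq , k = edge-realised (component f , e) in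
            (g , linked f g (sym k)) , cong proj₂ eq
        ; separates = λ g h → mk⇔
            (λ eq → from (sameEdge (proj₁ g) (proj₁ h))
              (pair-≡ (trans (edge-component (proj₁ g)) (trans (same g h) (sym (edge-component (proj₁ h))))) eq))
            (λ s → cong proj₂ (to (sameEdge (proj₁ g) (proj₁ h)) s))
        }
      ; vertexCount = record
        { class     = λ (g , _) → vertex g
        ; onto      = vertex-onto
        ; separates = λ (g , f~g) (h , f~h) →
            let v = sameVertex g h (linked g h (same (g , f~g) (h , f~h))) in mk⇔ (from v) (to v)
        }
      }
      where
      vertex-onto : ∀ v → ∃ λ (g : Component f) → vertex (proj₁ g) ≡ v
      vertex-onto v with end-onto (component f) v
      ... | e , s , end≡v with edge-realised (component f , e)
      ... | g , edge-g , k with ends g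
      -- The flag g lies on the right edge but possibly at its other end; then `flipV g` is taken.
      ... | t , here≡ , there≡ with s | t
      ... | toNext | toNext = (g , linked f g (sym k)) , trans here≡ (trans (cong (λ e → end e toNext) edge-g) end≡v)
      ... | toPrev | toPrev = (g , linked f g (sym k)) , trans here≡ (trans (cong (λ e → end e toPrev) edge-g) end≡v)
      ... | toNext | toPrev = (flipV g , linked f (flipV g) (sym (trans (cong proj₁ (face-flipV g)) k))) ,
                              trans there≡ (trans (cong (λ e → end e toNext) edge-g) end≡v)
      ... | toPrev | toNext = (flipV g , linked f (flipV g) (sym (trans (cong proj₁ (face-flipV g)) k))) ,
                              trans there≡ (trans (cong (λ e → end e toPrev) edge-g) end≡v)

  -- Around the loop face

  edge-flags : ∀ {f g} → edge f ≡ edge g → g ∈ f ∷ flipV f ∷ flipF f ∷ flipV (flipF f) ∷ []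
  edge-flags {f} {g} eq = orbit-closed (_∈ f ∷ flipV f ∷ flipF f ∷ flipV (flipF f) ∷ []) closed
    (from (sameEdge f g) eq) (here refl)
    where
    closed : ∀ {m} → m ∈ flipV ∷ flipF ∷ [] → ∀ g → g ∈ f ∷ flipV f ∷ flipF f ∷ flipV (flipF f) ∷ [] →
      m g ∈ f ∷ flipV f ∷ flipF f ∷ flipV (flipF f) ∷ []
    closed (here refl) _ (here refl)                         = there (here refl)
    closed (here refl) _ (there (here refl))                 = here (flipV-involutive f)
    closed (here refl) _ (there (there (here refl)))         = there (there (there (here refl)))
    closed (here refl) _ (there (there (there (here refl)))) = there (there (here (flipV-involutive _)))
    closed (there (here refl)) _ (here refl)                 = there (there (here refl))
    closed (there (here refl)) _ (there (here refl))         = there (there (there (here (sym (flipVF-comm f)))))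
    closed (there (here refl)) _ (there (there (here refl))) = here (flipF-involutive f)
    closed (there (here refl)) _ (there (there (there (here refl)))) =
      there (here (trans (sym (flipVF-comm (flipF f))) (cong flipV (flipF-involutive f))))

  module _ (k : Fin 2) where

    OnLoopFace : Flag → Set
    OnLoopFace f = face f ≡ (k , 6F)

    record Flank (s : Side) : Set where
      field
        flag   : Flag
        edge≡  : edge flag ≡ (k , flank k s)
        face≡  : OnLoopFace flag
        base≡  : vertex flag ≡ base k
        apex≡  : vertex (flipV flag) ≡ apex k
        unique : ∀ f → edge f ≡ (k , flank k s) → OnLoopFace f → f ≡ flag ⊎ f ≡ flipV flag

    flank-flag : ∀ s → Flank s
    flank-flag s = oriented (ends f)
      where
      corner-f = corner (proj₁ (realised (k , 6F))) (proj₁ (flank-on-border k s))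
      f : Flag
      f = proj₁ corner-f
      face-f : OnLoopFace f
      face-f = trans (sym (to (sameFace _ f) (proj₁ (proj₂ corner-f)))) (proj₂ (realised (k , 6F)))
      edge-f : edge f ≡ (k , flank k s)
      edge-f = trans (proj₂ (proj₂ corner-f)) (trans (cong (λ c → border c (proj₁ (flank-on-border k s)))
        (proj₂ (realised (k , 6F)))) (proj₂ (flank-on-border k s)))
      -- Otherwise all four flags of the flank would lie on the loop face, although the flank also
      -- borders another face. So the loop face contains only f and `flipV f` of it.
      across : face (flipF f) ≢ (k , 6F)
      across face-Ff =
        let c , c≢6 , x , border≡ = flank-other-face k s
            g , face-g           = realised (k , c)
            h , g~h , edge-h     = corner g x
            face-h : face h ≡ (k , c)
            face-h = trans (sym (to (sameFace g h) g~h)) face-g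
        in c≢6 (cong proj₂ (trans (sym face-h) (on-loop-face h
             (edge-flags (trans edge-f (sym (trans edge-h (trans (cong (λ c → border c x) face-g) border≡))))))))
        where
        on-loop-face : ∀ h → h ∈ f ∷ flipV f ∷ flipF f ∷ flipV (flipF f) ∷ [] → OnLoopFace h
        on-loop-face _ (here refl)                         = face-f
        on-loop-face _ (there (here refl))                 = trans (face-flipV f) face-f
        on-loop-face _ (there (there (here refl)))         = face-Ff
        on-loop-face _ (there (there (there (here refl)))) = trans (face-flipV _) face-Ff
      unique-f : ∀ g → edge g ≡ (k , flank k s) → OnLoopFace g → g ≡ f ⊎ g ≡ flipV f
      unique-f g edge-g face-g with edge-flags (trans edge-f (sym edge-g))
      ... | here refl                         = inj₁ refl
      ... | there (here refl)                 = inj₂ refl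
      ... | there (there (here refl))         = contradiction face-g across
      ... | there (there (there (here refl))) = contradiction (trans (sym (face-flipV _)) face-g) across
      oriented : (∃ λ t → vertex f ≡ end (edge f) t × vertex (flipV f) ≡ end (edge f) (other t)) → Flank s
      oriented (t , vertex-f , vertex-Vf) with flank-ends k s t
      ... | inj₁ (here-base , there-apex) = record
        { flag   = f
        ; edge≡  = edge-f
        ; face≡  = face-f
        ; base≡  = trans vertex-f (trans (cong (λ e → end e t) edge-f) here-base)
        ; apex≡  = trans vertex-Vf (trans (cong (λ e → end e (other t)) edge-f) there-apex)
        ; unique = unique-f
        }
      ... | inj₂ (here-apex , there-base) = record
        { flag   = flipV f
        ; edge≡  = trans (edge-flipV f) edge-f
        ; face≡  = trans (face-flipV f) face-f
        ; base≡  = trans vertex-Vf (trans (cong (λ e → end e (other t)) edge-f) there-base)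
        ; apex≡  = trans (cong vertex (flipV-involutive f)) (trans vertex-f (trans (cong (λ e → end e t) edge-f) here-apex))
        ; unique = λ g edge-g face-g → Sum.swap (Sum.map₁ (λ eq → trans eq (sym (flipV-involutive f))) (unique-f g edge-g face-g))
        }

    OnLoop : Flag → Set
    OnLoop f = edge f ≡ (k , 10F)

    onLoop⇒face : ∀ f → OnLoop f → OnLoopFace f
    onLoop⇒face f edge-f = let x , eq = incident f in loop-face k (face f) x (trans (sym eq) edge-f)

    onLoop⇒base : ∀ f → OnLoop f → vertex f ≡ base k
    onLoop⇒base f edge-f = let s , eq , _ = ends f in trans eq (trans (cong (λ e → end e s) edge-f) (loop-ends k s))

    private
      module P = Flank (flank-flag toNext)
      module Q = Flank (flank-flag toPrev)
      p q : Flag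
      p = P.flag
      q = Q.flag

    -- The eight flags of the loop face: two on each flank and the four of the loop.
    data Place (f : Flag) : Set where
      at-p  : f ≡ p → Place f
      at-Vp : f ≡ flipV p → Place f
      at-q  : f ≡ q → Place f
      at-Vq : f ≡ flipV q → Place f
      loop  : OnLoop f → Place f

    place : ∀ f → OnLoopFace f → Place f
    place f face-f with incident f
    ... | x , edge-f with border-loopFace k x
    ... | inj₂ eq            = loop (trans edge-f (trans (cong (λ c → border c x) face-f) eq))
    ... | inj₁ (toNext , eq) with P.unique f (trans edge-f (trans (cong (λ c → border c x) face-f) eq)) face-f
    ...   | inj₁ f≡p  = at-p f≡p
    ...   | inj₂ f≡Vp = at-Vp f≡Vp
    place f face-f | x , edge-f | inj₁ (toPrev , eq) with Q.unique f (trans edge-f (trans (cong (λ c → border c x) face-f) eq)) face-f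
    ...   | inj₁ f≡q  = at-q f≡q
    ...   | inj₂ f≡Vq = at-Vq f≡Vq

    flipE-injective : ∀ {f g} → flipE f ≡ flipE g → f ≡ g
    flipE-injective eq = trans (sym (flipE-involutive _)) (trans (cong flipE eq) (flipE-involutive _))

    flipE-swap : ∀ {f g} → flipE f ≡ g → flipE g ≡ f
    flipE-swap refl = flipE-involutive _

    p≢q : p ≢ q
    p≢q eq = flank-distinct k (cong proj₂ (trans (sym P.edge≡) (trans (cong edge eq) Q.edge≡)))

    p-off-loop : ¬ OnLoop p
    p-off-loop eq = flank≢loop k toNext (cong proj₂ (trans (sym P.edge≡) eq))

    Vp-off-loop : ¬ OnLoop (flipV p)
    Vp-off-loop = p-off-loop ∘ trans (sym (edge-flipV p))

    q-off-loop : ¬ OnLoop q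
    q-off-loop eq = flank≢loop k toPrev (cong proj₂ (trans (sym Q.edge≡) eq))

    Vq-off-loop : ¬ OnLoop (flipV q)
    Vq-off-loop = q-off-loop ∘ trans (sym (edge-flipV q))

    apex-off-base : ∀ {f} → vertex f ≡ apex k → vertex f ≢ base k
    apex-off-base f-apex f-base = apex≢base k (trans (sym f-apex) f-base)

    -- The apex is reached only along the two flanks, by one flag of the face on each; so the corner
    -- there pairs these flags.
    flipE-Vp : flipE (flipV p) ≡ flipV q
    flipE-Vp with place (flipE (flipV p)) (trans (face-flipE _) (trans (face-flipV p) P.face≡))
    ... | at-p eq  = contradiction (trans (cong vertex eq) P.base≡) (apex-off-base (trans (vertex-flipE _) P.apex≡))
    ... | at-Vp eq = contradiction eq (flipE-free _)
    ... | at-q eq  = contradiction (trans (cong vertex eq) Q.base≡) (apex-off-base (trans (vertex-flipE _) P.apex≡))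
    ... | at-Vq eq = eq
    ... | loop on  = contradiction (onLoop⇒base _ on) (apex-off-base (trans (vertex-flipE _) P.apex≡))

    loop-flag : ∃ OnLoop
    loop-flag = let f , eq , _ = edge-realised (k , 10F) in f , eq

    reaches-loop : ∀ {f} → OnLoopFace f → ∀ g → OnLoop g → SameFace f g
    reaches-loop face-f g on = from (sameFace _ g) (trans face-f (sym (onLoop⇒face g on)))

    -- If p were paired with q, the boundary of the face would close up after the two flanks and
    -- miss the loop.
    flipE-p-on-loop : OnLoop (flipE p)
    flipE-p-on-loop with place (flipE p) (trans (face-flipE p) P.face≡)
    ... | at-p eq  = contradiction eq (flipE-free p)
    ... | at-Vp eq = contradiction (trans (sym (vertex-flipE p)) (cong vertex eq)) λ vp≡ →
                       apex-off-base P.apex≡ (trans (sym vp≡) P.base≡)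
    ... | at-Vq eq = contradiction (trans (sym (cong vertex eq)) (trans (vertex-flipE p) P.base≡)) (apex-off-base Q.apex≡)
    ... | loop on  = on
    ... | at-q eq  = contradiction (proj₂ loop-flag) (off-loop (orbit-closed (_∈ four) closed
                       (reaches-loop P.face≡ (proj₁ loop-flag) (proj₂ loop-flag)) (here refl)))
      where
      four : List Flag
      four = p ∷ flipV p ∷ q ∷ flipV q ∷ []
      closed : ∀ {m} → m ∈ flipV ∷ flipE ∷ [] → ∀ f → f ∈ four → m f ∈ four
      closed (here refl)         _ (here refl)                         = there (here refl)
      closed (here refl)         _ (there (here refl))                 = here (flipV-involutive p)
      closed (here refl)         _ (there (there (here refl)))         = there (there (there (here refl)))
      closed (here refl)         _ (there (there (there (here refl)))) = there (there (here (flipV-involutive q)))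
      closed (there (here refl)) _ (here refl)                         = there (there (here eq))
      closed (there (here refl)) _ (there (here refl))                 = there (there (there (here flipE-Vp)))
      closed (there (here refl)) _ (there (there (here refl)))         = here (flipE-swap eq)
      closed (there (here refl)) _ (there (there (there (here refl)))) = there (here (flipE-swap flipE-Vp))
      off-loop : ∀ {f} → f ∈ four → ¬ OnLoop f
      off-loop (here refl)                         = p-off-loop
      off-loop (there (here refl))                 = Vp-off-loop
      off-loop (there (there (here refl)))         = q-off-loop
      off-loop (there (there (there (here refl)))) = Vq-off-loop

    -- Following an orientation around the loop face

    module _ (sign : Flag → Bool)
             (alternates : ∀ f → component f ≡ k → sign (flipV f) ≡ not (sign f) ×
                                                   sign (flipE f) ≡ not (sign f) × sign (flipF f) ≡ not (sign f)) where

      private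
        ℓ : Flag
        ℓ = flipE p

        on-V : OnLoop (flipV ℓ)
        on-V = trans (edge-flipV ℓ) flipE-p-on-loop

        on-F : OnLoop (flipF ℓ)
        on-F = trans (edge-flipF ℓ) flipE-p-on-loop

        on-face : ∀ {f} → OnLoopFace f → component f ≡ k
        on-face = cong proj₁

        σ : Bool
        σ = sign p

        signV : ∀ {f b} → OnLoopFace f → sign f ≡ b → sign (flipV f) ≡ not b
        signV {f} face-f eq = trans (proj₁ (alternates f (on-face face-f))) (cong not eq)

        signE : ∀ {f b} → OnLoopFace f → sign f ≡ b → sign (flipE f) ≡ not b
        signE {f} face-f eq = trans (proj₁ (proj₂ (alternates f (on-face face-f)))) (cong not eq)

        signF : ∀ {f b} → OnLoopFace f → sign f ≡ b → sign (flipF f) ≡ not b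
        signF {f} face-f eq = trans (proj₂ (proj₂ (alternates f (on-face face-f)))) (cong not eq)

        sign-Vq : sign (flipV q) ≡ σ
        sign-Vq = trans (cong sign (sym flipE-Vp)) (trans (signE (trans (face-flipV p) P.face≡) (signV P.face≡ refl))
                    (not-involutive σ))

        sign-q : sign q ≡ not σ
        sign-q = trans (cong sign (sym (flipV-involutive q))) (signV (trans (face-flipV q) Q.face≡) sign-Vq)

        sign-Eq : sign (flipE q) ≡ σ
        sign-Eq = trans (signE Q.face≡ sign-q) (not-involutive σ)

        sign-ℓ : sign ℓ ≡ not σ
        sign-ℓ = signE P.face≡ refl

        face-ℓ : OnLoopFace ℓ
        face-ℓ = onLoop⇒face ℓ flipE-p-on-loop

        sign-VFℓ : sign (flipV (flipF ℓ)) ≡ not σ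
        sign-VFℓ = trans (signV (onLoop⇒face _ on-F) (signF face-ℓ sign-ℓ)) (cong not (not-involutive σ))

        sign-clash : ∀ {f b} → sign f ≡ not b → sign f ≢ b
        sign-clash {b = b} f₁ f₂ = not-¬ {b} refl (trans (sym f₂) f₁)

        Fℓ≢ℓ : flipF ℓ ≢ ℓ
        Fℓ≢ℓ = flipF-free ℓ

        Fℓ≢Vℓ : flipF ℓ ≢ flipV ℓ
        Fℓ≢Vℓ eq = flipVF-free ℓ (trans (cong flipV eq) (flipV-involutive ℓ))

        flipE-q-on-loop : OnLoop (flipE q)
        flipE-q-on-loop with place (flipE q) (trans (face-flipE q) Q.face≡)
        ... | at-p eq  = contradiction (subst OnLoop (flipE-swap eq) flipE-p-on-loop) q-off-loop
        ... | at-Vp eq = contradiction (trans (sym (cong vertex eq)) (trans (vertex-flipE q) Q.base≡)) (apex-off-base P.apex≡)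
        ... | at-q eq  = contradiction eq (flipE-free q)
        ... | at-Vq eq = contradiction (trans (sym (cong vertex eq)) (trans (vertex-flipE q) Q.base≡)) (apex-off-base Q.apex≡)
        ... | loop on  = on

        -- The face would close up before reaching the other side of the loop.
        flipE-q≢Vℓ : flipE q ≢ flipV ℓ
        flipE-q≢Vℓ Eq≡Vℓ = missing (orbit-closed (_∈ six) closed (reaches-loop P.face≡ (flipF ℓ) on-F) (here refl))
          where
          six : List Flag
          six = p ∷ flipV p ∷ q ∷ flipV q ∷ ℓ ∷ flipV ℓ ∷ []
          closed : ∀ {m} → m ∈ flipV ∷ flipE ∷ [] → ∀ f → f ∈ six → m f ∈ six
          closed (here refl) _ (here refl)                                         = there (here refl)
          closed (here refl) _ (there (here refl))                                 = here (flipV-involutive p)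
          closed (here refl) _ (there (there (here refl)))                         = there (there (there (here refl)))
          closed (here refl) _ (there (there (there (here refl))))                 = there (there (here (flipV-involutive q)))
          closed (here refl) _ (there (there (there (there (here refl)))))         = there (there (there (there (there (here refl)))))
          closed (here refl) _ (there (there (there (there (there (here refl)))))) = there (there (there (there (here (flipV-involutive ℓ)))))
          closed (there (here refl)) _ (here refl)                                         = there (there (there (there (here refl))))
          closed (there (here refl)) _ (there (here refl))                                 = there (there (there (here flipE-Vp)))
          closed (there (here refl)) _ (there (there (here refl)))                         = there (there (there (there (there (here Eq≡Vℓ)))))
          closed (there (here refl)) _ (there (there (there (here refl))))                 = there (here (flipE-swap flipE-Vp))
          closed (there (here refl)) _ (there (there (there (there (here refl)))))         = here (flipE-involutive p)
          closed (there (here refl)) _ (there (there (there (there (there (here refl)))))) = there (there (here (flipE-swap Eq≡Vℓ)))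
          missing : ¬ (flipF ℓ ∈ six)
          missing (here eq)                                         = p-off-loop (subst OnLoop eq on-F)
          missing (there (here eq))                                 = Vp-off-loop (subst OnLoop eq on-F)
          missing (there (there (here eq)))                         = q-off-loop (subst OnLoop eq on-F)
          missing (there (there (there (here eq))))                 = Vq-off-loop (subst OnLoop eq on-F)
          missing (there (there (there (there (here eq)))))         = Fℓ≢ℓ eq
          missing (there (there (there (there (there (here eq)))))) = Fℓ≢Vℓ eq

        -- Of the four loop flags, ℓ is already paired with p, `flipV ℓ` has just been excluded, and
        -- `flipV (flipF ℓ)` has the wrong sign.
        flipE-q≡Fℓ : flipE q ≡ flipF ℓ
        flipE-q≡Fℓ with edge-flags {ℓ} (trans flipE-p-on-loop (sym flipE-q-on-loop))
        ... | here eq                         = contradiction (sym (flipE-injective eq)) p≢q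
        ... | there (here eq)                 = contradiction eq flipE-q≢Vℓ
        ... | there (there (here eq))         = eq
        ... | there (there (there (here eq))) = contradiction (trans (sym (cong sign eq)) sign-Eq) (sign-clash sign-VFℓ)

        sign-EVℓ : sign (flipE (flipV ℓ)) ≡ not σ
        sign-EVℓ = trans (signE (onLoop⇒face _ on-V) (signV face-ℓ sign-ℓ)) (cong not (not-involutive σ))

        -- Every other flag of the face is excluded: p and `flipF ℓ` by sign, those at the apex by
        -- their vertex, q and ℓ by the corners already found, and `flipV ℓ` because `flipE` has no
        -- fixed flag.
        flipE-Vℓ : flipE (flipV ℓ) ≡ flipV (flipF ℓ)
        flipE-Vℓ with place (flipE (flipV ℓ)) (trans (face-flipE _) (onLoop⇒face _ on-V))
        ... | at-p eq  = contradiction (cong sign eq) (sign-clash sign-EVℓ)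
        ... | at-Vp eq = contradiction (trans (sym (cong vertex eq)) (trans (vertex-flipE _) (onLoop⇒base _ on-V))) (apex-off-base P.apex≡)
        ... | at-q eq  = contradiction (trans (sym flipE-q≡Fℓ) (flipE-swap eq)) Fℓ≢Vℓ
        ... | at-Vq eq = contradiction (trans (sym (cong vertex eq)) (trans (vertex-flipE _) (onLoop⇒base _ on-V))) (apex-off-base Q.apex≡)
        ... | loop on with edge-flags {ℓ} (trans flipE-p-on-loop (sym on))
        ...   | here eq                         = contradiction (subst OnLoop (trans (sym (flipE-swap eq)) (flipE-involutive p)) on-V) p-off-loop
        ...   | there (here eq)                 = contradiction eq (flipE-free _)
        ...   | there (there (here eq))         = contradiction (trans (sym (cong sign eq)) sign-EVℓ)
                                                    λ s → sign-clash (signF face-ℓ sign-ℓ) s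
        ...   | there (there (there (here eq))) = eq

      -- The end of the loop at flipV ℓ would be a vertex of its own.
      not-orientable : ⊥
      not-orientable = missing (orbit-closed (_∈ two) closed
          (from (sameVertex (flipV ℓ) ℓ (linked _ _ (trans (on-face (onLoop⇒face _ on-V)) (sym (on-face face-ℓ)))))
                (trans (onLoop⇒base _ on-V) (sym (onLoop⇒base ℓ flipE-p-on-loop)))) (here refl))
        where
        two : List Flag
        two = flipV ℓ ∷ flipV (flipF ℓ) ∷ []
        closed : ∀ {m} → m ∈ flipE ∷ flipF ∷ [] → ∀ f → f ∈ two → m f ∈ two
        closed (here refl)         _ (here refl)         = there (here flipE-Vℓ)
        closed (here refl)         _ (there (here refl)) = here (flipE-swap flipE-Vℓ)
        closed (there (here refl)) _ (here refl)         = there (here (sym (flipVF-comm ℓ)))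
        closed (there (here refl)) _ (there (here refl)) =
          here (trans (sym (flipVF-comm (flipF ℓ))) (cong flipV (flipF-involutive ℓ)))
        missing : ¬ (ℓ ∈ two)
        missing (here eq)         = flipV-free ℓ (sym eq)
        missing (there (here eq)) = flipVF-free ℓ (sym eq)

  projective : ∀ f → Projective f
  projective f = record
    { faces         = 7
    ; edges         = 11
    ; vertices      = 5
    ; counts        = counts f
    ; euler         = refl
    ; nonOrientable = λ (sign , alternates) →
        not-orientable (component f) sign (λ g eq → alternates g (linked f g (sym eq)))
    }

-- The labelling of an arbitrary moduli space

-- Records rather than definitions, lest Agda compare graphs by unfolding them.
record IsFace (C : Cactus 7) (c : Face) : Set where
  constructor isFace
  field face-≅ : C ≅ᶜ rep c

record IsEdge (T : ColouredPlaneGraph) (e : Edge) : Set where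
  constructor isEdge
  field edge-≅ : T ≅₃ edgeGraph e

record IsVertex (S : PlaneGraph) (k : Fin 2) (v : Fin 5) : Set where
  constructor isVertex
  field vertex-≅ : S ≅ vertexGraph (k , v)

isFace-⇔ : ∀ {C D c d} → IsFace C c → IsFace D d → C ≅ᶜ D ⇔ c ≡ d
isFace-⇔ {C} {D} {c} {d} (isFace φ) (isFace ψ) = mk⇔
  (λ χ → rep-injective c d (≅ᶜ-trans {C = rep c} {C} {rep d} (≅ᶜ-inverse {C = C} {rep c} φ)
    (≅ᶜ-trans {C = C} {D} {rep d} χ ψ)))
  λ { refl → ≅ᶜ-trans {C = C} {rep c} {D} φ (≅ᶜ-inverse {C = D} {rep c} ψ) }

isEdge-⇔ : ∀ {T U e e′} → IsEdge T e → IsEdge U e′ → T ≅₃ U ⇔ e ≡ e′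
isEdge-⇔ {T} {U} {e} {e′} (isEdge φ) (isEdge ψ) = mk⇔
  (λ χ → edgeGraph-injective e e′ (≅₃-trans {edgeGraph e} {T} {edgeGraph e′} (≅₃-sym {T} {edgeGraph e} φ)
    (≅₃-trans {T} {U} {edgeGraph e′} χ ψ)))
  λ { refl → ≅₃-trans {T} {edgeGraph e} {U} φ (≅₃-sym {U} {edgeGraph e} ψ) }

isVertex-⇔ : ∀ {S S′ k v v′} → IsVertex S k v → IsVertex S′ k v′ → S ≅ S′ ⇔ v ≡ v′
isVertex-⇔ {S} {S′} {k} {v} {v′} (isVertex φ) (isVertex ψ) = mk⇔
  (λ χ → vertexGraph-injective k v v′ (≅-trans {vertexGraph (k , v)} {S} {vertexGraph (k , v′)}
    (≅-sym {S} {vertexGraph (k , v)} φ) (≅-trans {S} {S′} {vertexGraph (k , v′)} χ ψ)))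
  λ { refl → ≅-trans {S} {vertexGraph (k , v)} {S′} φ (≅-sym {S′} {vertexGraph (k , v)} ψ) }

open IsFace using (face-≅)
open _≅ᶜ_ using (relabel; cyclic)

border-edge : ∀ {C c T} (F : IsFace C c) x → T ≅₃ degenerate C x → IsEdge T (border c (relabel (face-≅ F) x))
border-edge {C} {c} {T} (isFace φ) x ψ = isEdge
  (≅₃-trans {T} {degenerate C x} {edgeGraph (border c (relabel φ x))} ψ (border-relabel {C} {c} φ x))

border-attained : ∀ {C c} → IsFace C c → ∀ x → ∃ λ y → ∀ {T} → T ≅₃ degenerate C y → IsEdge T (border c x)
-- The middle label sent to x: the cube of a cyclic relabelling is the identity, so its square is
-- its inverse.
border-attained {C} {c} (isFace φ) x = relabel φ (relabel φ x) , λ {T} ψ →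
  subst (λ y → IsEdge T (border c y)) (Cyclic.cyclic³ (relabel φ) (cyclic φ) x)
        (border-edge {C} {c} {T} (isFace φ) (relabel φ (relabel φ x)) ψ)

edge-ends : ∀ {T e S S′} → IsEdge T e → Contractions T S S′ →
  ∃ λ s → IsVertex S (proj₁ e) (end e s) × IsVertex S′ (proj₁ e) (end e (other s))
edge-ends {T} {e} {S} {S′} (isEdge φ) κ =
  let s , ψ , ψ′ = contractions-unique (rep (edgeFace e)) (edgeMiddle e) 0F {S} {S′}
                     (Contractions-to {T} {edgeGraph e} φ {S} {S′} κ)
  in s , isVertex (≅-trans {S} {contractedEdge e s} {vertexGraph (proj₁ e , end e s)} ψ (end-≅ e s))
       , isVertex (≅-trans {S′} {contractedEdge e (other s)} {vertexGraph (proj₁ e , end e (other s))} ψ′ (end-≅ e (other s)))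

module _ (M : ModuliSpace A₇-222) where
  open ModuliSpace M
  open Equivalence using (to; from)

  private
    opaque
      someFace : ∀ f → ∃ (IsFace (cactus f))
      someFace f = let c , φ = cactus-classification (cactus f) (cactus-in-class f) in c , isFace φ

    face : Flag → Face
    face f = proj₁ (someFace f)

    face-is : ∀ f → IsFace (cactus f) (face f)
    face-is f = proj₂ (someFace f)

    opaque
      someSide : ∀ f → ∃ λ x → IsEdge (degenerated f) (border (face f) x)
      someSide f = let x , φ = boundary⊆border f in _ , border-edge (face-is f) x φ

    edge : Flag → Edge
    edge f = border (face f) (proj₁ (someSide f))

    edge-is : ∀ f → IsEdge (degenerated f) (edge f)
    edge-is f = proj₂ (someSide f)

    component : Flag → Fin 2
    component f = proj₁ (face f)

    opaque
      someEnd : ∀ f → ∃ λ s → IsVertex (tree f) (component f) (end (edge f) s) ×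
                              IsVertex (tree (flipV f)) (component f) (end (edge f) (other s))
      someEnd f = edge-ends (edge-is f) (ends f)

    vertex : Flag → Fin 5
    vertex f = end (edge f) (proj₁ (someEnd f))

    vertex-is : ∀ f → IsVertex (tree f) (component f) (vertex f)
    vertex-is f = proj₁ (proj₂ (someEnd f))

    sameFace : ∀ f g → SameFace f g ⇔ face f ≡ face g
    sameFace f g = isFace-⇔ (face-is f) (face-is g) ⇔-∘ faces f g

    sameEdge : ∀ f g → SameEdge f g ⇔ edge f ≡ edge g
    sameEdge f g = isEdge-⇔ (edge-is f) (edge-is g) ⇔-∘ edges f g

    corner : ∀ f x → ∃ λ g → SameFace f g × edge g ≡ border (face f) x
    corner f x =
      let y , attained = border-attained (face-is f) x
          g , f~g , φ  = border⊆boundary f y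
      in g , f~g , to (isEdge-⇔ (edge-is g) (attained φ)) (≅₃-refl {degenerated g})

    realised : ∀ c → ∃ λ f → face f ≡ c
    realised c =
      let f , φ = cactus-onto (rep c) (rep-in-class c)
      in f , to (isFace-⇔ (face-is f) (isFace (≅ᶜ-refl {C = rep c}))) φ

    -- Trees are numbered relative to a component; comparing two of them requires that both carry
    -- the same component index.
    component-invariant : ∀ {f g} → SameComponent f g → component f ≡ component g
    component-invariant {f} path = sym (orbit-closed (λ g → component g ≡ component f) closed path refl)
      where
      closed : ∀ {m} → m ∈ flipV ∷ flipE ∷ flipF ∷ [] → ∀ g → component g ≡ component f → component (m g) ≡ component f
      closed (here refl)                 g = trans (cong proj₁ (sym (to (sameFace g (flipV g)) (orbit-move (here refl) g))))
      closed (there (here refl))         g = trans (cong proj₁ (sym (to (sameFace g (flipE g)) (orbit-move (there (here refl)) g))))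
      closed (there (there (here refl))) g = trans (cong proj₁ (sym (to (sameEdge g (flipF g)) (orbit-move (there (here refl)) g))))

    sameVertex : ∀ f g → SameComponent f g → SameVertex f g ⇔ vertex f ≡ vertex g
    sameVertex f g path = isVertex-⇔ (vertex-is f)
      (subst (λ k → IsVertex (tree g) k (vertex g)) (sym (component-invariant path)) (vertex-is g)) ⇔-∘ vertices f g path

    vertex-flipV : ∀ f → vertex (flipV f) ≡ end (edge f) (other (proj₁ (someEnd f)))
    vertex-flipV f = to (isVertex-⇔ (vertex-is (flipV f))
      (subst (λ k → IsVertex (tree (flipV f)) k (end (edge f) (other (proj₁ (someEnd f)))))
             (component-invariant (orbit-move (here refl) f)) (proj₂ (proj₂ (someEnd f)))))
      (≅-refl {tree (flipV f)})

  labelling : Labelling surfaceMap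
  labelling = record
    { face       = face
    ; edge       = edge
    ; vertex     = vertex
    ; sameFace   = sameFace
    ; sameEdge   = sameEdge
    ; incident   = λ f → proj₁ (someSide f) , refl
    ; corner     = corner
    ; realised   = realised
    ; sameVertex = sameVertex
    ; ends       = λ f → proj₁ (someEnd f) , refl , vertex-flipV f
    }

-- A moduli space

Contractions-≅ : ∀ {T S S′ R R′} → S ≅ R → S′ ≅ R′ → Contractions T S S′ → Contractions T R R′
Contractions-≅ {T} {S} {S′} {R} {R′} φ ψ (x , y , z , x≢y , x≢z , y≢z , m , κ , κ′) =
  x , y , z , x≢y , x≢z , y≢z , m , contraction-≅ {T} {x} {y} {S} {R} φ κ , contraction-≅ {T} {x} {z} {S′} {R′} ψ κ′

module ProjectivePlanes where

  -- The flags of an edge are numbered by the contracted side, which tells its ends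
  -- apart, and by the face.
  flagEdge : Fin 88 → Edge
  flagEdge f = let k , r = remQuot {2} 44 f in k , proj₁ (remQuot {11} 4 r)

  flagCorner : Fin 88 → Fin 2 × Fin 2
  flagCorner f = remQuot {2} 2 (proj₂ (remQuot {11} 4 (proj₂ (remQuot {2} 44 f))))

  flag : Edge → Fin 2 × Fin 2 → Fin 88
  flag (k , e) (s , b) = combine k (combine e (combine s b))

  swap₂ : Fin 2 → Fin 2
  swap₂ 0F = 1F
  swap₂ 1F = 0F

  side : Fin 2 → Side
  side 0F = toNext
  side 1F = toPrev

  -- The two faces in whose borders the edge occurs in `borderTable`; the loop has face 6 on both
  -- sides.
  edgeFaces : Vec (Vec (Vec (Fin 7) 2) 11) 2
  edgeFaces =
    ( (0F ∷ 5F ∷ []) ∷ (0F ∷ 4F ∷ []) ∷ (0F ∷ 1F ∷ []) ∷ (1F ∷ 6F ∷ []) ∷ (1F ∷ 2F ∷ []) ∷ (2F ∷ 6F ∷ [])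
    ∷ (2F ∷ 3F ∷ []) ∷ (3F ∷ 5F ∷ []) ∷ (3F ∷ 4F ∷ []) ∷ (4F ∷ 5F ∷ []) ∷ (6F ∷ 6F ∷ []) ∷ []) ∷
    ( (0F ∷ 4F ∷ []) ∷ (0F ∷ 3F ∷ []) ∷ (0F ∷ 1F ∷ []) ∷ (1F ∷ 5F ∷ []) ∷ (1F ∷ 2F ∷ []) ∷ (2F ∷ 5F ∷ [])
    ∷ (2F ∷ 6F ∷ []) ∷ (3F ∷ 6F ∷ []) ∷ (3F ∷ 4F ∷ []) ∷ (4F ∷ 5F ∷ []) ∷ (6F ∷ 6F ∷ []) ∷ []) ∷ []

  flagFace : Fin 88 → Face
  flagFace f = let k , e = flagEdge f in k , lookup (lookup (lookup edgeFaces k) e) (proj₂ (flagCorner f))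

  flagSide : Fin 88 → Side
  flagSide f = side (proj₁ (flagCorner f))

  flagVertex : Fin 88 → Vertex
  flagVertex f = proj₁ (flagEdge f) , end (flagEdge f) (flagSide f)

  flagV flagE flagF : Fin 88 → Fin 88
  flagV f = let s , b = flagCorner f in flag (flagEdge f) (swap₂ s , b)
  flagF f = let s , b = flagCorner f in flag (flagEdge f) (s , swap₂ b)
  -- Interchanges the two flags at a corner; they share face and vertex, which determines
  -- them except around the loops.
  flagE = lookup table
    where
    table : Vec (Fin 88) 88
    table =
      # 6 ∷ # 39 ∷ # 8 ∷ # 29 ∷ # 10 ∷ # 35 ∷ # 0 ∷ # 38 ∷
      # 2 ∷ # 12 ∷ # 4 ∷ # 18 ∷ # 9 ∷ # 23 ∷ # 16 ∷ # 40 ∷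
      # 14 ∷ # 20 ∷ # 11 ∷ # 26 ∷ # 17 ∷ # 43 ∷ # 24 ∷ # 13 ∷
      # 22 ∷ # 28 ∷ # 19 ∷ # 34 ∷ # 25 ∷ # 3 ∷ # 32 ∷ # 37 ∷
      # 30 ∷ # 36 ∷ # 27 ∷ # 5 ∷ # 33 ∷ # 31 ∷ # 7 ∷ # 1 ∷
      # 15 ∷ # 42 ∷ # 41 ∷ # 21 ∷ # 50 ∷ # 79 ∷ # 52 ∷ # 82 ∷
      # 54 ∷ # 72 ∷ # 44 ∷ # 78 ∷ # 46 ∷ # 56 ∷ # 48 ∷ # 62 ∷
      # 53 ∷ # 83 ∷ # 60 ∷ # 65 ∷ # 58 ∷ # 64 ∷ # 55 ∷ # 70 ∷
      # 61 ∷ # 59 ∷ # 68 ∷ # 81 ∷ # 66 ∷ # 84 ∷ # 63 ∷ # 73 ∷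
      # 49 ∷ # 71 ∷ # 76 ∷ # 87 ∷ # 74 ∷ # 80 ∷ # 51 ∷ # 45 ∷
      # 77 ∷ # 67 ∷ # 47 ∷ # 57 ∷ # 69 ∷ # 86 ∷ # 85 ∷ # 75 ∷ []

  projectivePlanes : SurfaceMap
  projectivePlanes = record
    { size             = 88
    ; flipV            = flagV
    ; flipE            = flagE
    ; flipF            = flagF
    ; flipV-involutive = decide (every? λ f → _ ≡? _) refl
    ; flipE-involutive = decide (every? λ f → _ ≡? _) refl
    ; flipF-involutive = decide (every? λ f → _ ≡? _) refl
    ; flipV-free       = decide (every? λ f → ¬? (_ ≡? _)) refl
    ; flipE-free       = decide (every? λ f → ¬? (_ ≡? _)) refl
    ; flipF-free       = decide (every? λ f → ¬? (_ ≡? _)) refl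
    ; flipVF-comm      = decide (every? λ f → _ ≡? _) refl
    ; flipVF-free      = decide (every? λ f → ¬? (_ ≡? _)) refl
    }

  alternate : {A : Set} (a b : A → A) → ℕ → A → A
  alternate a b zero    x = x
  alternate a b (suc n) x = alternate b a n (a x)

  alternate-orbit : {A : Set} (a b : A → A) → ∀ n x → Orbit (a ∷ b ∷ []) x (alternate a b n x)
  alternate-orbit a b zero          x = ε
  alternate-orbit a b (suc zero)    x = here refl ◅ ε
  alternate-orbit a b (suc (suc n)) x = here refl ◅ there (here refl) ◅ alternate-orbit a b n (b (a x))

  orbit-sym : {A : Set} {a b : A → A} → (∀ x → a (a x) ≡ x) → (∀ x → b (b x) ≡ x) →
    ∀ {x y} → Orbit (a ∷ b ∷ []) x y → Orbit (a ∷ b ∷ []) y x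
  orbit-sym {a = a} {b} a-involutive b-involutive = reverse λ
    { (here refl)         → here (a-involutive _)
    ; (there (here refl)) → there (here (b-involutive _))
    }

  -- Alternating two involutions runs through the orbit of the group they generate.
  module Classes {A : Set} {{_ : Searchable A}} (label : Fin 88 → A) (a b : Fin 88 → Fin 88) where

    record Separated : Set where
      constructor separated
      field
        invariant₁ : ∀ f → label (a f) ≡ label f
        invariant₂ : ∀ f → label (b f) ≡ label f
        -- Orbits have at most 14 flags, twice the largest degree 7 of a vertex, so fewer than 20
        -- alternations lead to any flag of an orbit.
        reach      : ∀ l → ∃ λ r → label r ≡ l × (∀ f → label f ≡ l → ∃ λ (n : Fin 20) → alternate a b (toℕ n) f ≡ r)

    separated? : Dec Separated
    separated? = map′ (λ (p , q , r) → separated p q r) (λ (separated p q r) → p , q , r)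
      ((every? λ f → label (a f) ≡? label f) ×-dec (every? λ f → label (b f) ≡? label f) ×-dec
       (every? λ l → some? λ r → (label r ≡? l) ×-dec
         every? λ f → (label f ≡? l) →-dec (some? λ n → alternate a b (toℕ n) f ≡? r)))

    module _ (a-involutive : ∀ f → a (a f) ≡ f) (b-involutive : ∀ f → b (b f) ≡ f) (S : Separated) where
      open Separated S

      to-root : ∀ f → Orbit (a ∷ b ∷ []) f (proj₁ (reach (label f)))
      to-root f = let n , alt = proj₂ (proj₂ (reach (label f))) f refl
                  in subst (Orbit (a ∷ b ∷ []) f) alt (alternate-orbit a b (toℕ n) f)

      classes-⇔ : ∀ f g → Orbit (a ∷ b ∷ []) f g ⇔ label f ≡ label g
      classes-⇔ f g = mk⇔ (λ path → sym (orbit-closed (λ h → label h ≡ label f) closed path refl))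
        (λ eq → to-root f ◅◅ subst (λ l → Orbit (a ∷ b ∷ []) (proj₁ (reach l)) g) (sym eq)
                                   (orbit-sym a-involutive b-involutive (to-root g)))
        where
        closed : ∀ {m} → m ∈ a ∷ b ∷ [] → ∀ h → label h ≡ label f → label (m h) ≡ label f
        closed (here refl)         h eq = trans (invariant₁ h) eq
        closed (there (here refl)) h eq = trans (invariant₂ h) eq

  module FaceClasses   = Classes flagFace flagV flagE
  module EdgeClasses   = Classes flagEdge flagV flagF
  module VertexClasses = Classes flagVertex flagE flagF

  opaque
    faces-separated : FaceClasses.Separated
    faces-separated = decide FaceClasses.separated? refl

    edges-separated : EdgeClasses.Separated
    edges-separated = decide EdgeClasses.separated? refl

    vertices-separated : VertexClasses.Separated
    vertices-separated = decide VertexClasses.separated? refl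

    flagEdge-border : ∀ f → ∃ λ x → border (flagFace f) x ≡ flagEdge f
    flagEdge-border = decide (every? λ f → some? λ x → _ ≡? _) refl

    border-flag : ∀ c x → ∃ λ f → c ≡ flagFace f × flagEdge f ≡ border c x
    border-flag = decide (every? λ c → every? λ x → some? λ f → (_ ≡? _) ×-dec (_ ≡? _)) refl

    flagVertex-component : ∀ f → proj₁ (flagVertex f) ≡ proj₁ (flagFace f)
    flagVertex-component = decide (every? λ f → _ ≡? _) refl

  open SurfaceMap projectivePlanes
    using (flipV; flipV-involutive; flipE-involutive; flipF-involutive; SameFace; SameEdge; SameVertex; SameComponent)

  opaque
    flagVertex-flipV : ∀ f → flagVertex (flipV f) ≡ (proj₁ (flagEdge f) , end (flagEdge f) (other (flagSide f)))
    flagVertex-flipV = decide (every? λ f → _ ≡? _) refl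

  sameFace-⇔ : ∀ f g → SameFace f g ⇔ flagFace f ≡ flagFace g
  sameFace-⇔ = FaceClasses.classes-⇔ flipV-involutive flipE-involutive faces-separated

  sameEdge-⇔ : ∀ f g → SameEdge f g ⇔ flagEdge f ≡ flagEdge g
  sameEdge-⇔ = EdgeClasses.classes-⇔ flipV-involutive flipF-involutive edges-separated

  sameVertex-⇔ : ∀ f g → SameVertex f g ⇔ flagVertex f ≡ flagVertex g
  sameVertex-⇔ = VertexClasses.classes-⇔ flipE-involutive flipF-involutive vertices-separated

  flag-component : ∀ {f g} → SameComponent f g → proj₁ (flagFace f) ≡ proj₁ (flagFace g)
  flag-component {f} path = sym (orbit-closed (λ h → proj₁ (flagFace h) ≡ proj₁ (flagFace f)) closed path refl)
    where
    closed : ∀ {m} → m ∈ flagV ∷ flagE ∷ flagF ∷ [] → ∀ h → proj₁ (flagFace h) ≡ proj₁ (flagFace f) →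
      proj₁ (flagFace (m h)) ≡ proj₁ (flagFace f)
    closed (here refl)                 h eq = trans (cong proj₁ (FaceClasses.Separated.invariant₁ faces-separated h)) eq
    closed (there (here refl))         h eq = trans (cong proj₁ (FaceClasses.Separated.invariant₂ faces-separated h)) eq
    closed (there (there (here refl))) h eq = trans (cong proj₁ (EdgeClasses.Separated.invariant₂ edges-separated h)) eq

  realised-face : ∀ c → ∃ λ f → flagFace f ≡ c
  realised-face c = let f , eq , _ = FaceClasses.Separated.reach faces-separated c in f , eq

  flag-isFace : ∀ c → IsFace (rep c) c
  flag-isFace c = isFace (≅ᶜ-refl {C = rep c})

  flag-isEdge : ∀ e → IsEdge (edgeGraph e) e
  flag-isEdge e = isEdge (≅₃-refl {edgeGraph e})

  flag-isVertex : ∀ k v → IsVertex (vertexGraph (k , v)) k v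
  flag-isVertex k v = isVertex (≅-refl {vertexGraph (k , v)})

  isVertex-Vertex : ∀ k (v : Vertex) → proj₁ v ≡ k → IsVertex (vertexGraph v) k (proj₂ v)
  isVertex-Vertex k (k , v) refl = flag-isVertex k v

  flag-sameVertex : ∀ f g → SameComponent f g → SameVertex f g ⇔ vertexGraph (flagVertex f) ≅ vertexGraph (flagVertex g)
  flag-sameVertex f g path =
    ⇔-sym (isVertex-⇔ (isVertex-Vertex k (flagVertex f) (flagVertex-component f))
                       (isVertex-Vertex k (flagVertex g) (trans (flagVertex-component g) (sym (flag-component path)))))
    ⇔-∘ (same-⇔ (flagVertex f) (flagVertex g) k≡ ⇔-∘ sameVertex-⇔ f g)
    where
    k : Fin 2
    k = proj₁ (flagFace f)
    k≡ : proj₁ (flagVertex f) ≡ proj₁ (flagVertex g)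
    k≡ = trans (flagVertex-component f) (trans (flag-component path) (sym (flagVertex-component g)))
    same-⇔ : ∀ (v w : Vertex) → proj₁ v ≡ proj₁ w → v ≡ w ⇔ proj₂ v ≡ proj₂ w
    same-⇔ (k , v) (k , w) refl = mk⇔ (cong proj₂) (cong (k ,_))

  edge-contractions : ∀ e s →
    Contractions (edgeGraph e) (vertexGraph (proj₁ e , end e s)) (vertexGraph (proj₁ e , end e (other s)))
  edge-contractions e s = Contractions-≅ {edgeGraph e} {contractedEdge e s} {contractedEdge e (other s)}
    {vertexGraph (proj₁ e , end e s)} {vertexGraph (proj₁ e , end e (other s))} (end-≅ e s) (end-≅ e (other s))
    (contractions (rep (edgeFace e)) (edgeMiddle e) s)

  cast-contractions : ∀ e v v′ w w′ → v ≡ v′ → w ≡ w′ →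
    Contractions (edgeGraph e) (vertexGraph v) (vertexGraph w) → Contractions (edgeGraph e) (vertexGraph v′) (vertexGraph w′)
  cast-contractions e v v w w refl refl κ = κ

  flag-ends : ∀ f → Contractions (edgeGraph (flagEdge f)) (vertexGraph (flagVertex f)) (vertexGraph (flagVertex (flipV f)))
  flag-ends f = cast-contractions (flagEdge f)
    (proj₁ (flagEdge f) , end (flagEdge f) (flagSide f)) (flagVertex f)
    (proj₁ (flagEdge f) , end (flagEdge f) (other (flagSide f))) (flagVertex (flipV f))
    refl (sym (flagVertex-flipV f)) (edge-contractions (flagEdge f) (flagSide f))

  rep-⇔ : ∀ c d → rep c ≅ᶜ rep d ⇔ c ≡ d
  rep-⇔ c d = isFace-⇔ {rep c} {rep d} (flag-isFace c) (flag-isFace d)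

  edgeGraph-⇔ : ∀ e e′ → edgeGraph e ≅₃ edgeGraph e′ ⇔ e ≡ e′
  edgeGraph-⇔ e e′ = isEdge-⇔ {edgeGraph e} {edgeGraph e′} (flag-isEdge e) (flag-isEdge e′)

  border-isEdge : ∀ c x → IsEdge (degenerate (rep c) x) (border c x)
  border-isEdge c x = isEdge (border-≅ c x)

  edgeGraph-border-⇔ : ∀ e c x → edgeGraph e ≅₃ degenerate (rep c) x ⇔ e ≡ border c x
  edgeGraph-border-⇔ e c x = isEdge-⇔ {edgeGraph e} {degenerate (rep c) x} {e} {border c x} (flag-isEdge e) (border-isEdge c x)

  flag-faces : ∀ f g → SameFace f g ⇔ rep (flagFace f) ≅ᶜ rep (flagFace g)
  flag-faces f g = ⇔-sym (rep-⇔ (flagFace f) (flagFace g)) ⇔-∘ sameFace-⇔ f g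

  flag-edges : ∀ f g → SameEdge f g ⇔ edgeGraph (flagEdge f) ≅₃ edgeGraph (flagEdge g)
  flag-edges f g = ⇔-sym (edgeGraph-⇔ (flagEdge f) (flagEdge g)) ⇔-∘ sameEdge-⇔ f g

  flag-cactus-onto : ∀ C → A₇-222 C → ∃ λ f → rep (flagFace f) ≅ᶜ C
  flag-cactus-onto C C-in-class =
    let c , φ = cactus-classification C C-in-class
        f , eq = realised-face c
    in f , Equivalence.from (isFace-⇔ {rep (flagFace f)} {C} (flag-isFace (flagFace f)) (isFace φ)) eq

  flag-boundary : ∀ f → ∃ λ x → edgeGraph (flagEdge f) ≅₃ degenerate (rep (flagFace f)) x
  flag-boundary f =
    let x , eq = flagEdge-border f
    in x , Equivalence.from (edgeGraph-border-⇔ (flagEdge f) (flagFace f) x) (sym eq)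

  flag-border : ∀ f x → ∃ λ g → SameFace f g × edgeGraph (flagEdge g) ≅₃ degenerate (rep (flagFace f)) x
  flag-border f x =
    let g , face≡ , edge≡ = border-flag (flagFace f) x
    in g , Equivalence.from (sameFace-⇔ f g) face≡ ,
       Equivalence.from (edgeGraph-border-⇔ (flagEdge g) (flagFace f) x) edge≡

  moduliSpace : ModuliSpace A₇-222
  moduliSpace = record
    { surfaceMap      = projectivePlanes
    ; cactus          = λ f → rep (flagFace f)
    ; cactus-in-class = λ f → rep-in-class (flagFace f)
    ; cactus-onto     = flag-cactus-onto
    ; faces           = flag-faces
    ; degenerated     = λ f → edgeGraph (flagEdge f)
    ; edges           = flag-edges
    ; boundary⊆border = flag-boundary
    ; border⊆boundary = flag-border
    ; tree            = λ f → vertexGraph (flagVertex f)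
    ; vertices        = flag-sameVertex
    ; ends            = flag-ends
    }

theorem6p1 : ModuliSpace A₇-222 ×
    (∀ (M : ModuliSpace A₇-222) → let open ModuliSpace M in
    HasClasses Flag SameComponent 2 ×
    (∀ (f : Flag) → Projective f × HasCounts f 7 11 5))
theorem6p1 = ProjectivePlanes.moduliSpace , λ M →
  let open Labelled (ModuliSpace.surfaceMap M) (labelling M)
  in components , λ f → projective f , counts f
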